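{- Let $n\ge 3$ and let $\lambda=(\lambda_1,\lambda_2)$ be a two-row partition of $n$ ($\lambda_1\ge\lambda_2\ge 1$). Then the $[1,n]$-labeled graph $\overline{\Gamma}_\lambda=(\mathrm{RSYT}(\lambda),m,\overline{\mathrm{des}})$ is a $\overline{\mathcal S_n}$-graph, i.e. a $W$-graph for the affine symmetric group $W=\overline{\mathcal S_n}$.
   Context: **Residues and cyclic intervals.** For $k\in\mathbb Z$, $\overline{k}$ is the unique element of $\{1,\dots,n\}$ congruent to $k$ modulo $n$; $[a,b]=\{x\in\mathbb Z\mid a\le x\le b\}$. For $a,b\in\{1,\dots,n\}$, $\langle a,b\rangle\subset\{1,\dots,n\}$ is $\emptyset$ if $a=\overline{b+1}$, and otherwise is the cyclic interval $\{a,\overline{a+1},\dots,b\}$ (start at $a$, add $1$ modulo $n$ until reaching $b$). **Groups.** $\overline{\mathcal S_n}$ is the affine symmetric group, a Coxeter group with simple reflections $s_0=s_n,s_1,\dots,s_{n-1}$ whose Dynkin diagram is the cycle of type $\widetilde A_{n-1}$ ($s_i$ adjacent to $s_{i\pm1}$, indices mod $n$). Simple reflections are identified with $[1,n]$ via $s_i\leftrightarrow i$. **Tableaux.** $\mathrm{RSYT}(\lambda)$ is the set of fillings of the Young diagram of $\lambda$ (English convention) by $1,\dots,n$, each used once, with rows increasing; $T^1$ (top row) and $T^2$ denote the rows of $T$, regarded as sets. Whenever entries are interchanged, rows are re-sorted. $\overline{\mathrm{des}}(T)=\{i\in[1,n]\mid i\text{ lies in a strictly higher row of }T\text{ than }\overline{i+1}\}$.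 **Labeled graphs and $W$-graphs.** For a Coxeter group $W$ with simple reflections $I$, an $I$-labeled graph $(V,m,\tau)$ consists of a set $V$, maps $m:V\times V\to\mathbb Z[q^{\pm1/2}]$ (written $m(u\triangleright v)$) and $\tau:V\to\{\text{subsets of }I\}$, such that for each $v$ only finitely many $w$ have $m(v\triangleright w)\ne0$ or $m(w\triangleright v)\neq0$. Let $\mathcal H_W$ be the Iwahori–Hecke algebra over $\mathbb Z[q^{\pm1/2}]$ with generators $T_i$ ($i\in I$) satisfying the braid relations and $(T_i-q)(T_i+1)=0$. The graph is a $W$-graph if the formulas $T_i(u)=qu$ if $i\notin\tau(u)$, and $T_i(u)=-u+q^{1/2}\sum_{v:\,i\notin\tau(v)}m(u\triangleright v)\,v$ if $i\in\tau(u)$, define an $\mathcal H_W$-module structure on $\bigoplus_{v\in V}\mathbb Z[q^{\pm1/2}]v$. **The graph $\overline\Gamma_\lambda$.** Its vertex set is $\mathrm{RSYT}(\lambda)$, $\tau=\overline{\mathrm{des}}$, and $m(s\triangleright t)\in\{0,1\}$ with $m(s\triangleright t)=1$ iff there is a move from $s$ to $t$ of one of the following kinds. 1. (First kind) $t$ is obtained from $s$ by interchanging $\overline i$ and $\overline{i+1}$, where $\overline i\in s^1$ and $\overline{i+1}\in s^2$. 2. (Second kind) $t$ is obtained from $s$ by interchanging $\overline i$ and $\overline j$, where $\overline i\in s^2$, $\overline j\in s^1$, $\overline i\ne\overline{j+1}$, and: (a) $\overline{j-i}$ is odd; (b) $\overline{i+1}\in s^1$ and $\overline{j-1}\in s^2$;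 (c) $\overline{i-1}\in s^1$ or $\overline{j+1}\in s^2$; (d) $\#(s^2\cap\langle\overline{j-1-2k},\overline{j-2}\rangle)\ge k$ for all $k\in\{1,\dots,\frac{\overline{j-i}-3}{2}\}$; (e) $\#(s^2\cap\langle\overline{i+2},\overline{j-2}\rangle)=\frac{\overline{j-i}-3}{2}$ when $\overline j\ne\overline{i+1}$. -}

module Defs where

open import Algebra.Bundles using (CommutativeRing; Ring)
open import Algebra.Module.Structures using (IsLeftModule)
import Algebra.Properties.Ring as RingProperties
open import Data.Bool.Base using (if_then_else_; true; false)
import Data.Bool.Properties as Bool
open import Data.Empty using (⊥-elim)
import Data.Empty.Irrelevant as Irrelevant
open import Data.Fin.Base as Fin using (Fin; toℕ; fromℕ<)
import Data.Fin.Permutation.Components as Perm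
import Data.Fin.Properties as Fin
open import Data.Fin.Subset using (Subset; ⁅_⁆; ⋃; ⊥; _∩_; ∣_∣; _∈_)
open import Data.Fin.Subset.Properties using (_∈?_)
open import Data.Integer.Base as ℤ using (ℤ; 0ℤ; 1ℤ; +_)
open import Data.Integer.DivMod using (n%ℕd<d)
import Data.Integer.Properties as ℤ
open import Data.List.Base using (List; []; _∷_; _++_; map; concatMap; [_]; allFin; cartesianProduct; cartesianProductWith)
import Data.List.Membership.Propositional as List
open import Data.List.Membership.Propositional.Properties
  using (∈-concatMap⁺; ∈-cartesianProduct⁺; ∈-cartesianProductWith⁺; ∈-allFin; ∈-++⁺ˡ; ∈-++⁺ʳ)
import Data.List.Properties as List
open import Data.List.Relation.Unary.Any using (here; there)
import Data.List.Relation.Unary.Any as Any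
open import Data.Nat.Base as ℕ using (ℕ; zero; suc; NonZero; _≤_)
open import Data.Nat.Divisibility using (_∣_; _∣?_)
import Data.Nat.Properties as ℕ
open import Data.Product.Base using (∃; ∃₂; _×_; _,_; proj₁; proj₂)
open import Data.Sum.Base using (_⊎_; inj₁; inj₂; swap)
open import Data.Vec.Base as Vec using (Vec)
import Data.Vec.Properties as Vec
open import Data.Vec.Relation.Unary.Linked using (Linked; linked?)
open import Relation.Binary.Definitions using (DecidableEquality)
open import Relation.Binary.PropositionalEquality
  using (_≡_; _≢_; refl; sym; trans; cong; cong₂; module ≡-Reasoning)
open import Relation.Nullary using (¬_; Dec; yes; no; does)
open import Relation.Nullary.Decidable
  using (map′; _×-dec_; _⊎-dec_; _→-dec_; ¬?)

module Laurent where

  -- A pair (c , e) stands for c·q^(e/2), so exponents count powers of q^(1/2);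
  -- a list stands for the sum of its terms, which may repeat exponents.
  Term : Set
  Term = ℤ × ℤ

  Laurent : Set
  Laurent = List Term

  coeffTerm : Term → ℤ → ℤ
  coeffTerm (c , e) k = if does (e ℤ.≟ k) then c else 0ℤ

  coeff : Laurent → ℤ → ℤ
  coeff []      k = 0ℤ
  coeff (x ∷ p) k = coeffTerm x k ℤ.+ coeff p k

  infix 4 _≈_
  record _≈_ (p r : Laurent) : Set where
    constructor mk≈
    field coeff-≡ : ∀ k → coeff p k ≡ coeff r k
  open _≈_ public

  infixl 6 _+_
  infixl 7 _*_ _·_
  infix 8 -_

  _·_ : Term → Term → Term
  (c , e) · (d , f) = c ℤ.* d , e ℤ.+ f

  _+_ _*_ : Laurent → Laurent → Laurent
  p + r = p ++ r
  p * r = concatMap (λ x → map (x ·_) r) p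

  -_ : Laurent → Laurent
  - p = map (λ (c , e) → ℤ.- c , e) p

  0# 1# : Laurent
  0# = []
  1# = [ 1ℤ , 0ℤ ]

  private
    coeff-+ : ∀ p r k → coeff (p + r) k ≡ coeff p k ℤ.+ coeff r k
    coeff-+ []      r k = sym (ℤ.+-identityˡ _)
    coeff-+ (x ∷ p) r k =
      trans (cong (λ z → coeffTerm x k ℤ.+ z) (coeff-+ p r k)) (sym (ℤ.+-assoc (coeffTerm x k) _ _))

    coeff-- : ∀ p k → coeff (- p) k ≡ ℤ.- coeff p k
    coeff-- []            k = refl
    coeff-- ((c , e) ∷ p) k =
      trans (cong₂ ℤ._+_ (lemma (e ℤ.≟ k)) (coeff-- p k)) (sym (ℤ.neg-distrib-+ (coeffTerm (c , e) k) _))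
      where
      lemma : (d : Dec (e ≡ k)) → (if does d then ℤ.- c else 0ℤ) ≡ ℤ.- (if does d then c else 0ℤ)
      lemma (yes _) = refl
      lemma (no _)  = refl

    coeffTerm-· : ∀ c e d f k → coeffTerm ((c , e) · (d , f)) k ≡ c ℤ.* coeffTerm (d , f) (k ℤ.- e)
    coeffTerm-· c e d f k = lemma (e ℤ.+ f ℤ.≟ k) (f ℤ.≟ k ℤ.- e)
      where
      open ≡-Reasoning
      to : e ℤ.+ f ≡ k → f ≡ k ℤ.- e
      to refl = begin
        f                       ≡⟨ ℤ.+-identityʳ f ⟨
        f ℤ.+ 0ℤ                ≡⟨ cong (λ z → f ℤ.+ z) (ℤ.+-inverseʳ e) ⟨
        f ℤ.+ (e ℤ.- e)         ≡⟨ ℤ.+-assoc f e _ ⟨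
        f ℤ.+ e ℤ.- e           ≡⟨ cong (ℤ._- e) (ℤ.+-comm f e) ⟩
        e ℤ.+ f ℤ.- e           ∎
      from : f ≡ k ℤ.- e → e ℤ.+ f ≡ k
      from refl = begin
        e ℤ.+ (k ℤ.- e)         ≡⟨ ℤ.+-comm e _ ⟩
        k ℤ.- e ℤ.+ e           ≡⟨ ℤ.+-assoc k _ e ⟩
        k ℤ.+ (ℤ.- e ℤ.+ e)     ≡⟨ cong (λ z → k ℤ.+ z) (ℤ.+-inverseˡ e) ⟩
        k ℤ.+ 0ℤ                ≡⟨ ℤ.+-identityʳ k ⟩
        k                       ∎
      lemma : (a : Dec (e ℤ.+ f ≡ k)) (b : Dec (f ≡ k ℤ.- e)) →
              (if does a then c ℤ.* d else 0ℤ) ≡ c ℤ.* (if does b then d else 0ℤ)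
      lemma (yes _) (yes _) = refl
      lemma (yes p) (no ¬q) = ⊥-elim (¬q (to p))
      lemma (no ¬p) (yes q) = ⊥-elim (¬p (from q))
      lemma (no _)  (no _)  = sym (ℤ.*-zeroʳ c)

    coeff-map-· : ∀ c e r k → coeff (map ((c , e) ·_) r) k ≡ c ℤ.* coeff r (k ℤ.- e)
    coeff-map-· c e []            k = sym (ℤ.*-zeroʳ c)
    coeff-map-· c e ((d , f) ∷ r) k =
      trans (cong₂ ℤ._+_ (coeffTerm-· c e d f k) (coeff-map-· c e r k))
            (sym (ℤ.*-distribˡ-+ c (coeffTerm (d , f) (k ℤ.- e)) _))

    ·-comm : ∀ x y → x · y ≡ y · x
    ·-comm (c , e) (d , f) = cong₂ _,_ (ℤ.*-comm c d) (ℤ.+-comm e f)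

    ·-assoc : ∀ x y z → (x · y) · z ≡ x · (y · z)
    ·-assoc (c , e) (d , f) (b , g) = cong₂ _,_ (ℤ.*-assoc c d b) (ℤ.+-assoc e f g)

    map-· : ∀ x r s → map (x ·_) r * s ≡ map (x ·_) (r * s)
    map-· x r s = begin
      concatMap (λ y → map (y ·_) s) (map (x ·_) r)   ≡⟨ List.concatMap-map _ (x ·_) r ⟩
      concatMap (λ y → map ((x · y) ·_) s) r          ≡⟨ List.concatMap-cong (λ y →
                                                           trans (List.map-cong (·-assoc x y) s) (List.map-∘ s)) r ⟩
      concatMap (λ y → map (x ·_) (map (y ·_) s)) r   ≡⟨ List.map-concatMap (x ·_) _ r ⟨
      map (x ·_) (r * s)                              ∎
      where open ≡-Reasoning

    +-middle : ∀ a b c → a ℤ.+ (b ℤ.+ c) ≡ b ℤ.+ (a ℤ.+ c)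
    +-middle a b c = trans (sym (ℤ.+-assoc a b c))
                    (trans (cong (ℤ._+ c) (ℤ.+-comm a b)) (ℤ.+-assoc b a c))

    coeff-*-[] : ∀ p k → coeff (p * []) k ≡ 0ℤ
    coeff-*-[] []      k = refl
    coeff-*-[] (x ∷ p) k = coeff-*-[] p k

    coeff-*-∷ : ∀ p y r k → coeff (p * (y ∷ r)) k ≡ coeff (map (y ·_) p) k ℤ.+ coeff (p * r) k
    coeff-*-∷ []      y r k = refl
    coeff-*-∷ (x ∷ p) y r k = begin
      coeffTerm (x · y) k ℤ.+ coeff (map (x ·_) r + p * (y ∷ r)) k
        ≡⟨ cong₂ ℤ._+_ (cong (λ z → coeffTerm z k) (·-comm x y)) (coeff-+ (map (x ·_) r) _ k) ⟩
      a ℤ.+ (b ℤ.+ coeff (p * (y ∷ r)) k)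
        ≡⟨ cong (λ z → a ℤ.+ (b ℤ.+ z)) (coeff-*-∷ p y r k) ⟩
      a ℤ.+ (b ℤ.+ (c ℤ.+ coeff (p * r) k))
        ≡⟨ cong (λ z → a ℤ.+ z) (+-middle b c _) ⟩
      a ℤ.+ (c ℤ.+ (b ℤ.+ coeff (p * r) k))
        ≡⟨ ℤ.+-assoc a c _ ⟨
      a ℤ.+ c ℤ.+ (b ℤ.+ coeff (p * r) k)
        ≡⟨ cong (λ z → a ℤ.+ c ℤ.+ z) (coeff-+ (map (x ·_) r) (p * r) k) ⟨
      a ℤ.+ c ℤ.+ coeff (map (x ·_) r + p * r) k ∎
      where
      open ≡-Reasoning
      a = coeffTerm (y · x) k
      b = coeff (map (x ·_) r) k
      c = coeff (map (y ·_) p) k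

    comm : ∀ p r → p * r ≈ r * p
    comm p r .coeff-≡ k = go r
      where
      go : ∀ r → coeff (p * r) k ≡ coeff (r * p) k
      go []      = coeff-*-[] p k
      go (y ∷ r) = trans (coeff-*-∷ p y r k)
                  (trans (cong (λ z → coeff (map (y ·_) p) k ℤ.+ z) (go r))
                         (sym (coeff-+ (map (y ·_) p) (r * p) k)))

    congˡ : ∀ p {r s} → r ≈ s → p * r ≈ p * s
    congˡ p {r} {s} eq .coeff-≡ k = go p
      where
      go : ∀ p → coeff (p * r) k ≡ coeff (p * s) k
      go []            = refl
      go ((c , e) ∷ p) = begin
        coeff (map ((c , e) ·_) r + p * r) k               ≡⟨ coeff-+ (map ((c , e) ·_) r) _ k ⟩
        coeff (map ((c , e) ·_) r) k ℤ.+ coeff (p * r) k   ≡⟨ cong₂ ℤ._+_ lemma (go p) ⟩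
        coeff (map ((c , e) ·_) s) k ℤ.+ coeff (p * s) k   ≡⟨ coeff-+ (map ((c , e) ·_) s) _ k ⟨
        coeff (map ((c , e) ·_) s + p * s) k               ∎
        where
        open ≡-Reasoning
        lemma : coeff (map ((c , e) ·_) r) k ≡ coeff (map ((c , e) ·_) s) k
        lemma = trans (coeff-map-· c e r k)
               (trans (cong (λ z → c ℤ.* z) (coeff-≡ eq (k ℤ.- e))) (sym (coeff-map-· c e s k)))

    reflexive : ∀ {p r} → p ≡ r → p ≈ r
    reflexive refl = mk≈ (λ _ → refl)

    ≈-trans : ∀ {p r s} → p ≈ r → r ≈ s → p ≈ s
    ≈-trans eq eq′ = mk≈ (λ k → trans (coeff-≡ eq k) (coeff-≡ eq′ k))

    +-cong : ∀ {p p′ r r′} → p ≈ p′ → r ≈ r′ → p + r ≈ p′ + r′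
    +-cong {p} {p′} {r} {r′} eq eq′ = mk≈ λ k →
      trans (coeff-+ p r k) (trans (cong₂ ℤ._+_ (coeff-≡ eq k) (coeff-≡ eq′ k)) (sym (coeff-+ p′ r′ k)))

    +-comm : ∀ p r → p + r ≈ r + p
    +-comm p r = mk≈ λ k →
      trans (coeff-+ p r k) (trans (ℤ.+-comm (coeff p k) _) (sym (coeff-+ r p k)))

    -‿cong : ∀ {p r} → p ≈ r → - p ≈ - r
    -‿cong {p} {r} eq = mk≈ λ k →
      trans (coeff-- p k) (trans (cong (λ z → ℤ.- z) (coeff-≡ eq k)) (sym (coeff-- r k)))

    -‿inverseʳ : ∀ p → p + - p ≈ 0#
    -‿inverseʳ p = mk≈ λ k →
      trans (coeff-+ p (- p) k) (trans (cong (λ z → coeff p k ℤ.+ z) (coeff-- p k)) (ℤ.+-inverseʳ (coeff p k)))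

    *-assoc : ∀ p r s → (p * r) * s ≡ p * (r * s)
    *-assoc []      r s = refl
    *-assoc (x ∷ p) r s =
      trans (List.concatMap-++ (λ y → map (y ·_) s) (map (x ·_) r) (p * r))
            (cong₂ _++_ (map-· x r s) (*-assoc p r s))

    *-cong : ∀ {p p′ r r′} → p ≈ p′ → r ≈ r′ → p * r ≈ p′ * r′
    *-cong {p} {p′} {r} {r′} eq eq′ =
      ≈-trans (congˡ p eq′) (≈-trans (comm p r′) (≈-trans (congˡ r′ eq) (comm r′ p′)))

    *-identityˡ : ∀ p → 1# * p ≈ p
    *-identityˡ p = reflexive (trans (List.++-identityʳ _)
      (trans (List.map-cong (λ (c , e) → cong₂ _,_ (ℤ.*-identityˡ c) (ℤ.+-identityˡ e)) p) (List.map-id p)))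

    distribʳ : ∀ s p r → (p + r) * s ≈ p * s + r * s
    distribʳ s p r = reflexive (List.concatMap-++ (λ y → map (y ·_) s) p r)

  commutativeRing : CommutativeRing _ _
  commutativeRing = record
    { Carrier = Laurent ; _≈_ = _≈_ ; _+_ = _+_ ; _*_ = _*_ ; -_ = -_ ; 0# = 0# ; 1# = 1#
    ; isCommutativeRing = record
      { isRing = record
        { +-isAbelianGroup = record
          { isGroup = record
            { isMonoid = record
              { isSemigroup = record
                { isMagma = record
                  { isEquivalence = record
                    { refl  = mk≈ (λ _ → refl)
                    ; sym   = λ eq → mk≈ (λ k → sym (coeff-≡ eq k))
                    ; trans = ≈-trans
                    }
                  ; ∙-cong = +-cong
                  }
                ; assoc = λ p r s → reflexive (List.++-assoc p r s)
                }
              ; identity = (λ p → reflexive refl) , (λ p → reflexive (List.++-identityʳ p))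
              }
            ; inverse = (λ p → ≈-trans (+-comm (- p) p) (-‿inverseʳ p)) , -‿inverseʳ
            ; ⁻¹-cong = -‿cong
            }
          ; comm = +-comm
          }
        ; *-cong = *-cong
        ; *-assoc = λ p r s → reflexive (*-assoc p r s)
        ; *-identity = *-identityˡ , (λ p → ≈-trans (comm p 1#) (*-identityˡ p))
        ; distrib = (λ s p r → ≈-trans (comm s (p + r)) (≈-trans (distribʳ s p r)
                                 (+-cong (comm p s) (comm r s)))) , distribʳ
        }
      ; *-comm = comm
      }
    }

  q½ q : Laurent
  q½ = [ 1ℤ , 1ℤ ]
  q  = q½ * q½

open Laurent using (Laurent; q½; q)
private
  module A = CommutativeRing Laurent.commutativeRing
  module AP = RingProperties A.ring

-- A Coxeter system of rank r, with simple reflections Fin r.  The value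
-- m i j = 0 encodes m i j = ∞.
record CoxeterMatrix (r : ℕ) : Set where
  field
    m          : Fin r → Fin r → ℕ
    m-sym      : ∀ i j → m i j ≡ m j i
    m-diagonal : ∀ i → m i i ≡ 1
    m-offDiag  : ∀ i j → i ≢ j → m i j ≢ 1

module Hecke {r : ℕ} (C : CoxeterMatrix r) where
  open CoxeterMatrix C

  infixl 6 _+_
  infixl 7 _*_
  infix 8 -_

  data Expr : Set where
    const   : Laurent → Expr
    T       : Fin r → Expr
    _+_ _*_ : Expr → Expr → Expr
    -_      : Expr → Expr

  0# 1# : Expr
  0# = const A.0#
  1# = const A.1#

  -- T i · T j · T i · ⋯ with k factors.
  alternating : ℕ → Fin r → Fin r → Expr
  alternating zero    i j = 1#
  alternating (suc k) i j = T i * alternating k j i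

  infix 4 _≈_

  -- The least congruence making Expr an associative unital algebra over the
  -- Laurent polynomials in which the Hecke relations hold.
  data _≈_ : Expr → Expr → Set where
    ≈-refl      : ∀ {x} → x ≈ x
    ≈-sym       : ∀ {x y} → x ≈ y → y ≈ x
    ≈-trans     : ∀ {x y z} → x ≈ y → y ≈ z → x ≈ z
    +-cong      : ∀ {x x′ y y′} → x ≈ x′ → y ≈ y′ → x + y ≈ x′ + y′
    *-cong      : ∀ {x x′ y y′} → x ≈ x′ → y ≈ y′ → x * y ≈ x′ * y′
    -‿cong      : ∀ {x y} → x ≈ y → - x ≈ - y
    +-assoc     : ∀ x y z → (x + y) + z ≈ x + (y + z)
    +-comm      : ∀ x y → x + y ≈ y + x
    +-identityˡ : ∀ x → 0# + x ≈ x
    -‿inverseˡ  : ∀ x → - x + x ≈ 0#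
    *-assoc     : ∀ x y z → (x * y) * z ≈ x * (y * z)
    *-identityˡ : ∀ x → 1# * x ≈ x
    *-identityʳ : ∀ x → x * 1# ≈ x
    distribˡ    : ∀ x y z → x * (y + z) ≈ x * y + x * z
    distribʳ    : ∀ x y z → (y + z) * x ≈ y * x + z * x

    const-cong    : ∀ {a b} → a A.≈ b → const a ≈ const b
    const-+       : ∀ a b → const (a A.+ b) ≈ const a + const b
    const-*       : ∀ a b → const (a A.* b) ≈ const a * const b
    const-central : ∀ a x → const a * x ≈ x * const a

    quadratic : ∀ i → (T i + - const q) * (T i + 1#) ≈ 0#
    -- Vacuous when m i j = 0, so no relation is imposed for m i j = ∞.
    braid     : ∀ i j → alternating (m i j) i j ≈ alternating (m i j) j i

  ring : Ring _ _
  ring = record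
    { Carrier = Expr ; _≈_ = _≈_ ; _+_ = _+_ ; _*_ = _*_ ; -_ = -_ ; 0# = 0# ; 1# = 1#
    ; isRing = record
      { +-isAbelianGroup = record
        { isGroup = record
          { isMonoid = record
            { isSemigroup = record
              { isMagma = record
                { isEquivalence = record { refl = ≈-refl ; sym = ≈-sym ; trans = ≈-trans }
                ; ∙-cong = +-cong
                }
              ; assoc = +-assoc
              }
            ; identity = +-identityˡ , (λ x → ≈-trans (+-comm x 0#) (+-identityˡ x))
            }
          ; inverse = -‿inverseˡ , (λ x → ≈-trans (+-comm x (- x)) (-‿inverseˡ x))
          ; ⁻¹-cong = -‿cong
          }
        ; comm = +-comm
        }
      ; *-cong = *-cong
      ; *-assoc = *-assoc
      ; *-identity = *-identityˡ , *-identityʳ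
      ; distrib = distribˡ , distribʳ
      }
    }

record LabeledGraph (r : ℕ) : Set₁ where
  infix 4 _≟_
  field
    V             : Set
    _≟_           : DecidableEquality V
    m             : V → V → Laurent
    τ             : V → Subset r
    locallyFinite : ∀ v → ∃ λ (ws : List V) → ∀ w → w List.∉ ws → m v w A.≈ A.0# × m w v A.≈ A.0#

-- ⨁_{v ∈ V} ℤ[q^{±1/2}] v, as finitely supported functions on V.
module FreeModule {V : Set} (_≟_ : DecidableEquality V) where

  record Free : Set where
    field
      coeff   : V → Laurent
      support : ∃ λ (ws : List V) → ∀ w → w List.∉ ws → coeff w A.≈ A.0#
  open Free public

  infix 4 _≈ᴹ_
  record _≈ᴹ_ (x y : Free) : Set where
    constructor mk≈ᴹ
    field coeff-≈ : ∀ v → coeff x v A.≈ coeff y v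
  open _≈ᴹ_ public

  infixl 6 _+ᴹ_
  infixr 7 _*ₗ_
  infix 8 -ᴹ_

  _+ᴹ_ : Free → Free → Free
  (x +ᴹ y) .coeff v = coeff x v A.+ coeff y v
  (x +ᴹ y) .support = proj₁ (support x) ++ proj₁ (support y) , λ w w∉ →
    A.trans (A.+-cong (proj₂ (support x) w (λ w∈ → w∉ (∈-++⁺ˡ w∈)))
                      (proj₂ (support y) w (λ w∈ → w∉ (∈-++⁺ʳ (proj₁ (support x)) w∈))))
            (A.+-identityˡ A.0#)

  0ᴹ : Free
  0ᴹ .coeff v = A.0#
  0ᴹ .support = [] , λ _ _ → A.refl

  -ᴹ_ : Free → Free
  (-ᴹ x) .coeff v = A.- coeff x v
  (-ᴹ x) .support = proj₁ (support x) , λ w w∉ →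
    A.trans (A.-‿cong (proj₂ (support x) w w∉)) AP.-0#≈0#

  _*ₗ_ : Laurent → Free → Free
  (a *ₗ x) .coeff v = a A.* coeff x v
  (a *ₗ x) .support = proj₁ (support x) , λ w w∉ →
    A.trans (A.*-congˡ {a} (proj₂ (support x) w w∉)) (A.zeroʳ a)

  basis : V → Free
  basis u .coeff v = if does (u ≟ v) then A.1# else A.0#
  basis u .support = u ∷ [] , λ w w∉ → outside w w∉ (u ≟ w)
    where
    outside : ∀ w → w List.∉ (u ∷ []) → (d : Dec (u ≡ w)) → (if does d then A.1# else A.0#) A.≈ A.0#
    outside w w∉ (yes refl) = ⊥-elim (w∉ (here refl))
    outside w w∉ (no _)     = A.refl

module WGraph {r : ℕ} (C : CoxeterMatrix r) (Γ : LabeledGraph r) where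
  open LabeledGraph Γ
  open FreeModule _≟_ public
  module H = Hecke C

  -- Σ_{v : i ∉ τ(v)} m(u ▹ v) v
  neighbours : Fin r → V → Free
  neighbours i u .coeff v = if does (i ∈? τ v) then A.0# else m u v
  neighbours i u .support = proj₁ (locallyFinite u) , λ w w∉ →
    outside (does (i ∈? τ w)) (proj₁ (proj₂ (locallyFinite u) w w∉))
    where
    outside : ∀ b {a} → a A.≈ A.0# → (if b then A.0# else a) A.≈ A.0#
    outside true  _  = A.refl
    outside false eq = eq

  T-basis : Fin r → V → Free
  T-basis i u = if does (i ∈? τ u)
    then -ᴹ basis u +ᴹ q½ *ₗ neighbours i u
    else q *ₗ basis u

  record IsWGraph : Set where
    infixr 7 _∙_
    field
      _∙_          : H.Expr → Free → Free
      isLeftModule : IsLeftModule H.ring _≈ᴹ_ _+ᴹ_ 0ᴹ -ᴹ_ _∙_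
      const-action : ∀ a x → H.const a ∙ x ≈ᴹ a *ₗ x
      T-action     : ∀ i u → H.T i ∙ basis u ≈ᴹ T-basis i u

open WGraph using (IsWGraph) public

-- The set {1, …, n} is Fin n, with i : Fin n standing for the number toℕ i + 1.
module Cyclic (n : ℕ) .{{_ : NonZero n}} where

  value : Fin n → ℤ
  value i = + suc (toℕ i)

  -- The unique element of {1, …, n} congruent to k modulo n.
  residue : ℤ → Fin n
  residue k = fromℕ< (n%ℕd<d (k ℤ.- 1ℤ) n)

  infixl 6 _⊕_ _⊖_
  _⊕_ _⊖_ : Fin n → ℕ → Fin n
  i ⊕ k = residue (value i ℤ.+ + k)
  i ⊖ k = residue (value i ℤ.- + k)

  -- The residue of j - i, as a number in {1, …, n}.
  gap : Fin n → Fin n → ℕ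
  gap i j = suc (toℕ (residue (value j ℤ.- value i)))

  -- Outside the empty case, x lies in ⟨ a , b ⟩ iff it takes no more steps to
  -- reach x from a than to reach b from a.
  ⟨_,_⟩ : Fin n → Fin n → Subset n
  ⟨ a , b ⟩ = if does (a Fin.≟ b ⊕ 1) then ⊥ else Vec.tabulate (λ x → does (steps x ℕ.≤? steps b))
    where
    steps : Fin n → ℕ
    steps x = (value x ℤ.- value a) ℤ.%ℕ n

  Adjacent : Fin n → Fin n → Set
  Adjacent i j = j ≡ i ⊕ 1 ⊎ i ≡ j ⊕ 1

  adjacent? : ∀ i j → Dec (Adjacent i j)
  adjacent? i j = (j Fin.≟ i ⊕ 1) ⊎-dec (i Fin.≟ j ⊕ 1)

-- Type Ã_{n-1}, where the index standing for n is s_n = s_0.  This describes the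
-- affine symmetric group for n ≥ 3 only: for n = 2 the two reflections generate
-- an infinite dihedral group.
module _ (n : ℕ) .{{_ : NonZero n}} where
  open Cyclic n

  affineSymmetric : CoxeterMatrix n
  affineSymmetric = record
    { m          = λ i j → entry (i Fin.≟ j) (adjacent? i j)
    ; m-sym      = λ i j → entry-sym (i Fin.≟ j) (adjacent? i j) (j Fin.≟ i) (adjacent? j i)
    ; m-diagonal = λ i → entry-diag (i Fin.≟ i) (adjacent? i i)
    ; m-offDiag  = λ i j → entry-off (i Fin.≟ j) (adjacent? i j)
    }
    where
    entry : ∀ {P Q : Set} → Dec P → Dec Q → ℕ
    entry equal adjacent = if does equal then 1 else if does adjacent then 3 else 2

    entry-sym : ∀ {i j} (a : Dec (i ≡ j)) (b : Dec (Adjacent i j))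
                (a′ : Dec (j ≡ i)) (b′ : Dec (Adjacent j i)) → entry a b ≡ entry a′ b′
    entry-sym (yes p) _       (yes _)  _        = refl
    entry-sym (yes p) _       (no ¬p)  _        = ⊥-elim (¬p (sym p))
    entry-sym (no ¬p) _       (yes p)  _        = ⊥-elim (¬p (sym p))
    entry-sym (no _)  (yes _) (no _)   (yes _)  = refl
    entry-sym (no _)  (yes p) (no _)   (no ¬p)  = ⊥-elim (¬p (swap p))
    entry-sym (no _)  (no ¬p) (no _)   (yes p)  = ⊥-elim (¬p (swap p))
    entry-sym (no _)  (no _)  (no _)   (no _)   = refl

    entry-diag : ∀ {i} (a : Dec (i ≡ i)) (b : Dec (Adjacent i i)) → entry a b ≡ 1
    entry-diag (yes _) _ = refl
    entry-diag (no ¬p) _ = ⊥-elim (¬p refl)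

    entry-off : ∀ {i j} (a : Dec (i ≡ j)) (b : Dec (Adjacent i j)) → i ≢ j → entry a b ≢ 1
    entry-off (yes p) _       i≢j _  = i≢j p
    entry-off (no _)  (yes _) _   ()
    entry-off (no _)  (no _)  _   ()

module TwoRow (n λ₁ λ₂ : ℕ) .{{_ : NonZero n}} where
  open Cyclic n

  IsRSYT : Vec (Fin n) λ₁ → Vec (Fin n) λ₂ → Set
  IsRSYT r₁ r₂ = Linked Fin._<_ r₁ × Linked Fin._<_ r₂ × (∀ x → Vec.count (x Fin.≟_) (r₁ Vec.++ r₂) ≡ 1)

  isRSYT? : ∀ r₁ r₂ → Dec (IsRSYT r₁ r₂)
  isRSYT? r₁ r₂ = linked? Fin._<?_ r₁ ×-dec linked? Fin._<?_ r₂ ×-dec Fin.all? (λ x → _ ℕ.≟ 1)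

  -- The validity proof is irrelevant, so that equality of tableaux is equality
  -- of their rows.
  record RSYT : Set where
    constructor mkRSYT
    field
      row₁    : Vec (Fin n) λ₁
      row₂    : Vec (Fin n) λ₂
      .isRSYT : IsRSYT row₁ row₂
  open RSYT

  _≟_ : DecidableEquality RSYT
  mkRSYT r₁ r₂ _ ≟ mkRSYT s₁ s₂ _ =
    map′ (λ { (refl , refl) → refl }) (λ { refl → refl , refl })
         (Vec.≡-dec Fin._≟_ r₁ s₁ ×-dec Vec.≡-dec Fin._≟_ r₂ s₂)

  private
    vecs : ∀ k → List (Vec (Fin n) k)
    vecs zero    = Vec.[] ∷ []
    vecs (suc k) = cartesianProductWith Vec._∷_ (allFin n) (vecs k)

    ∈-vecs : ∀ {k} (v : Vec (Fin n) k) → v List.∈ vecs k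
    ∈-vecs Vec.[]      = here refl
    ∈-vecs (x Vec.∷ v) = ∈-cartesianProductWith⁺ Vec._∷_ (∈-allFin x) (∈-vecs v)

    fromRows : ∀ r₁ r₂ → Dec (IsRSYT r₁ r₂) → List RSYT
    fromRows r₁ r₂ (yes ok) = mkRSYT r₁ r₂ ok ∷ []
    fromRows r₁ r₂ (no _)   = []

    ∈-fromRows : ∀ r₁ r₂ .(ok : IsRSYT r₁ r₂) (d : Dec (IsRSYT r₁ r₂)) →
                 mkRSYT r₁ r₂ ok List.∈ fromRows r₁ r₂ d
    ∈-fromRows r₁ r₂ ok (yes _)  = here refl
    ∈-fromRows r₁ r₂ ok (no ¬ok) = Irrelevant.⊥-elim (¬ok ok)

  allRSYT : List RSYT
  allRSYT = concatMap (λ (r₁ , r₂) → fromRows r₁ r₂ (isRSYT? r₁ r₂)) (cartesianProduct (vecs λ₁) (vecs λ₂))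

  ∈-allRSYT : ∀ t → t List.∈ allRSYT
  ∈-allRSYT (mkRSYT r₁ r₂ ok) = ∈-concatMap⁺ _
    (Any.map (λ { refl → ∈-fromRows r₁ r₂ ok (isRSYT? r₁ r₂) })
             (∈-cartesianProduct⁺ (∈-vecs r₁) (∈-vecs r₂)))

  entries : ∀ {k} → Vec (Fin n) k → Subset n
  entries r = ⋃ (map ⁅_⁆ (Vec.toList r))

  _¹ _² : RSYT → Subset n
  t ¹ = entries (row₁ t)
  t ² = entries (row₂ t)

  des : RSYT → Subset n
  des t = Vec.tabulate (λ i → does (i ∈? t ¹ ×-dec i ⊕ 1 ∈? t ²))

  -- t is s with i and j interchanged.  As the rows of t increase, comparing them
  -- as sets accounts for the re-sorting.
  Interchanged : Fin n → Fin n → RSYT → RSYT → Set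
  Interchanged i j s t =
    t ¹ ≡ entries (Vec.map (Perm.transpose i j) (row₁ s)) ×
    t ² ≡ entries (Vec.map (Perm.transpose i j) (row₂ s))

  FirstKind : RSYT → RSYT → Set
  FirstKind s t = ∃ λ i → i ∈ s ¹ × i ⊕ 1 ∈ s ² × Interchanged i (i ⊕ 1) s t

  -- Truncated subtraction of 3 differs from subtraction, for odd gap i j, only if
  -- gap i j = 1, i.e. j ≡ i ⊕ 1; then CondD is vacuous with either reading and
  -- CondE imposes nothing.
  CondD CondE : RSYT → Fin n → Fin n → Set
  CondD s i j = ∀ k → 1 ≤ k → k ≤ (gap i j ℕ.∸ 3) ℕ./ 2 →
                k ≤ ∣ s ² ∩ ⟨ j ⊖ (1 ℕ.+ 2 ℕ.* k) , j ⊖ 2 ⟩ ∣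
  CondE s i j = j ≢ i ⊕ 1 → ∣ s ² ∩ ⟨ i ⊕ 2 , j ⊖ 2 ⟩ ∣ ≡ (gap i j ℕ.∸ 3) ℕ./ 2

  SecondKind : RSYT → RSYT → Set
  SecondKind s t = ∃₂ λ i j →
    (i ∈ s ² × j ∈ s ¹ × i ≢ j ⊕ 1 × Interchanged i j s t) ×
    ¬ (2 ∣ gap i j) ×
    (i ⊕ 1 ∈ s ¹ × j ⊖ 1 ∈ s ²) ×
    (i ⊖ 1 ∈ s ¹ ⊎ j ⊕ 1 ∈ s ²) ×
    CondD s i j ×
    CondE s i j

  Move : RSYT → RSYT → Set
  Move s t = FirstKind s t ⊎ SecondKind s t

  interchanged? : ∀ i j s t → Dec (Interchanged i j s t)
  interchanged? i j s t = Vec.≡-dec Bool._≟_ _ _ ×-dec Vec.≡-dec Bool._≟_ _ _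

  condD? : ∀ s i j → Dec (CondD s i j)
  condD? s i j = map′ (λ f k 1≤k k≤b → f {k} (ℕ.s≤s k≤b) 1≤k) (λ f {k} k<1+b 1≤k → f k 1≤k (ℕ.s≤s⁻¹ k<1+b))
    (ℕ.allUpTo? (λ k → 1 ℕ.≤? k →-dec k ℕ.≤? ∣ s ² ∩ ⟨ j ⊖ (1 ℕ.+ 2 ℕ.* k) , j ⊖ 2 ⟩ ∣) (suc ((gap i j ℕ.∸ 3) ℕ./ 2)))

  condE? : ∀ s i j → Dec (CondE s i j)
  condE? s i j = ¬? (j Fin.≟ i ⊕ 1) →-dec _ ℕ.≟ _

  move? : ∀ s t → Dec (Move s t)
  move? s t =
    Fin.any? (λ i → i ∈? s ¹ ×-dec i ⊕ 1 ∈? s ² ×-dec interchanged? i (i ⊕ 1) s t)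
    ⊎-dec
    Fin.any? (λ i → Fin.any? (λ j →
      (i ∈? s ² ×-dec j ∈? s ¹ ×-dec ¬? (i Fin.≟ j ⊕ 1) ×-dec interchanged? i j s t) ×-dec
      ¬? (2 ∣? gap i j) ×-dec
      (i ⊕ 1 ∈? s ¹ ×-dec j ⊖ 1 ∈? s ²) ×-dec
      (i ⊖ 1 ∈? s ¹ ⊎-dec j ⊕ 1 ∈? s ²) ×-dec
      condD? s i j ×-dec
      condE? s i j))

  Γ̄ : LabeledGraph n
  Γ̄ = record
    { V             = RSYT
    ; _≟_           = _≟_
    ; m             = λ s t → if does (move? s t) then A.1# else A.0#
    ; τ             = des
    ; locallyFinite = λ s → allRSYT , λ t t∉ → ⊥-elim (t∉ (∈-allRSYT t))
    }

open TwoRow using (Γ̄) public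

{-# OPTIONS --safe #-}

-- Read a tableau as a cyclic word in which the entries of the top row open and
-- those of the bottom row close a parenthesis.  If i lies in des s but not in
-- des t, then there is a move from s to t iff s arises from t by the annular
-- Temperley–Lieb generator at i, that is, by matching i with i + 1 and their
-- former partners with each other.  So each T_i - q is q^(1/2) times the transpose
-- of a Temperley–Lieb generator with loop value -(q^(1/2) + q^(-1/2)), and the
-- Hecke relations follow from e_i² = -(q^(1/2) + q^(-1/2)) e_i, e_i e_j e_i = e_i
-- for adjacent i and j, and e_i e_j = e_j e_i otherwise.  The last one is the hard
-- one: it compares how the searches for the two partners influence each other.
module Submission where

open import Defs

open import Algebra.Bundles using (CommutativeRing)
open import Algebra.Module.Structures using (IsLeftModule)
import Algebra.Properties.AbelianGroup as AbelianGroupProperties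
import Algebra.Properties.Ring as RingProperties
import Algebra.Solver.Ring.NaturalCoefficients.Default as NaturalCoefficients
open import Data.Bool.Base using (Bool; true; false; not; _∧_; _∨_; if_then_else_)
import Data.Bool.Properties as Bool
open import Data.Empty using (⊥-elim)
open import Data.Fin.Base as Fin using (Fin; toℕ)
import Data.Fin.Permutation.Components as Perm
import Data.Fin.Properties as Fin
open import Data.Fin.Subset as Subset using (Subset; ∣_∣; ⁅_⁆; _∪_; _∩_; ⋃; ∁; _∈_)
open import Data.Fin.Subset.Properties as Subset using (_∈?_)
open import Data.Integer.Base as ℤ using (ℤ; 1ℤ)
import Data.Integer.DivMod as ℤ
import Data.Integer.Properties as ℤ
open import Data.Integer.Tactic.RingSolver using (solve-∀)
open import Data.List.Base as List using (List; []; _∷_; _++_; length; [_])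
import Data.List.Properties as List
open import Data.Nat.Base using (ℕ; zero; suc; NonZero; _≤_; _<_; z≤n; s≤s)
open import Data.Nat.DivMod
  using (_%_; _/_; _mod_; m%n<n; m%n%n≡m%n; m<n⇒m%n≡m; m*n/n≡m; m≡m%n+[m/n]*n;
         %-distribˡ-+; [m+n]%n≡m%n; [m+kn]%n≡m%n)
open import Data.Nat.Divisibility using (_∣_; divides; ∣m+n∣m⇒∣n; ∣1⇒≡1)
import Data.Nat.Properties as ℕ
open import Data.Nat.Solver using (module +-*-Solver)
open import Data.Product.Base using (∃; ∃₂; _×_; _,_; proj₁; proj₂)
open import Data.Sum.Base as Sum using (_⊎_; inj₁; inj₂)
open import Data.Vec.Base as Vec using (Vec; []; _∷_; lookup; tabulate; count)
import Data.Vec.Properties as Vec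
open import Data.Vec.Relation.Unary.Linked as Linked using (Linked; []; [-]; _∷_)
import Data.Vec.Relation.Unary.Linked.Properties as Linked
open import Function.Base using (_∋_)
open import Relation.Binary.PropositionalEquality as ≡ using (_≡_; _≢_; module ≡-Reasoning)
import Relation.Binary.Reasoning.Setoid as SetoidReasoning
open import Relation.Nullary using (¬_; Dec; yes; no; does)
open import Relation.Nullary.Decidable using (dec-true; dec-false; map′; recompute; _×-dec_)

-- Temperley–Lieb operators and the Hecke relations

-- Conditions (a), (b), (d) and (e) of a move of the second kind together say that the letters
-- strictly between i and j form a balanced word. This is what the search to the right from the site
-- (i - 1, i), or to the left from the site (j, j + 1), walks over before it stops; condition (c)
-- supplies the other letter of one of these sites. A generator kills a word when its search finds
-- nothing, so a search runs over the linear word of the n - 2 letters outside the site. Working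
-- with b = T - q instead of the generator itself avoids a division by q^(1/2): the relations become
-- b² = -(1 + q) b and b b′ b = q b. Passing to the transpose leaves at most one nonzero entry in
-- each row of b, so the relations turn into statements about single words and a partial function on
-- them. For distant sites the word is cut at both, because the partner of one site can be a letter
-- of the other, and because the first flip can create the letter that the second search finds.
-- Flips keep the number of closers, which is why every word that is reached comes from a tableau of
-- the same shape.

module Identities {c ℓ} (R : CommutativeRing c ℓ) where
  open CommutativeRing R
  open NaturalCoefficients commutativeSemiring using (solve; con; _:+_; _:*_; _:=_)

  linear : ∀ d a x y → d * (a * x + y) ≈ a * (d * x) + d * y
  linear = solve 4 (λ d a x y → d :* (a :* x :+ y) := a :* (d :* x) :+ d :* y) refl

  linear-+ : ∀ a x y s t → (a * x + y) + (a * s + t) ≈ a * (x + s) + (y + t)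
  linear-+ = solve 5 (λ a x y s t → (a :* x :+ y) :+ (a :* s :+ t) := a :* (x :+ s) :+ (y :+ t)) refl

  exchange : ∀ p d x → p * (d * x) ≈ d * (p * x)
  exchange = solve 3 (λ p d x → p :* (d :* x) := d :* (p :* x)) refl

  zigzag : ∀ d p x → d * (p * (p * x)) ≈ p * p * (d * x)
  zigzag = solve 3 (λ d p x → d :* (p :* (p :* x)) := p :* p :* (d :* x)) refl

  linear₂ : ∀ q a x y s t → q * (a * x + y) + (a * s + t) ≈ a * (q * x + s) + (q * y + t)
  linear₂ = solve 6 (λ q a x y s t → q :* (a :* x :+ y) :+ (a :* s :+ t) := a :* (q :* x :+ s) :+ (q :* y :+ t)) refl

  regroup : ∀ q x s → q * x + s + 1# * x ≈ (q + 1#) * x + s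
  regroup = solve 3 (λ q x s → q :* x :+ s :+ con 1 :* x := (q :+ con 1) :* x :+ s) refl

  product : ∀ q x s t u → q * (q * x + t) + (q * s + u) ≈ q * (q * x + s) + (q * t + u)
  product = solve 5 (λ q x s t u → q :* (q :* x :+ t) :+ (q :* s :+ u) := q :* (q :* x :+ s) :+ (q :* t :+ u)) refl

  sum : ∀ q d x → q * x + d * x + 1# * x ≈ (q + 1# + d) * x
  sum = solve 3 (λ q d x → q :* x :+ d :* x :+ con 1 :* x := (q :+ con 1 :+ d) :* x) refl

  sum₂ : ∀ q d x → (q + 1#) * x + d * x ≈ (q + 1# + d) * x
  sum₂ = solve 3 (λ q d x → (q :+ con 1) :* x :+ d :* x := (q :+ con 1 :+ d) :* x) refl

  -- Here s, t, u and w stand for the values of b_i x, b_j x, b_j b_i x and b_i b_j x, with b_i b_i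
  -- and b_i b_j b_i already rewritten. The right-hand side is symmetric in i and j except for its
  -- last term, which vanishes once d is -(1 + q).
  braid : ∀ q d x s t u w →
    q * (q * (q * x + s) + (q * t + u)) + (q * (q * s + d * s) + (q * w + q * s)) ≈
    q * (q * (q * x)) + q * (q * (s + t)) + q * (w + u) + q * ((q + 1# + d) * s)
  braid = solve 7 (λ q d x s t u w → q :* (q :* (q :* x :+ s) :+ (q :* t :+ u)) :+ (q :* (q :* s :+ d :* s) :+ (q :* w :+ q :* s)) := q :* (q :* (q :* x)) :+ q :* (q :* (s :+ t)) :+ q :* (w :+ u) :+ q :* ((q :+ con 1 :+ d) :* s)) refl

module Operators {c ℓ} (R : CommutativeRing c ℓ) {V I : Set}
  (q½ : CommutativeRing.Carrier R)
  (Cup : I → V → Set) (Step : I → V → V → Set)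
  (cup? : ∀ i v → Dec (Cup i v)) (step? : ∀ i v → Dec (∃ (Step i v)))
  (functional : ∀ {i v u w} → Step i v u → Step i v w → u ≡ w)
  (target : ∀ {i v u} → Step i v u → Cup i u)
  (source : ∀ {i v u} → Step i v u → ¬ Cup i v)
  where

  open CommutativeRing R hiding (zero)
  open SetoidReasoning setoid

  open AbelianGroupProperties +-abelianGroup using (xyx⁻¹≈y)
  open RingProperties ring using (+-inverseˡ-unique)
  private module Id = Identities R

  q δ : Carrier
  q = q½ * q½
  δ = - (1# + q)

  -- The three shapes of row v in the matrix of `b i`: a diagonal entry δ, a single entry q½ in
  -- column u, or zero. They exclude each other by `source`.
  data View (i : I) (v : V) : Set where
    cup  : Cup i v → View i v
    step : ∀ {u} → Step i v u → View i v
    none : ¬ Cup i v → ¬ ∃ (Step i v) → View i v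

  view : ∀ i v → View i v
  view i v with cup? i v | step? i v
  ... | yes c | _           = cup c
  ... | no _  | yes (_ , s) = step s
  ... | no ¬c | no ¬s       = none ¬c ¬s

  evaluate : ∀ {i v} → View i v → (V → Carrier) → Carrier
  evaluate {v = v} (cup _)      x = δ * x v
  evaluate         (step {u} _) x = q½ * x u
  evaluate         (none _ _)   x = 0#

  -- q^(1/2) times a Temperley–Lieb generator with loop value -(q^(1/2) + q^(-1/2)).
  b : I → (V → Carrier) → V → Carrier
  b i x v = evaluate (view i v) x

  b-cup : ∀ {i v} → Cup i v → ∀ x → b i x v ≈ δ * x v
  b-cup {i} {v} c x with view i v
  ... | cup _     = refl
  ... | step s    = ⊥-elim (source s c)
  ... | none ¬c _ = ⊥-elim (¬c c)

  b-step : ∀ {i v u} → Step i v u → ∀ x → b i x v ≈ q½ * x u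
  b-step {i} {v} s x with view i v
  ... | cup c     = ⊥-elim (source s c)
  ... | none _ ¬s = ⊥-elim (¬s (_ , s))
  ... | step s′ with functional s s′
  ...   | ≡.refl = refl

  b-none : ∀ {i v} → ¬ Cup i v → ¬ ∃ (Step i v) → ∀ x → b i x v ≈ 0#
  b-none {i} {v} ¬c ¬s x with view i v
  ... | cup c    = ⊥-elim (¬c c)
  ... | step s   = ⊥-elim (¬s (_ , s))
  ... | none _ _ = refl

  infix 4 _≗_
  _≗_ : (V → Carrier) → (V → Carrier) → Set ℓ
  x ≗ y = ∀ v → x v ≈ y v

  b-cong : ∀ i {x y} → x ≗ y → b i x ≗ b i y
  b-cong i eq v with view i v
  ... | cup _    = *-congˡ (eq v)
  ... | step s   = *-congˡ (eq _)
  ... | none _ _ = refl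

  b-linear : ∀ i a x y → b i (λ v → a * x v + y v) ≗ λ v → a * b i x v + b i y v
  b-linear i a x y v with view i v
  ... | cup _        = Id.linear δ a (x v) (y v)
  ... | step {u} s   = Id.linear q½ a (x u) (y u)
  ... | none _ _     = sym (trans (+-identityʳ (a * 0#)) (zeroʳ a))

  -- A step ends in a cup, where the second application only rescales.
  b-square : ∀ i x → b i (b i x) ≗ λ v → δ * b i x v
  b-square i x v with view i v
  ... | cup c      = *-congˡ (b-cup c x)
  ... | step {u} s = trans (*-congˡ (b-cup (target s) x)) (Id.exchange q½ δ (x u))
  ... | none _ _   = sym (zeroʳ δ)

  -- The form of e_i e_j e_i = e_i on single words. Cups suffice, because the first generator either
  -- kills a word, rescales a cup or leads to one.
  Linking : I → I → Set
  Linking i j = ∀ {v} → Cup i v → ∃ λ u → Step j v u × Step i u v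

  b-braid : ∀ {i j} → Linking i j → ∀ x → b i (b j (b i x)) ≗ λ v → q * b i x v
  b-braid {i} {j} link x v with view i v
  ... | cup c with u , s , s′ ← link c = begin
    δ * b j (b i x) v        ≈⟨ *-congˡ (b-step s (b i x)) ⟩
    δ * (q½ * b i x u)       ≈⟨ *-congˡ (*-congˡ (b-step s′ x)) ⟩
    δ * (q½ * (q½ * x v))    ≈⟨ Id.zigzag δ q½ (x v) ⟩
    q * (δ * x v)            ∎
  b-braid {i} {j} link x v | step {u} s with w , t , t′ ← link (target s) = begin
    q½ * b j (b i x) u       ≈⟨ *-congˡ (b-step t (b i x)) ⟩
    q½ * (q½ * b i x w)      ≈⟨ *-congˡ (*-congˡ (b-step t′ x)) ⟩
    q½ * (q½ * (q½ * x u))   ≈⟨ *-assoc q½ q½ (q½ * x u) ⟨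
    q * (q½ * x u)           ∎
  b-braid link x v | none _ _ = sym (zeroʳ q)

  -- These conditions are used for (i , j) and (j , i) together. That a word killed in one order is
  -- also killed in the other then follows from the functionality of steps.
  record Distant (i j : I) : Set where
    field
      kept    : ∀ {v u} → Cup i v → Step j v u → Cup i u
      made    : ∀ {v u} → Step i v u → ¬ Cup j v → Cup j u → Step j v u
      commute : ∀ {v u w} → Step i v u → Step j u w → ∃ λ t → Step j v t × Step i t w

  module _ {i j} (D : Distant i j) (D′ : Distant j i) (x : V → Carrier) where
    commute-cup : ∀ {v} → Cup i v → b i (b j x) v ≈ b j (b i x) v
    commute-cup {v} c with view j v
    ... | cup c′     = begin
      b i (b j x) v        ≈⟨ b-cup c (b j x) ⟩
      δ * b j x v          ≈⟨ *-congˡ (b-cup c′ x) ⟩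
      δ * (δ * x v)        ≈⟨ *-congˡ (b-cup c x) ⟨
      δ * b i x v          ∎
    ... | step {u} s = begin
      b i (b j x) v        ≈⟨ b-cup c (b j x) ⟩
      δ * b j x v          ≈⟨ *-congˡ (b-step s x) ⟩
      δ * (q½ * x u)       ≈⟨ Id.exchange δ q½ (x u) ⟩
      q½ * (δ * x u)       ≈⟨ *-congˡ (b-cup (Distant.kept D c s) x) ⟨
      q½ * b i x u         ∎
    ... | none ¬c ¬s = begin
      b i (b j x) v        ≈⟨ b-cup c (b j x) ⟩
      δ * b j x v          ≈⟨ *-congˡ (b-none ¬c ¬s x) ⟩
      δ * 0#               ≈⟨ zeroʳ δ ⟩
      0#                   ∎

    commute-step : ∀ {v u} → Step i v u → ¬ Cup j v → b i (b j x) v ≈ b j (b i x) v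
    commute-step {v} {u} s ¬c = trans (b-step s (b j x)) (next (view j u))
      where
      next : View j u → q½ * b j x u ≈ b j (b i x) v
      next (cup c) = begin
        q½ * b j x u         ≈⟨ *-congˡ (b-cup c x) ⟩
        q½ * (δ * x u)       ≈⟨ *-congˡ (b-cup (target s) x) ⟨
        q½ * b i x u         ≈⟨ b-step (Distant.made D s ¬c c) (b i x) ⟨
        b j (b i x) v        ∎
      next (step {w} t) with t′ , r , r′ ← Distant.commute D s t = begin
        q½ * b j x u         ≈⟨ *-congˡ (b-step t x) ⟩
        q½ * (q½ * x w)      ≈⟨ *-congˡ (b-step r′ x) ⟨
        q½ * b i x t′        ≈⟨ b-step r (b i x) ⟨
        b j (b i x) v        ∎
      -- Now j kills u, so the other order has to vanish too. If j moved v to t′ without i killing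
      -- t′, then `made` or `commute` with the roles reversed would give a step of i from v. By
      -- functionality it ends in u, where j would then find a cup or a step.
      next (none ¬c′ ¬s′) = trans (trans (*-congˡ (b-none ¬c′ ¬s′ x)) (zeroʳ q½)) (sym (vanish (view j v)))
        where
        vanish : View j v → b j (b i x) v ≈ 0#
        vanish (cup c)     = ⊥-elim (¬c c)
        vanish (none _ ¬s) = b-none ¬c ¬s (b i x)
        vanish (step {t′} r) = trans (b-step r (b i x)) (trans (*-congˡ (vanish′ (view i t′))) (zeroʳ q½))
          where
          vanish′ : View i t′ → b i x t′ ≈ 0#
          vanish′ (cup c) with functional s (Distant.made D′ r (source s) c)
          ... | ≡.refl = ⊥-elim (¬c′ (target r))
          vanish′ (step r′) with s′ , t , t″ ← Distant.commute D′ r r′ with functional s t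
          ... | ≡.refl = ⊥-elim (¬s′ (_ , t″))
          vanish′ (none ¬c″ ¬s″) = b-none ¬c″ ¬s″ x

  b-commute : ∀ {i j} → Distant i j → Distant j i → ∀ x → b i (b j x) ≗ b j (b i x)
  b-commute {i} {j} D D′ x v = cases (view i v) (view j v)
    where
    cases : View i v → View j v → b i (b j x) v ≈ b j (b i x) v
    cases (cup c)      _            = commute-cup D D′ x c
    cases _            (cup c)      = sym (commute-cup D′ D x c)
    cases (step s)     (step t)     = commute-step D D′ x s (source t)
    cases (step s)     (none ¬c _)  = commute-step D D′ x s ¬c
    cases (none ¬c _)  (step t)     = sym (commute-step D′ D x t ¬c)
    cases (none ¬c ¬s) (none ¬c′ ¬s′) = trans (b-none ¬c ¬s (b j x)) (sym (b-none ¬c′ ¬s′ (b i x)))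

  T : I → (V → Carrier) → V → Carrier
  T i x v = q * x v + b i x v

  q+1+δ≈0 : q + 1# + δ ≈ 0#
  q+1+δ≈0 = trans (+-congʳ (+-comm q 1#)) (-‿inverseʳ (1# + q))

  T-cup : ∀ {i v} → Cup i v → ∀ x → T i x v ≈ - x v
  T-cup {i} {v} c x = +-inverseˡ-unique (T i x v) (x v) (begin
    q * x v + b i x v + x v          ≈⟨ +-cong (+-congˡ (b-cup c x)) (sym (*-identityˡ (x v))) ⟩
    q * x v + δ * x v + 1# * x v     ≈⟨ Id.sum q δ (x v) ⟩
    (q + 1# + δ) * x v               ≈⟨ *-congʳ q+1+δ≈0 ⟩
    0# * x v                         ≈⟨ zeroˡ (x v) ⟩
    0#                               ∎)

  T-step : ∀ {i v u} → Step i v u → ∀ x → T i x v ≈ q * x v + q½ * x u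
  T-step s x = +-congˡ (b-step s x)

  T-none : ∀ {i v} → ¬ Cup i v → ¬ ∃ (Step i v) → ∀ x → T i x v ≈ q * x v
  T-none ¬c ¬s x = trans (+-congˡ (b-none ¬c ¬s x)) (+-identityʳ _)

  T-cong : ∀ i {x y} → x ≗ y → T i x ≗ T i y
  T-cong i eq v = +-cong (*-congˡ (eq v)) (b-cong i eq v)

  T-linear : ∀ i a x y → T i (λ v → a * x v + y v) ≗ λ v → a * T i x v + T i y v
  T-linear i a x y v = trans (+-congˡ (b-linear i a x y v)) (Id.linear₂ q a (x v) (y v) (b i x v) (b i y v))

  -- With T = q + b the product (T - q)(T + 1) is b (b + q + 1), and b² = -(q + 1) b.
  T-quadratic : ∀ i x v → T i (λ w → T i x w + 1# * x w) v + - (q * (T i x v + 1# * x v)) ≈ 0#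
  T-quadratic i x v = begin
    q * y v + b i y v + - (q * y v)             ≈⟨ xyx⁻¹≈y (q * y v) (b i y v) ⟩
    b i y v                                     ≈⟨ b-cong i (λ w → Id.regroup q (x w) (b i x w)) v ⟩
    b i (λ w → (q + 1#) * x w + b i x w) v      ≈⟨ b-linear i (q + 1#) x (b i x) v ⟩
    (q + 1#) * b i x v + b i (b i x) v          ≈⟨ +-congˡ (b-square i x v) ⟩
    (q + 1#) * b i x v + δ * b i x v            ≈⟨ Id.sum₂ q δ (b i x v) ⟩
    (q + 1# + δ) * b i x v                      ≈⟨ *-congʳ q+1+δ≈0 ⟩
    0# * b i x v                                ≈⟨ zeroˡ (b i x v) ⟩
    0#                                          ∎
    where
    y : V → Carrier
    y w = T i x w + 1# * x w

  T-T : ∀ i j x v → T i (T j x) v ≈ q * (q * x v + b j x v) + (q * b i x v + b i (b j x) v)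
  T-T i j x v = +-congˡ (b-linear i q x (b j x) v)

  T-commute : ∀ {i j} → Distant i j → Distant j i → ∀ x → T i (T j x) ≗ T j (T i x)
  T-commute {i} {j} D D′ x v = begin
    T i (T j x) v                                                ≈⟨ T-T i j x v ⟩
    q * (q * x v + b j x v) + (q * b i x v + b i (b j x) v)      ≈⟨ +-congˡ (+-congˡ (b-commute D D′ x v)) ⟩
    q * (q * x v + b j x v) + (q * b i x v + b j (b i x) v)      ≈⟨ Id.product q (x v) (b i x v) (b j x v) _ ⟩
    q * (q * x v + b i x v) + (q * b j x v + b j (b i x) v)      ≈⟨ T-T j i x v ⟨
    T j (T i x) v                                                ∎

  -- The right-hand side is symmetric in i and j up to commutativity of addition, which is all that
  -- `T-braid` then needs.
  T-T-T : ∀ {i j} → Linking i j → ∀ x v → T i (T j (T i x)) v ≈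
          q * (q * (q * x v)) + q * (q * (b i x v + b j x v)) + q * (b i (b j x) v + b j (b i x) v)
  T-T-T {i} {j} link x v = begin
    q * T j (T i x) v + b i (T j (T i x)) v
      ≈⟨ +-cong (*-congˡ (T-T j i x v)) (b-cong i (T-T j i x) v) ⟩
    q * Y + b i (λ w → q * T i x w + (q * b j x w + b j (b i x) w)) v
      ≈⟨ +-congˡ (trans (b-linear i q (T i x) (λ w → q * b j x w + b j (b i x) w) v)
          (+-cong (*-congˡ (b-linear i q x (b i x) v)) (b-linear i q (b j x) (b j (b i x)) v))) ⟩
    q * Y + (q * (q * b i x v + b i (b i x) v) + (q * b i (b j x) v + b i (b j (b i x)) v))
      ≈⟨ +-congˡ (+-cong (*-congˡ (+-congˡ (b-square i x v))) (+-congˡ (b-braid link x v))) ⟩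
    q * Y + (q * (q * b i x v + δ * b i x v) + (q * b i (b j x) v + q * b i x v))
      ≈⟨ Id.braid q δ (x v) (b i x v) (b j x v) (b j (b i x) v) (b i (b j x) v) ⟩
    N + q * ((q + 1# + δ) * b i x v)
      ≈⟨ +-congˡ (*-congˡ (trans (*-congʳ q+1+δ≈0) (zeroˡ (b i x v)))) ⟩
    N + q * 0#
      ≈⟨ trans (+-congˡ (zeroʳ q)) (+-identityʳ N) ⟩
    N ∎
    where
    N Y : Carrier
    N = q * (q * (q * x v)) + q * (q * (b i x v + b j x v)) + q * (b i (b j x) v + b j (b i x) v)
    Y = q * (q * x v + b i x v) + (q * b j x v + b j (b i x) v)

  T-braid : ∀ {i j} → Linking i j → Linking j i → ∀ x → T i (T j (T i x)) ≗ T j (T i (T j x))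
  T-braid {i} {j} link link′ x v = trans (T-T-T link x v) (trans
    (+-cong (+-congˡ (*-congˡ (*-congˡ (+-comm _ _)))) (*-congˡ (+-comm _ _))) (sym (T-T-T link′ x v)))

open import Data.Nat.Base using (_+_; _*_; _∸_)
open ≡ using (refl; sym; trans; cong; cong₂; subst; subst₂)
open +-*-Solver using (solve; con; _:+_; _:*_; _:=_)
open Laurent using (Laurent; q½)

-- Matching parentheses

Word : Set
Word = List Bool

-- ○ opens and ● closes a parenthesis.
pattern ○ = false
pattern ● = true

-- FHit k w v: scanning w from the left with k openers pending, there is a first
-- unmatched closer, and flipping it gives v.  FPass k w m: there is none, and m
-- openers are pending at the end.  GHit and GPass are the mirror images: they scan
-- from the right for an unmatched opener.
data FHit : ℕ → Word → Word → Set where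
  stop  : ∀ {w} → FHit 0 (● ∷ w) (○ ∷ w)
  open′ : ∀ {k w v} → FHit (suc k) w v → FHit k (○ ∷ w) (○ ∷ v)
  close : ∀ {k w v} → FHit k w v → FHit (suc k) (● ∷ w) (● ∷ v)

data FPass : ℕ → Word → ℕ → Set where
  nil   : ∀ {k} → FPass k [] k
  open′ : ∀ {k w m} → FPass (suc k) w m → FPass k (○ ∷ w) m
  close : ∀ {k w m} → FPass k w m → FPass (suc k) (● ∷ w) m

data GPass : ℕ → Word → ℕ → Set where
  nil   : ∀ {k} → GPass k [] k
  open′ : ∀ {k w m} → GPass k w (suc m) → GPass k (○ ∷ w) m
  close : ∀ {k w m} → GPass k w m → GPass k (● ∷ w) (suc m)

data GHit : ℕ → Word → Word → Set where
  stop  : ∀ {k w} → GPass k w 0 → GHit k (○ ∷ w) (● ∷ w)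
  there : ∀ {k b w v} → GHit k w v → GHit k (b ∷ w) (b ∷ v)

F-total : ∀ k w → ∃ (FHit k w) ⊎ ∃ (FPass k w)
F-total k []      = inj₂ (k , nil)
F-total k (○ ∷ w) with F-total (suc k) w
... | inj₁ (v , h) = inj₁ (○ ∷ v , open′ h)
... | inj₂ (m , p) = inj₂ (m , open′ p)
F-total zero    (● ∷ w) = inj₁ (○ ∷ w , stop)
F-total (suc k) (● ∷ w) with F-total k w
... | inj₁ (v , h) = inj₁ (● ∷ v , close h)
... | inj₂ (m , p) = inj₂ (m , close p)

G-total : ∀ k w → ∃ (GHit k w) ⊎ ∃ (GPass k w)
G-total k []      = inj₂ (k , nil)
G-total k (b ∷ w) with G-total k w
G-total k (b ∷ w) | inj₁ (v , h)     = inj₁ (b ∷ v , there h)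
G-total k (● ∷ w) | inj₂ (m , p)     = inj₂ (suc m , close p)
G-total k (○ ∷ w) | inj₂ (zero , p)  = inj₁ (● ∷ w , stop p)
G-total k (○ ∷ w) | inj₂ (suc m , p) = inj₂ (m , open′ p)

FHit-functional : ∀ {k w v v′} → FHit k w v → FHit k w v′ → v ≡ v′
FHit-functional stop      stop       = refl
FHit-functional (open′ h) (open′ h′) = cong (○ ∷_) (FHit-functional h h′)
FHit-functional (close h) (close h′) = cong (● ∷_) (FHit-functional h h′)

FPass-functional : ∀ {k w m m′} → FPass k w m → FPass k w m′ → m ≡ m′
FPass-functional nil       nil        = refl
FPass-functional (open′ p) (open′ p′) = FPass-functional p p′
FPass-functional (close p) (close p′) = FPass-functional p p′

FHit-FPass : ∀ {k w v m} → FHit k w v → ¬ FPass k w m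
FHit-FPass (open′ h) (open′ p) = FHit-FPass h p
FHit-FPass (close h) (close p) = FHit-FPass h p

GPass-functional : ∀ {k w m m′} → GPass k w m → GPass k w m′ → m ≡ m′
GPass-functional nil       nil        = refl
GPass-functional (open′ p) (open′ p′) = ℕ.suc-injective (GPass-functional p p′)
GPass-functional (close p) (close p′) = cong suc (GPass-functional p p′)

GHit-GPass : ∀ {k w v m} → GHit k w v → ¬ GPass k w m
GHit-GPass (stop p)  (open′ p′) with () ← GPass-functional p p′
GHit-GPass (there h) (open′ p)  = GHit-GPass h p
GHit-GPass (there h) (close p)  = GHit-GPass h p

GHit-functional : ∀ {k w v v′} → GHit k w v → GHit k w v′ → v ≡ v′
GHit-functional (stop p)  (stop p′)  = refl
GHit-functional (stop p)  (there h)  = ⊥-elim (GHit-GPass h p)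
GHit-functional (there h) (stop p)   = ⊥-elim (GHit-GPass h p)
GHit-functional (there h) (there h′) = cong (_ ∷_) (GHit-functional h h′)

FPass-shift : ∀ {k w m} → FPass k w m → ∀ d → FPass (d + k) w (d + m)
FPass-shift {k} {w} {m} p zero = p
FPass-shift p (suc d) = shift₁ (FPass-shift p d)
  where
  shift₁ : ∀ {k w m} → FPass k w m → FPass (suc k) w (suc m)
  shift₁ nil       = nil
  shift₁ (open′ p) = open′ (shift₁ p)
  shift₁ (close p) = close (shift₁ p)

GPass-shift : ∀ {k w m} → GPass k w m → ∀ d → GPass (d + k) w (d + m)
GPass-shift p zero = p
GPass-shift p (suc d) = shift₁ (GPass-shift p d)
  where
  shift₁ : ∀ {k w m} → GPass k w m → GPass (suc k) w (suc m)
  shift₁ nil       = nil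
  shift₁ (open′ p) = open′ (shift₁ p)
  shift₁ (close p) = close (shift₁ p)

FPass-pass : ∀ {w m} → FPass 0 w m → ∀ k → FPass k w (k + m)
FPass-pass {w} {m} p k = subst (λ d → FPass d w (k + m)) (ℕ.+-identityʳ k) (FPass-shift p k)

GPass-pass : ∀ {w m} → GPass 0 w m → ∀ k → GPass k w (k + m)
GPass-pass {w} {m} p k = subst (λ d → GPass d w (k + m)) (ℕ.+-identityʳ k) (GPass-shift p k)

-- By `GPass 0 w g` the word has no unmatched opener and g unmatched closers; these use up g of the
-- k pending openers.
FPass-GPass : ∀ {k w m g} → FPass k w m → GPass 0 w g → m + g ≡ k
FPass-GPass {k} nil nil = ℕ.+-identityʳ k
FPass-GPass {m = m} (open′ p) (open′ r) = ℕ.suc-injective (trans (sym (ℕ.+-suc m _)) (FPass-GPass p r))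
FPass-GPass {m = m} (close p) (close r) = trans (ℕ.+-suc m _) (cong suc (FPass-GPass p r))

-- The hit is the unmatched closer number k + 1 among g. Once it is an opener, it is matched by the
-- next unmatched closer, which lowers g by two; if it was the last one, it stays unmatched, and the
-- search from the right undoes the flip.
FHit-GPass : ∀ {k w v g} → FHit k w v → GPass 0 w g →
  (g ≡ suc k × GHit 0 v w) ⊎ (∃ λ m → g ≡ 2 + m × k ≤ m × GPass 0 v m)
FHit-GPass stop (close {m = zero}  r) = inj₁ (refl , stop r)
FHit-GPass stop (close {m = suc m} r) = inj₂ (m , refl , z≤n , open′ r)
FHit-GPass (open′ h) (open′ r) with FHit-GPass h r
... | inj₁ (refl , x)                 = inj₁ (refl , there x)
... | inj₂ (suc m , refl , s≤s k≤m , x) = inj₂ (m , refl , k≤m , open′ x)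
FHit-GPass (close h) (close r) with FHit-GPass h r
... | inj₁ (refl , x)           = inj₁ (refl , there x)
... | inj₂ (m , refl , k≤m , x) = inj₂ (suc m , refl , s≤s k≤m , close x)

-- With g = 0 there is no unmatched closer for a forward search to hit, so balance does not depend
-- on the direction of the scan.
GPass⇒FPass : ∀ {w} → GPass 0 w 0 → FPass 0 w 0
GPass⇒FPass {w} r with F-total 0 w
... | inj₁ (v , h) with FHit-GPass h r
...   | inj₁ (() , _)
...   | inj₂ (_ , () , _)
GPass⇒FPass {w} r | inj₂ (m , p) = subst (FPass 0 w) (trans (sym (ℕ.+-identityʳ m)) (FPass-GPass p r)) p

-- Mirror image of `FHit-GPass`: the last unmatched opener becomes a closer and is matched by the
-- opener pending before it, or, if it was the only one pending at the end, is left unmatched and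
-- flipped back.
FPass-GHit : ∀ {k w v m} → FPass k w m → GHit 0 w v →
  (m ≡ 1 × FHit k v w) ⊎ (∃ λ d → m ≡ 2 + d × FPass k v d)
FPass-GHit (open′ p) (there h) with FPass-GHit p h
... | inj₁ (refl , x)     = inj₁ (refl , open′ x)
... | inj₂ (d , refl , x) = inj₂ (d , refl , open′ x)
FPass-GHit (close p) (there h) with FPass-GHit p h
... | inj₁ (refl , x)     = inj₁ (refl , close x)
... | inj₂ (d , refl , x) = inj₂ (d , refl , close x)
FPass-GHit {k} {m = m} (open′ p) (stop r) with trans (sym (ℕ.+-identityʳ m)) (FPass-GPass p r)
FPass-GHit {zero}  (open′ p) (stop r) | refl = inj₁ (refl , stop)
FPass-GHit {suc k} {v = _ ∷ w} (open′ p) (stop r) | refl =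
  inj₂ (k , refl , close (subst (FPass k w) (ℕ.+-identityʳ k) (FPass-pass (GPass⇒FPass r) k)))

FPass⇒GPass : ∀ {w} → FPass 0 w 0 → GPass 0 w 0
FPass⇒GPass {w} p with G-total 0 w
... | inj₁ (v , h) with FPass-GHit p h
...   | inj₁ (() , _)
...   | inj₂ (_ , () , _)
FPass⇒GPass {w} p | inj₂ (m , r) = subst (GPass 0 w) (FPass-GPass p r) r

-- In every word the unmatched closers stand to the left of the unmatched openers. The two searches
-- therefore flip different letters, and neither flip comes into the way of the other search.
FHit-GHit : ∀ {k w v u} → FHit k w v → GHit 0 w u → ∃ λ z → FHit k u z × GHit 0 v z
FHit-GHit stop (there g) = _ , stop , there g
FHit-GHit (open′ h) (there g) with FHit-GHit h g
... | z , x , y = _ , open′ x , there y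
FHit-GHit (close h) (there g) with FHit-GHit h g
... | z , x , y = _ , close x , there y
FHit-GHit (open′ h) (stop r) with FHit-GPass h r
... | inj₁ (() , _)
... | inj₂ (_ , () , _)

-- `FHit k` flips the unmatched closer number k + 1. Once number m + 1 is an opener, it also uses up
-- its successor, so for m ≤ k the closer number k + 1 of v is number k + 3 of w. The applications
-- have m = 0; the induction over the letters needs the general m.
FHit-swap : ∀ {m k w v u} → m ≤ k → FHit m w v → FHit k v u → ∃ λ z → FHit (2 + k) w z × FHit m z u
FHit-swap m≤k stop (open′ h) = _ , close h , stop
FHit-swap m≤k (open′ g) (open′ h) with FHit-swap (s≤s m≤k) g h
... | z , x , y = _ , open′ x , open′ y
FHit-swap (s≤s m≤k) (close g) (close h) with FHit-swap m≤k g h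
... | z , x , y = _ , close x , close y

FHit-swap⁻ : ∀ {m k w z u} → m ≤ k → FHit (2 + k) w z → FHit m z u → ∃ λ v → FHit m w v × FHit k v u
FHit-swap⁻ m≤k (close h) stop = _ , stop , open′ h
FHit-swap⁻ m≤k (open′ g) (open′ h) with FHit-swap⁻ (s≤s m≤k) g h
... | v , x , y = _ , open′ x , open′ y
FHit-swap⁻ (s≤s m≤k) (close g) (close h) with FHit-swap⁻ m≤k g h
... | v , x , y = _ , close x , close y

-- Turning the last unmatched opener into a closer adds two to the surplus of closers; two more
-- closers pending at the start have the same effect on the letters to its left.
GHit-GPass-swap : ∀ {k w v m} → GHit 0 w v → GPass k v m → GPass (2 + k) w m
GHit-GPass-swap (stop r)          (close p) = open′ (GPass-shift p 2)
GHit-GPass-swap (there {b = ○} g) (open′ p) = open′ (GHit-GPass-swap g p)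
GHit-GPass-swap (there {b = ●} g) (close p) = close (GHit-GPass-swap g p)

GHit-GPass-swap⁻ : ∀ {k w v m} → GHit 0 w v → GPass (2 + k) w m → GPass k v m
GHit-GPass-swap⁻ {k} (stop {w = w} r) (open′ {m = m} p) =
  subst (GPass k (● ∷ w)) (sym (ℕ.suc-injective (GPass-functional p (GPass-pass r (2 + k)))))
        (close (GPass-pass r k))
GHit-GPass-swap⁻ (there {b = ○} g) (open′ p) = open′ (GHit-GPass-swap⁻ g p)
GHit-GPass-swap⁻ (there {b = ●} g) (close p) = close (GHit-GPass-swap⁻ g p)

-- Mirror image of `FHit-swap` for m = 0. The pending closers enter behind the word, so the
-- recursion over its head leaves both counts fixed.
GHit-swap : ∀ {k w v u} → GHit 0 w v → GHit k v u → ∃ λ z → GHit (2 + k) w z × GHit 0 z u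
GHit-swap {k} (stop r) (there h) = ⊥-elim (GHit-GPass h (GPass-pass r k))
GHit-swap (there g) (stop p) = _ , stop (GHit-GPass-swap g p) , there g
GHit-swap (there g) (there h) with GHit-swap g h
... | z , x , y = _ , there x , there y

-- An opener is hit although 2 + k closers came in from the right. So the letters behind it contain
-- unmatched openers, and these survive the flip.
GHit-¬GPass : ∀ {k w z m} → GHit (2 + k) w z → ¬ GPass 0 z m
GHit-¬GPass {k} (stop r) (close p) with () ← GPass-functional r (GPass-pass p (2 + k))
GHit-¬GPass (there h) (open′ p) = GHit-¬GPass h p
GHit-¬GPass (there h) (close p) = GHit-¬GPass h p

GHit-swap⁻ : ∀ {k w z u} → GHit (2 + k) w z → GHit 0 z u → ∃ λ v → GHit 0 w v × GHit k v u
GHit-swap⁻ (stop p)  (there g) = _ , there g , stop (GHit-GPass-swap⁻ g p)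
GHit-swap⁻ (there h) (stop r)  = ⊥-elim (GHit-¬GPass h r)
GHit-swap⁻ (there h) (there g) with GHit-swap⁻ h g
... | v , x , y = _ , there x , there y

-- A cyclic word cut at two disjoint pairs of adjacent letters, the sites x x′ and
-- y y′; A runs from the first site to the second, and B back to the first.
record State : Set where
  constructor ⟨_,_,_,_,_,_⟩
  field
    x x′ : Bool
    A    : Word
    y y′ : Bool
    B    : Word

swapSites : State → State
swapSites ⟨ x , x′ , A , y , y′ , B ⟩ = ⟨ y , y′ , B , x , x′ , A ⟩

infix 4 _⇝_ _⇝′_

-- The Temperley–Lieb generator at the first site.  A constructor is named after the
-- direction in which the partner is searched and the part where it is found.
data _⇝_ : State → State → Set where
  swap : ∀ {A y y′ B} → ⟨ ● , ○ , A , y , y′ , B ⟩ ⇝ ⟨ ○ , ● , A , y , y′ , B ⟩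
  rA   : ∀ {A A′ y y′ B} → FHit 0 A A′ → ⟨ ○ , ○ , A , y , y′ , B ⟩ ⇝ ⟨ ○ , ● , A′ , y , y′ , B ⟩
  rY   : ∀ {A y′ B} → FPass 0 A 0 → ⟨ ○ , ○ , A , ● , y′ , B ⟩ ⇝ ⟨ ○ , ● , A , ○ , y′ , B ⟩
  rY′  : ∀ {A B} → FPass 0 A 1 → ⟨ ○ , ○ , A , ● , ● , B ⟩ ⇝ ⟨ ○ , ● , A , ● , ○ , B ⟩
  rB   : ∀ {A k y y′ m B B′} → FPass 0 A k → FPass k (y ∷ y′ ∷ []) m → FHit m B B′ →
         ⟨ ○ , ○ , A , y , y′ , B ⟩ ⇝ ⟨ ○ , ● , A , y , y′ , B′ ⟩
  lB   : ∀ {A y y′ B B′} → GHit 0 B B′ → ⟨ ● , ● , A , y , y′ , B ⟩ ⇝ ⟨ ○ , ● , A , y , y′ , B′ ⟩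
  lY′  : ∀ {A y B} → GPass 0 B 0 → ⟨ ● , ● , A , y , ○ , B ⟩ ⇝ ⟨ ○ , ● , A , y , ● , B ⟩
  lY   : ∀ {A B} → GPass 0 B 1 → ⟨ ● , ● , A , ○ , ○ , B ⟩ ⇝ ⟨ ○ , ● , A , ● , ○ , B ⟩
  lA   : ∀ {A A′ y y′ B k m} → GPass 0 B k → GPass k (y ∷ y′ ∷ []) m → GHit m A A′ →
         ⟨ ● , ● , A , y , y′ , B ⟩ ⇝ ⟨ ○ , ● , A′ , y , y′ , B ⟩

-- Cutting the same cyclic word at the other site first lets both generators share one definition.
_⇝′_ : State → State → Set
s ⇝′ t = swapSites s ⇝ swapSites t

-- A search walks over an adjacent matched pair from either side: the constructors that flip a
-- letter of the other site require a different pair of letters there.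
cup-kept : ∀ {s t} → State.x s ≡ ○ → State.x′ s ≡ ● → s ⇝′ t → State.x t ≡ ○ × State.x′ t ≡ ●
cup-kept {t = ⟨ _ , _ , _ , _ , _ , _ ⟩} refl refl swap = refl , refl
cup-kept {t = ⟨ _ , _ , _ , _ , _ , _ ⟩} refl refl (rA _) = refl , refl
cup-kept {t = ⟨ _ , _ , _ , _ , _ , _ ⟩} refl refl (rB _ _ _) = refl , refl
cup-kept {t = ⟨ _ , _ , _ , _ , _ , _ ⟩} refl refl (lB _) = refl , refl
cup-kept {t = ⟨ _ , _ , _ , _ , _ , _ ⟩} refl refl (lA _ _ _) = refl , refl

-- A new cup appears at the second site only if the sites are ○ ○ and ● ● facing each other across a
-- balanced A, or ● ● and ○ ○ across a balanced B. Then both generators make the same reconnection.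
cup-made : ∀ {s t} → s ⇝ t → State.y t ≡ ○ → State.y′ t ≡ ● → ¬ (State.y s ≡ ○ × State.y′ s ≡ ●) → s ⇝′ t
cup-made swap       refl refl ¬c = ⊥-elim (¬c (refl , refl))
cup-made (rA _)     refl refl ¬c = ⊥-elim (¬c (refl , refl))
cup-made (rY p)     refl refl ¬c = lY′ (FPass⇒GPass p)
cup-made (rB _ _ _) refl refl ¬c = ⊥-elim (¬c (refl , refl))
cup-made (lB _)     refl refl ¬c = ⊥-elim (¬c (refl , refl))
cup-made (lY′ {y = ○} r) refl refl ¬c = rY (GPass⇒FPass r)
cup-made (lA _ _ _) refl refl ¬c = ⊥-elim (¬c (refl , refl))

-- In the generic cases the searches are interchanged by the lemmas above; an offset of two pending
-- letters accounts for a site that has turned from two equal letters into a matched pair. In the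
-- others the first step creates or removes what the second search meets, and the two orders use
-- different constructors.
⇝-commute : ∀ {s t u} → s ⇝ t → t ⇝′ u → ∃ λ t′ → s ⇝′ t′ × t′ ⇝ u
⇝-commute {u = ⟨ _ , _ , _ , _ , _ , _ ⟩} swap swap = ⟨ ● , ○ , _ , ○ , ● , _ ⟩ , swap , swap
⇝-commute {u = ⟨ _ , _ , _ , _ , _ , _ ⟩} swap (rA h) = ⟨ ● , ○ , _ , ○ , ● , _ ⟩ , rA h , swap
-- With nothing pending, the second site's search passes the swapped first site. In the other order
-- it stops at the ● that is still there, and the first site, then ○ ○, finds the letter of A
-- instead.
⇝-commute {u = ⟨ _ , _ , _ , _ , _ , _ ⟩} swap (rB {k = zero} p (open′ (close nil)) h) =
  ⟨ ○ , ○ , _ , ○ , ● , _ ⟩ , rY p , rA h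
⇝-commute {u = ⟨ _ , _ , _ , _ , _ , _ ⟩} swap (rB {k = suc k} p (open′ (close nil)) h) =
  ⟨ ● , ○ , _ , ○ , ● , _ ⟩ , rB p (close (open′ nil)) h , swap
⇝-commute {u = ⟨ _ , _ , _ , _ , _ , _ ⟩} swap (lB h) = ⟨ ● , ○ , _ , ○ , ● , _ ⟩ , lB h , swap
⇝-commute {u = ⟨ _ , _ , _ , _ , _ , _ ⟩} swap (lA {k = zero} p (open′ (close nil)) h) =
  ⟨ ● , ● , _ , ○ , ● , _ ⟩ , lY′ p , lB h
⇝-commute {u = ⟨ _ , _ , _ , _ , _ , _ ⟩} swap (lA {k = suc k} p (open′ (close nil)) h) =
  ⟨ ● , ○ , _ , ○ , ● , _ ⟩ , lA p (close (open′ nil)) h , swap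
⇝-commute {u = ⟨ _ , _ , _ , _ , _ , _ ⟩} (rA f) swap = ⟨ ○ , ○ , _ , ○ , ● , _ ⟩ , swap , rA f
⇝-commute {u = ⟨ _ , _ , _ , _ , _ , _ ⟩} (rA f) (rA h) = ⟨ ○ , ○ , _ , ○ , ● , _ ⟩ , rA h , rA f
⇝-commute {u = ⟨ _ , _ , _ , _ , _ , _ ⟩} (rA f) (rB p (open′ (close nil)) h) with FHit-swap z≤n f h
... | z , h′ , f′ = ⟨ ○ , ○ , z , ○ , ● , _ ⟩ , rB p (open′ (open′ nil)) h′ , rA f′
-- The second site finds another opener of A, or the one just made if A had a single unmatched
-- closer and no unmatched opener. In the latter case A is restored; in the other order the second
-- site reaches ○ ○ with one closer pending and turns it into ● ○.
⇝-commute {⟨ _ , _ , A , _ , _ , _ ⟩} {u = ⟨ _ , _ , _ , _ , _ , _ ⟩} (rA f) (lB h) with G-total 0 A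
... | inj₁ (z , g) with FHit-GHit f g
...   | v , f′ , g′ rewrite GHit-functional h g′ = ⟨ ○ , ○ , z , ○ , ● , _ ⟩ , lB g , rA f′
⇝-commute {⟨ _ , _ , A , _ , _ , _ ⟩} {u = ⟨ _ , _ , _ , _ , _ , _ ⟩} (rA f) (lB h) | inj₂ (m , r) with FHit-GPass f r
... | inj₁ (refl , g) rewrite GHit-functional h g = ⟨ ● , ○ , A , ○ , ● , _ ⟩ , lY r , swap
... | inj₂ (_ , _ , _ , r′) = ⊥-elim (GHit-GPass h r′)
-- The first step costs A two unmatched closers; in the other order the letters ○ ○ of the first
-- site absorb two.
⇝-commute {⟨ _ , _ , A , _ , _ , _ ⟩} {u = ⟨ _ , _ , _ , _ , _ , _ ⟩} (rA f) (lA p (open′ (close nil)) h) with G-total 0 A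
... | inj₁ (z , g) with FHit-GHit f g
...   | v , f′ , g′ = ⊥-elim (GHit-GPass g′ p)
⇝-commute {⟨ _ , _ , A , _ , _ , _ ⟩} {u = ⟨ _ , _ , _ , _ , _ , _ ⟩} (rA f) (lA p (open′ (close nil)) h) | inj₂ (m , r) with FHit-GPass f r
... | inj₁ (refl , g) = ⊥-elim (GHit-GPass g p)
... | inj₂ (_ , refl , _ , r′) rewrite GPass-functional p r′ =
  ⟨ ○ , ○ , A , ○ , ● , _ ⟩ , lA r (open′ (open′ nil)) h , rA f
⇝-commute {u = ⟨ _ , _ , _ , _ , _ , _ ⟩} (rY {A = A} f) (rA h) = ⟨ ○ , ○ , A , ○ , ● , _ ⟩ , swap , rB f (open′ (close nil)) h
⇝-commute {u = ⟨ _ , _ , _ , _ , _ , _ ⟩} (rY f) (rB p (open′ (close nil)) h) = ⊥-elim (FHit-FPass h (FPass-pass f _))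
-- In the other order the second site, still ● ●, flips the one unmatched opener of A, and the first
-- site flips it back.
⇝-commute {⟨ _ , _ , A , _ , _ , _ ⟩} {u = ⟨ _ , _ , _ , _ , _ , _ ⟩} (rY′ f) swap with G-total 0 A
... | inj₂ (m , r) with () ← FPass-GPass f r
... | inj₁ (z , g) with FPass-GHit f g
...   | inj₁ (refl , f′)   = ⟨ ○ , ○ , z , ○ , ● , _ ⟩ , lB g , rA f′
...   | inj₂ (_ , () , _)
-- The flip in A leaves two pending openers fewer, which balances that the second site no longer
-- absorbs two.
⇝-commute {u = ⟨ _ , _ , _ , _ , _ , _ ⟩} (rB f (close (close nil)) h) (lB g) with FPass-GHit f g
... | inj₁ (() , _)
... | inj₂ (_ , refl , f′) = ⟨ ○ , ○ , _ , ○ , ● , _ ⟩ , lB g , rB f′ (open′ (close nil)) h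
⇝-commute {u = ⟨ _ , _ , _ , _ , _ , _ ⟩} (rB f (close (close nil)) h) (lA r _ _) with () ← FPass-GPass f r
⇝-commute {u = ⟨ _ , _ , _ , _ , _ , _ ⟩} (rB {A = A} f (close (open′ nil)) h) swap =
  ⟨ ○ , ○ , A , ○ , ● , _ ⟩ , swap , rB f (open′ (close nil)) h
⇝-commute {u = ⟨ _ , _ , _ , _ , _ , _ ⟩} (rB {A = A} f (open′ (open′ nil)) h) (rA h′) with FHit-swap⁻ z≤n h h′
... | z , g , g′ = ⟨ ○ , ○ , A , ○ , ● , z ⟩ , rA g , rB f (open′ (close nil)) g′
⇝-commute {u = ⟨ _ , _ , _ , _ , _ , _ ⟩} (rB f (open′ (open′ nil)) h) (rB p (open′ (close nil)) h′) =
  ⊥-elim (FHit-FPass h′ (FPass-pass f _))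
-- From here on the first search runs to the left. The cases mirror those above, with A and B as
-- well as openers and closers exchanged.
⇝-commute {u = ⟨ _ , _ , _ , _ , _ , _ ⟩} (lB {B = B} g) swap = ⟨ ● , ● , _ , ○ , ● , B ⟩ , swap , lB g
⇝-commute {u = ⟨ _ , _ , _ , _ , _ , _ ⟩} (lB {B = B} g) (lB h) = ⟨ ● , ● , _ , ○ , ● , B ⟩ , lB h , lB g
⇝-commute {u = ⟨ _ , _ , _ , _ , _ , _ ⟩} (lB g) (lA p (open′ (close nil)) h) with GHit-swap g h
... | z , h′ , g′ = ⟨ ● , ● , _ , ○ , ● , z ⟩ , lA p (close (close nil)) h′ , lB g′
⇝-commute {⟨ _ , _ , _ , _ , _ , B ⟩} {u = ⟨ _ , _ , _ , _ , _ , _ ⟩} (lB g) (rA h) with F-total 0 B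
... | inj₁ (z , f) with FHit-GHit f g
...   | v , f′ , g′ rewrite FHit-functional h f′ = ⟨ ● , ● , _ , ○ , ● , z ⟩ , rA f , lB g′
⇝-commute {⟨ _ , _ , _ , _ , _ , B ⟩} {u = ⟨ _ , _ , _ , _ , _ , _ ⟩} (lB g) (rA h) | inj₂ (m , p) with FPass-GHit p g
... | inj₁ (refl , f) rewrite FHit-functional h f = ⟨ ● , ○ , _ , ○ , ● , B ⟩ , rY′ p , swap
... | inj₂ (_ , _ , p′) = ⊥-elim (FHit-FPass h p′)
⇝-commute {⟨ _ , _ , _ , _ , _ , B ⟩} {u = ⟨ _ , _ , _ , _ , _ , _ ⟩} (lB g) (rB p (open′ (close nil)) h) with F-total 0 B
... | inj₁ (z , f) with FHit-GHit f g
...   | v , f′ , g′ = ⊥-elim (FHit-FPass f′ p)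
⇝-commute {⟨ _ , _ , _ , _ , _ , B ⟩} {u = ⟨ _ , _ , _ , _ , _ , _ ⟩} (lB g) (rB p (open′ (close nil)) h) | inj₂ (m , q) with FPass-GHit q g
... | inj₁ (refl , f) = ⊥-elim (FHit-FPass f p)
... | inj₂ (_ , refl , p′) rewrite FPass-functional p p′ =
  ⟨ ● , ● , _ , ○ , ● , B ⟩ , rB q (close (close nil)) h , lB g
⇝-commute {u = ⟨ _ , _ , _ , _ , _ , _ ⟩} (lY′ {B = B} r) (lB h) = ⟨ ● , ● , _ , ○ , ● , B ⟩ , swap , lA r (open′ (close nil)) h
⇝-commute {u = ⟨ _ , _ , _ , _ , _ , _ ⟩} (lY′ r) (lA p (open′ (close nil)) h) = ⊥-elim (GHit-GPass h (GPass-pass r _))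
⇝-commute {⟨ _ , _ , _ , _ , _ , B ⟩} {u = ⟨ _ , _ , _ , _ , _ , _ ⟩} (lY r) swap with F-total 0 B
... | inj₂ (m , p) with trans (sym (ℕ.+-suc m 0)) (FPass-GPass p r)
...   | ()
⇝-commute {⟨ _ , _ , _ , _ , _ , B ⟩} {u = ⟨ _ , _ , _ , _ , _ , _ ⟩} (lY r) swap | inj₁ (z , f) with FHit-GPass f r
... | inj₁ (_ , g)           = ⟨ ● , ● , _ , ○ , ● , z ⟩ , rA f , lB g
... | inj₂ (_ , () , _)
⇝-commute {u = ⟨ _ , _ , _ , _ , _ , _ ⟩} (lA {B = B} r (open′ (open′ nil)) h) (rA f) with FHit-GPass f r
... | inj₁ (() , _)
... | inj₂ (_ , refl , _ , r′) = ⟨ ● , ● , _ , ○ , ● , _ ⟩ , rA f , lA r′ (open′ (close nil)) h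
⇝-commute {u = ⟨ _ , _ , _ , _ , _ , _ ⟩} (lA r (open′ (open′ nil)) h) (rB {k = k} p _ _)
  with trans (sym (ℕ.+-suc k _)) (FPass-GPass p r)
... | ()
⇝-commute {u = ⟨ _ , _ , _ , _ , _ , _ ⟩} (lA {B = B} r (close (open′ nil)) h) swap =
  ⟨ ● , ● , _ , ○ , ● , B ⟩ , swap , lA r (open′ (close nil)) h
⇝-commute {u = ⟨ _ , _ , _ , _ , _ , _ ⟩} (lA {B = B} r (close (close nil)) h) (lB h′) with GHit-swap⁻ h h′
... | z , g , g′ = ⟨ ● , ● , z , ○ , ● , B ⟩ , lB g , lA r (open′ (close nil)) g′
⇝-commute {u = ⟨ _ , _ , _ , _ , _ , _ ⟩} (lA r (close (close nil)) h) (lA p (open′ (close nil)) h′) =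
  ⊥-elim (GHit-GPass h′ (GPass-pass r _))

-- Cyclic words

FHit-++ˡ : ∀ {k A A′} B → FHit k A A′ → FHit k (A ++ B) (A′ ++ B)
FHit-++ˡ B stop      = stop
FHit-++ˡ B (open′ h) = open′ (FHit-++ˡ B h)
FHit-++ˡ B (close h) = close (FHit-++ˡ B h)

FHit-++ʳ : ∀ {k A m B B′} → FPass k A m → FHit m B B′ → FHit k (A ++ B) (A ++ B′)
FHit-++ʳ nil       h = h
FHit-++ʳ (open′ p) h = open′ (FHit-++ʳ p h)
FHit-++ʳ (close p) h = close (FHit-++ʳ p h)

FHit-++⁻ : ∀ {k} A {B v} → FHit k (A ++ B) v →
  (∃ λ A′ → v ≡ A′ ++ B × FHit k A A′) ⊎ (∃₂ λ m B′ → v ≡ A ++ B′ × FPass k A m × FHit m B B′)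
FHit-++⁻ []      h = inj₂ (_ , _ , refl , nil , h)
FHit-++⁻ (● ∷ A) stop = inj₁ (_ , refl , stop)
FHit-++⁻ (○ ∷ A) (open′ h) with FHit-++⁻ A h
... | inj₁ (A′ , refl , h′)         = inj₁ (_ , refl , open′ h′)
... | inj₂ (m , B′ , refl , p , h′) = inj₂ (_ , _ , refl , open′ p , h′)
FHit-++⁻ (● ∷ A) (close h) with FHit-++⁻ A h
... | inj₁ (A′ , refl , h′)         = inj₁ (_ , refl , close h′)
... | inj₂ (m , B′ , refl , p , h′) = inj₂ (_ , _ , refl , close p , h′)

GHit-++ʳ : ∀ {k} A {B B′} → GHit k B B′ → GHit k (A ++ B) (A ++ B′)
GHit-++ʳ []      h = h
GHit-++ʳ (b ∷ A) h = there (GHit-++ʳ A h)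

GPass-++ : ∀ {k m l A B} → GPass k B m → GPass m A l → GPass k (A ++ B) l
GPass-++ p nil       = p
GPass-++ p (open′ q) = open′ (GPass-++ p q)
GPass-++ p (close q) = close (GPass-++ p q)

GPass-++⁻ : ∀ {k l} A {B} → GPass k (A ++ B) l → ∃ λ m → GPass k B m × GPass m A l
GPass-++⁻ []      p = _ , p , nil
GPass-++⁻ (○ ∷ A) (open′ p) with GPass-++⁻ A p
... | m , q , r = m , q , open′ r
GPass-++⁻ (● ∷ A) (close p) with GPass-++⁻ A p
... | m , q , r = m , q , close r

GHit-++ˡ : ∀ {k m A A′ B} → GPass k B m → GHit m A A′ → GHit k (A ++ B) (A′ ++ B)
GHit-++ˡ p (stop q)  = stop (GPass-++ p q)
GHit-++ˡ p (there h) = there (GHit-++ˡ p h)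

GHit-++⁻ : ∀ {k} A {B v} → GHit k (A ++ B) v →
  (∃ λ B′ → v ≡ A ++ B′ × GHit k B B′) ⊎ (∃₂ λ m A′ → v ≡ A′ ++ B × GPass k B m × GHit m A A′)
GHit-++⁻ []      h = inj₁ (_ , refl , h)
GHit-++⁻ (○ ∷ A) (stop p) with GPass-++⁻ A p
... | m , q , r = inj₂ (m , _ , refl , q , stop r)
GHit-++⁻ (b ∷ A) (there h) with GHit-++⁻ A h
... | inj₁ (B′ , refl , h′)         = inj₁ (_ , refl , h′)
... | inj₂ (m , A′ , refl , p , h′) = inj₂ (_ , _ , refl , p , there h′)

-- The Temperley–Lieb generator at the first two letters of a cyclic word, on the
-- words that it does not merely rescale.
data Step : Word → Word → Set where
  swap  : ∀ {w} → Step (● ∷ ○ ∷ w) (○ ∷ ● ∷ w)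
  right : ∀ {w v} → FHit 0 w v → Step (○ ∷ ○ ∷ w) (○ ∷ ● ∷ v)
  left  : ∀ {w v} → GHit 0 w v → Step (● ∷ ● ∷ w) (○ ∷ ● ∷ v)

Step-functional : ∀ {w v v′} → Step w v → Step w v′ → v ≡ v′
Step-functional swap      swap       = refl
Step-functional (right h) (right h′) = cong (λ v → ○ ∷ ● ∷ v) (FHit-functional h h′)
Step-functional (left h)  (left h′)  = cong (λ v → ○ ∷ ● ∷ v) (GHit-functional h h′)

Step-target : ∀ {w b c v u} → Step w v → v ≡ b ∷ c ∷ u → b ≡ ○ × c ≡ ●
Step-target swap      refl = refl , refl
Step-target (right _) refl = refl , refl
Step-target (left _)  refl = refl , refl

Step-source : ∀ {w u v} → Step w v → w ≢ ○ ∷ ● ∷ u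
Step-source swap ()

step? : ∀ w → Dec (∃ (Step w))
step? []          = no λ ()
step? (_ ∷ [])    = no λ ()
step? (● ∷ ○ ∷ w) = yes (_ , swap)
step? (○ ∷ ● ∷ w) = no λ ()
step? (○ ∷ ○ ∷ w) with F-total 0 w
... | inj₁ (v , h) = yes (_ , right h)
... | inj₂ (m , p) = no λ { (_ , right h) → FHit-FPass h p }
step? (● ∷ ● ∷ w) with G-total 0 w
... | inj₁ (v , h) = yes (_ , left h)
... | inj₂ (m , p) = no λ { (_ , left h) → GHit-GPass h p }

# : Word → ℕ
# []      = 0
# (○ ∷ w) = # w
# (● ∷ w) = suc (# w)

#-++ : ∀ v w → # (v ++ w) ≡ # v + # w
#-++ []      w = refl
#-++ (○ ∷ v) w = #-++ v w
#-++ (● ∷ v) w = cong suc (#-++ v w)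

FHit-# : ∀ {k w v} → FHit k w v → # w ≡ suc (# v)
FHit-# stop      = refl
FHit-# (open′ h) = FHit-# h
FHit-# (close h) = cong suc (FHit-# h)

GHit-# : ∀ {k w v} → GHit k w v → suc (# w) ≡ # v
GHit-# (stop _)        = refl
GHit-# (there {b = ○} h) = GHit-# h
GHit-# (there {b = ●} h) = cong suc (GHit-# h)

Step-# : ∀ {w v} → Step w v → # v ≡ # w
Step-# swap      = refl
Step-# (right h) = sym (FHit-# h)
Step-# (left h)  = cong suc (sym (GHit-# h))

FHit-length : ∀ {k w v} → FHit k w v → length v ≡ length w
FHit-length stop      = refl
FHit-length (open′ h) = cong suc (FHit-length h)
FHit-length (close h) = cong suc (FHit-length h)

GHit-length : ∀ {k w v} → GHit k w v → length v ≡ length w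
GHit-length (stop _)  = refl
GHit-length (there h) = cong suc (GHit-length h)

Step-length : ∀ {w v} → Step w v → length v ≡ length w
Step-length swap      = refl
Step-length (right h) = cong (2 +_) (FHit-length h)
Step-length (left h)  = cong (2 +_) (GHit-length h)

rotl : Word → Word
rotl []      = []
rotl (b ∷ w) = w ++ [ b ]

cup-right : ∀ z w → ∃ λ v → Step (rotl (○ ∷ ● ∷ z ∷ w)) (rotl v) × Step v (○ ∷ ● ∷ z ∷ w)
cup-right ○ w = ○ ∷ ○ ∷ ● ∷ w , swap , right stop
-- After the rotation the opener of the cup is the last letter, which is where the search to the
-- left begins.
cup-right ● w = ● ∷ ○ ∷ ● ∷ w , left (GHit-++ʳ w (stop nil)) , swap

cup-left : ∀ z w → ∃ λ v → Step (z ∷ ○ ∷ ● ∷ w) v × Step (rotl v) (rotl (z ∷ ○ ∷ ● ∷ w))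
cup-left ○ w = ○ ∷ ● ∷ ○ ∷ w , right stop , swap
cup-left ● w = ○ ∷ ● ∷ ● ∷ w , swap , left (GHit-++ʳ w (stop nil))

flatten : State → Word
flatten ⟨ x , x′ , A , y , y′ , B ⟩ = x ∷ x′ ∷ A ++ y ∷ y′ ∷ B

-- `flatten` forgets where the word was cut; it is injective only once the lengths of A and B are
-- fixed.
SameShape : State → State → Set
SameShape s t = length (State.A s) ≡ length (State.A t) × length (State.B s) ≡ length (State.B t)

⇝-shape : ∀ {s t} → s ⇝ t → SameShape s t
⇝-shape swap       = refl , refl
⇝-shape (rA h)     = sym (FHit-length h) , refl
⇝-shape (rY _)     = refl , refl
⇝-shape (rY′ _)    = refl , refl
⇝-shape (rB _ _ h) = refl , sym (FHit-length h)
⇝-shape (lB h)     = refl , sym (GHit-length h)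
⇝-shape (lY′ _)    = refl , refl
⇝-shape (lY _)     = refl , refl
⇝-shape (lA _ _ h) = sym (GHit-length h) , refl

++-injective-length : ∀ (u v : Word) {w z} → length u ≡ length v → u ++ w ≡ v ++ z → u ≡ v × w ≡ z
++-injective-length []      []      _  eq = refl , eq
++-injective-length (b ∷ u) (c ∷ v) le eq with List.∷-injective eq
... | refl , eq′ with ++-injective-length u v (ℕ.suc-injective le) eq′
...   | refl , eq″ = refl , eq″

flatten-injective : ∀ s t → SameShape s t → flatten s ≡ flatten t → s ≡ t
flatten-injective ⟨ _ , _ , A , _ , _ , B ⟩ ⟨ _ , _ , C , _ , _ , D ⟩ (le , _) eq
  with refl , eq′ ← List.∷-injective eq
  with refl , eq′ ← List.∷-injective eq′
  with ++-injective-length A C le eq′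
... | refl , refl = refl

⇝⇒Step : ∀ {s t} → s ⇝ t → Step (flatten s) (flatten t)
⇝⇒Step swap       = swap
⇝⇒Step (rA h)     = right (FHit-++ˡ _ h)
⇝⇒Step (rY p)     = right (FHit-++ʳ p stop)
⇝⇒Step (rY′ p)    = right (FHit-++ʳ p (close stop))
⇝⇒Step (rB {y = ○} {y′ = ○} p (open′ (open′ nil)) h) = right (FHit-++ʳ p (open′ (open′ h)))
⇝⇒Step (rB {y = ○} {y′ = ●} p (open′ (close nil)) h) = right (FHit-++ʳ p (open′ (close h)))
⇝⇒Step (rB {y = ●} {y′ = ○} p (close (open′ nil)) h) = right (FHit-++ʳ p (close (open′ h)))
⇝⇒Step (rB {y = ●} {y′ = ●} p (close (close nil)) h) = right (FHit-++ʳ p (close (close h)))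
⇝⇒Step (lB {A = A} h)     = left (GHit-++ʳ A (there (there h)))
⇝⇒Step (lY′ {A = A} p)    = left (GHit-++ʳ A (there (stop p)))
⇝⇒Step (lY {A = A} p)     = left (GHit-++ʳ A (stop (open′ p)))
⇝⇒Step (lA {B = B} p q h) = left (GHit-++ˡ (GPass-++ p q) h)

Step⇒⇝ : ∀ s {w} → Step (flatten s) w → ∃ λ t → w ≡ flatten t × s ⇝ t
Step⇒⇝ ⟨ _ , _ , A , y , y′ , B ⟩ swap = ⟨ ○ , ● , A , y , y′ , B ⟩ , refl , swap
Step⇒⇝ ⟨ _ , _ , A , y , y′ , B ⟩ (right h) with FHit-++⁻ A h
... | inj₁ (A′ , refl , h′) = _ , refl , rA h′
... | inj₂ (_ , _ , refl , p , stop) = _ , refl , rY p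
... | inj₂ (_ , _ , refl , p , close stop) = _ , refl , rY′ p
... | inj₂ (_ , _ , refl , p , open′ (open′ h′)) = _ , refl , rB p (open′ (open′ nil)) h′
... | inj₂ (_ , _ , refl , p , open′ (close h′)) = _ , refl , rB p (open′ (close nil)) h′
... | inj₂ (_ , _ , refl , p , close (open′ h′)) = _ , refl , rB p (close (open′ nil)) h′
... | inj₂ (_ , _ , refl , p , close (close h′)) = _ , refl , rB p (close (close nil)) h′
Step⇒⇝ ⟨ _ , _ , A , y , y′ , B ⟩ (left h) with GHit-++⁻ A h
... | inj₁ (_ , refl , there (there h′)) = _ , refl , lB h′
... | inj₁ (_ , refl , there (stop p))   = _ , refl , lY′ p
... | inj₁ (_ , refl , stop (open′ p))   = _ , refl , lY p
... | inj₂ (_ , _ , refl , p , h′) with GPass-++⁻ (y ∷ y′ ∷ []) p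
...   | _ , q , r = _ , refl , lA q r h′

-- Subsets of the cycle as words

seg : (ℕ → Bool) → ℕ → ℕ → Word
seg f a zero    = []
seg f a (suc m) = f a ∷ seg f (suc a) m

length-seg : ∀ f a m → length (seg f a m) ≡ m
length-seg f a zero    = refl
length-seg f a (suc m) = cong suc (length-seg f (suc a) m)

seg-++ : ∀ f a m l → seg f a (m + l) ≡ seg f a m ++ seg f (m + a) l
seg-++ f a zero    l = refl
seg-++ f a (suc m) l = cong (f a ∷_) (trans (seg-++ f (suc a) m l)
  (cong (λ c → seg f (suc a) m ++ seg f c l) (ℕ.+-suc m a)))

nth : Word → ℕ → Bool
-- All words read the same past their end, so comparisons such as `nth-++-other` need no bound on
-- the position.
nth []      k       = ○
nth (b ∷ w) zero    = b
nth (b ∷ w) (suc k) = nth w k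

nth-seg : ∀ f a {m} y → y < m → nth (seg f a m) y ≡ f (y + a)
nth-seg f a {suc m} zero    _         = refl
nth-seg f a {suc m} (suc y) (s≤s y<m) = trans (nth-seg f (suc a) y y<m) (cong f (ℕ.+-suc y a))

seg-nth : ∀ f a w → (∀ y → y < length w → f (y + a) ≡ nth w y) → seg f a (length w) ≡ w
seg-nth f a []      eq = refl
seg-nth f a (b ∷ w) eq = cong₂ _∷_ (eq 0 (s≤s z≤n))
  (seg-nth f (suc a) w λ y y<m → trans (cong f (ℕ.+-suc y a)) (eq (suc y) (s≤s y<m)))

seg-cong : ∀ f g a b m → (∀ y → y < m → f (y + a) ≡ g (y + b)) → seg f a m ≡ seg g b m
seg-cong f g a b zero    eq = refl
seg-cong f g a b (suc m) eq = cong₂ _∷_ (eq 0 (s≤s z≤n))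
  (seg-cong f g (suc a) (suc b) m λ y y<m →
    trans (cong f (ℕ.+-suc y a)) (trans (eq (suc y) (s≤s y<m)) (cong g (sym (ℕ.+-suc y b)))))

module CyclicWords (n : ℕ) .{{_ : NonZero n}} where

  infix 4 _≋_
  -- Positions are natural numbers up to this congruence, so that a window can run past n and no
  -- case of wrapping around has to be distinguished.
  _≋_ : ℕ → ℕ → Set
  k ≋ l = k % n ≡ l % n

  +-cong-≋ : ∀ {k k′ l l′} → k ≋ k′ → l ≋ l′ → k + l ≋ k′ + l′
  +-cong-≋ {k} {k′} {l} {l′} p q =
    trans (%-distribˡ-+ k l n) (trans (cong₂ (λ x y → (x + y) % n) p q) (sym (%-distribˡ-+ k′ l′ n)))

  %-≋ : ∀ k → k % n ≋ k
  %-≋ k = m%n%n≡m%n k n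

  n+-≋ : ∀ k → n + k ≋ k
  n+-≋ k = trans (cong (_% n) (ℕ.+-comm n k)) ([m+n]%n≡m%n k n)

  neg : ℕ → ℕ
  neg a = n ∸ a % n

  +-neg : ∀ k a → k + neg a + a ≋ k
  +-neg k a = begin
    (k + neg a + a) % n         ≡⟨ +-cong-≋ {k + neg a} refl (sym (%-≋ a)) ⟩
    (k + neg a + a % n) % n     ≡⟨ cong (_% n) (ℕ.+-assoc k (neg a) (a % n)) ⟩
    (k + (neg a + a % n)) % n   ≡⟨ cong (λ c → (k + c) % n) (ℕ.m∸n+n≡m (ℕ.<⇒≤ (m%n<n a n))) ⟩
    (k + n) % n                 ≡⟨ [m+n]%n≡m%n k n ⟩
    k % n                       ∎
    where open ≡-Reasoning

  +-cancelʳ-≋ : ∀ {k l} a → k + a ≋ l + a → k ≋ l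
  +-cancelʳ-≋ {k} {l} a eq = begin
    k % n               ≡⟨ lemma k ⟨
    (k + a + neg a) % n ≡⟨ +-cong-≋ {k + a} eq refl ⟩
    (l + a + neg a) % n ≡⟨ lemma l ⟩
    l % n               ∎
    where
    open ≡-Reasoning
    lemma : ∀ k → k + a + neg a ≋ k
    lemma k = trans (cong (_% n) (trans (ℕ.+-assoc k a (neg a))
      (trans (cong (k +_) (ℕ.+-comm a (neg a))) (sym (ℕ.+-assoc k (neg a) a))))) (+-neg k a)

  <-≋ : ∀ {k l} → k < n → l < n → k ≋ l → k ≡ l
  <-≋ k<n l<n eq = trans (sym (m<n⇒m%n≡m k<n)) (trans eq (m<n⇒m%n≡m l<n))

  steps : ℕ → ℕ → ℕ
  steps a k = (k + neg a) % n

  steps< : ∀ a k → steps a k < n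
  steps< a k = m%n<n (k + neg a) n

  steps-≋ : ∀ a k → steps a k + a ≋ k
  steps-≋ a k = trans (+-cong-≋ {steps a k} (%-≋ (k + neg a)) refl) (+-neg k a)

  steps-unique : ∀ a {k y} → y < n → y + a ≋ k → steps a k ≡ y
  steps-unique a {k} {y} y<n eq = <-≋ (steps< a k) y<n (+-cancelʳ-≋ a (trans (steps-≋ a k) (sym eq)))

  -- ⟦ k ⟧ is the entry congruent to k + 1, since Fin n counts the entries from 0.
  ⟦_⟧ : ℕ → Fin n
  ⟦ k ⟧ = k mod n

  toℕ-⟦⟧ : ∀ k → toℕ ⟦ k ⟧ ≡ k % n
  toℕ-⟦⟧ k = Fin.toℕ-fromℕ< (m%n<n k n)

  ⟦⟧-cong : ∀ {k l} → k ≋ l → ⟦ k ⟧ ≡ ⟦ l ⟧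
  ⟦⟧-cong {k} {l} eq = Fin.toℕ-injective (trans (toℕ-⟦⟧ k) (trans eq (sym (toℕ-⟦⟧ l))))

  ⟦⟧-injective : ∀ {k l} → ⟦ k ⟧ ≡ ⟦ l ⟧ → k ≋ l
  ⟦⟧-injective {k} {l} eq = trans (sym (toℕ-⟦⟧ k)) (trans (cong toℕ eq) (toℕ-⟦⟧ l))

  ⟦toℕ⟧ : ∀ i → ⟦ toℕ i ⟧ ≡ i
  ⟦toℕ⟧ i = Fin.toℕ-injective (trans (toℕ-⟦⟧ (toℕ i)) (m<n⇒m%n≡m (Fin.toℕ<n i)))

  χ : Subset n → ℕ → Bool
  χ p k = lookup p ⟦ k ⟧

  χ-cong : ∀ p {k l} → k ≋ l → χ p k ≡ χ p l
  χ-cong p eq = cong (lookup p) (⟦⟧-cong eq)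

  χ-ext : ∀ {p p′} a → (∀ y → y < n → χ p (y + a) ≡ χ p′ (y + a)) → p ≡ p′
  χ-ext {p} {p′} a eq = trans (sym (Vec.tabulate∘lookup p))
    (trans (Vec.tabulate-cong pointwise) (Vec.tabulate∘lookup p′))
    where
    pointwise : ∀ i → lookup p i ≡ lookup p′ i
    pointwise i = begin
      lookup p i                          ≡⟨ cong (lookup p) (⟦toℕ⟧ i) ⟨
      χ p (toℕ i)                         ≡⟨ χ-cong p (steps-≋ a (toℕ i)) ⟨
      χ p (steps a (toℕ i) + a)           ≡⟨ eq _ (steps< a (toℕ i)) ⟩
      χ p′ (steps a (toℕ i) + a)          ≡⟨ χ-cong p′ (steps-≋ a (toℕ i)) ⟩
      χ p′ (toℕ i)                        ≡⟨ cong (lookup p′) (⟦toℕ⟧ i) ⟩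
      lookup p′ i                         ∎
      where open ≡-Reasoning

  rot : Subset n → ℕ → Word
  rot p a = seg (χ p) a n

  rot-nth : ∀ p a y → y < n → nth (rot p a) y ≡ χ p (y + a)
  rot-nth p a y = nth-seg (χ p) a y

  rot-injective : ∀ {p p′} a → rot p a ≡ rot p′ a → p ≡ p′
  rot-injective {p} {p′} a eq = χ-ext a λ y y<n →
    trans (sym (rot-nth p a y y<n)) (trans (cong (λ w → nth w y) eq) (rot-nth p′ a y y<n))

  rot-cong : ∀ p {a b} → a ≋ b → rot p a ≡ rot p b
  rot-cong p {a} {b} eq = seg-cong (χ p) (χ p) a b n λ y _ → χ-cong p (+-cong-≋ {y} refl eq)

  rot-suc : ∀ p a → rot p (suc a) ≡ rotl (rot p a)
  rot-suc p a = lemma n refl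
    where
    lemma : ∀ m → m ≡ n → seg (χ p) (suc a) m ≡ rotl (seg (χ p) a m)
    lemma zero    _  = refl
    lemma (suc m) eq = begin
      seg (χ p) (suc a) (suc m)                        ≡⟨ cong (seg (χ p) (suc a)) (ℕ.+-comm 1 m) ⟩
      seg (χ p) (suc a) (m + 1)                        ≡⟨ seg-++ (χ p) (suc a) m 1 ⟩
      seg (χ p) (suc a) m ++ [ χ p (m + suc a) ]       ≡⟨ cong (λ b → seg (χ p) (suc a) m ++ [ b ]) wrap ⟩
      seg (χ p) (suc a) m ++ [ χ p a ]                 ∎
      where
      open ≡-Reasoning
      wrap : χ p (m + suc a) ≡ χ p a
      wrap = χ-cong p (trans (cong (_% n) (trans (ℕ.+-suc m a) (cong (_+ a) eq))) (n+-≋ a))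

  unrot : ℕ → Word → Subset n
  unrot a w = tabulate (λ i → nth w (steps a (toℕ i)))

  χ-unrot : ∀ a w y → y < n → χ (unrot a w) (y + a) ≡ nth w y
  χ-unrot a w y y<n = trans (Vec.lookup∘tabulate _ ⟦ y + a ⟧)
    (cong (nth w) (steps-unique a y<n (sym (trans (cong (_% n) (toℕ-⟦⟧ (y + a))) (%-≋ (y + a))))))

  rot-unrot : ∀ a w → length w ≡ n → rot (unrot a w) a ≡ w
  rot-unrot a w eq = trans (cong (seg (χ (unrot a w)) a) (sym eq))
    (seg-nth _ a w λ y y<l → χ-unrot a w y (ℕ.<-≤-trans y<l (ℕ.≤-reflexive eq)))

  #-rotl : ∀ w → # (rotl w) ≡ # w
  #-rotl []      = refl
  #-rotl (○ ∷ w) = trans (#-++ w [ ○ ]) (ℕ.+-identityʳ _)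
  #-rotl (● ∷ w) = trans (#-++ w [ ● ]) (ℕ.+-comm _ 1)

  #-seg : ∀ {m} (p : Subset m) f a → (∀ i → f (toℕ i + a) ≡ lookup p i) → # (seg f a m) ≡ ∣ p ∣
  #-seg Vec.[]      f a eq = refl
  #-seg (b Vec.∷ p) f a eq with f a | eq Fin.zero | #-seg p f (suc a) (λ i → trans (cong f (ℕ.+-suc (toℕ i) a)) (eq (Fin.suc i)))
  ... | ○ | refl | rec = rec
  ... | ● | refl | rec = cong suc rec

  #-rot : ∀ p a → # (rot p a) ≡ ∣ p ∣
  #-rot p zero    = #-seg p (χ p) 0 λ i → trans (cong (χ p) (ℕ.+-identityʳ (toℕ i))) (cong (lookup p) (⟦toℕ⟧ i))
  #-rot p (suc a) = trans (cong # (rot-suc p a)) (trans (#-rotl (rot p a)) (#-rot p a))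

  length-rot : ∀ p a → length (rot p a) ≡ n
  length-rot p a = length-seg (χ p) a n

  record StepAt (a : ℕ) (p p′ : Subset n) : Set where
    constructor stepAt
    field step : Step (rot p a) (rot p′ a)
  open StepAt

  StepAt-cong : ∀ {a b p p′} → a ≋ b → StepAt a p p′ → StepAt b p p′
  StepAt-cong {p = p} {p′} eq (stepAt s) = stepAt (subst₂ Step (rot-cong p eq) (rot-cong p′ eq) s)

  StepAt-functional : ∀ {a p p′ p″} → StepAt a p p′ → StepAt a p p″ → p′ ≡ p″
  StepAt-functional {a} (stepAt s) (stepAt s′) = rot-injective a (Step-functional s s′)

  StepAt-card : ∀ {a p p′} → StepAt a p p′ → ∣ p′ ∣ ≡ ∣ p ∣
  StepAt-card {a} {p} {p′} (stepAt s) = trans (sym (#-rot p′ a)) (trans (Step-# s) (#-rot p a))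

  Step⇒StepAt : ∀ a p {w} → Step (rot p a) w → ∃ λ p′ → rot p′ a ≡ w × StepAt a p p′
  Step⇒StepAt a p {w} s = unrot a w , eq , stepAt (subst (Step (rot p a)) (sym eq) s)
    where eq = rot-unrot a w (trans (Step-length s) (length-rot p a))

  stepAt? : ∀ a p → Dec (∃ (StepAt a p))
  stepAt? a p with step? (rot p a)
  ... | yes (w , s) with p′ , _ , s′ ← Step⇒StepAt a p s = yes (p′ , s′)
  ... | no ¬s = no λ { (p′ , stepAt s) → ¬s (_ , s) }

  record CupAt (a : ℕ) (p : Subset n) : Set where
    constructor cupAt
    field
      opens  : χ p a ≡ ○
      closes : χ p (suc a) ≡ ●

  rot-2+ : ∀ {r} → 2 + r ≡ n → ∀ p a → rot p a ≡ χ p a ∷ χ p (suc a) ∷ seg (χ p) (2 + a) r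
  rot-2+ eq p a = cong (seg (χ p) a) (sym eq)

  rot-3+ : ∀ {r} → 3 + r ≡ n → ∀ p a → rot p a ≡ χ p a ∷ χ p (1 + a) ∷ χ p (2 + a) ∷ seg (χ p) (3 + a) r
  rot-3+ eq p a = cong (seg (χ p) a) (sym eq)

  StepAt-target : ∀ {a p p′} → 2 ≤ n → StepAt a p p′ → CupAt a p′
  StepAt-target {a} {p} {p′} 2≤n (stepAt s)
    with r , eq ← ℕ.m≤n⇒∃[o]m+o≡n 2≤n
    with e , e′ ← Step-target s (rot-2+ eq p′ a) = cupAt e e′

  StepAt-source : ∀ {a p p′} → 2 ≤ n → StepAt a p p′ → ¬ CupAt a p
  StepAt-source {a} {p} {p′} 2≤n (stepAt s) (cupAt e e′) with r , eq ← ℕ.m≤n⇒∃[o]m+o≡n 2≤n =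
    Step-source s (trans (rot-2+ eq p a) (cong₂ (λ b c → b ∷ c ∷ seg (χ p) (2 + a) r) e e′))

  -- The neighbouring site shares one letter with the cup, and 3 ≤ n makes its other letter a third
  -- one, on whose value `cup-right` branches.
  cupAt-next : ∀ {a p} → 3 ≤ n → CupAt a p → ∃ λ p′ → StepAt (suc a) p p′ × StepAt a p′ p
  cupAt-next {a} {p} 3≤n (cupAt e e′)
    with r , eq ← ℕ.m≤n⇒∃[o]m+o≡n 3≤n
    with z , w , eq′ ← ∃₂ (λ z w → rot p a ≡ ○ ∷ ● ∷ z ∷ w) ∋
                        (_ , _ , trans (rot-3+ eq p a) (cong₂ (λ b c → b ∷ c ∷ χ p (2 + a) ∷ seg (χ p) (3 + a) r) e e′))
    with v , s , s′ ← cup-right z w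
    = p′ , stepAt (subst₂ Step (sym (trans (rot-suc p a) (cong rotl eq′))) (sym (trans (rot-suc p′ a) (cong rotl eq″))) s)
         , stepAt (subst₂ Step (sym eq″) (sym eq′) s′)
    where
    p′  = unrot a v
    eq″ : rot p′ a ≡ v
    eq″ = rot-unrot a v (trans (sym (Step-length s′)) (trans (cong length (sym eq′)) (length-rot p a)))

  cupAt-prev : ∀ {a p} → 3 ≤ n → CupAt (suc a) p → ∃ λ p′ → StepAt a p p′ × StepAt (suc a) p′ p
  cupAt-prev {a} {p} 3≤n (cupAt e e′)
    with r , eq ← ℕ.m≤n⇒∃[o]m+o≡n 3≤n
    with z , w , eq′ ← ∃₂ (λ z w → rot p a ≡ z ∷ ○ ∷ ● ∷ w) ∋
                        (_ , _ , trans (rot-3+ eq p a) (cong₂ (λ b c → χ p a ∷ b ∷ c ∷ seg (χ p) (3 + a) r) e e′))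
    with v , s , s′ ← cup-left z w
    with p′ , eq″ , s″ ← Step⇒StepAt a p (subst (λ u → Step u v) (sym eq′) s)
    = p′ , s″ , stepAt (subst₂ Step (sym (trans (rot-suc p′ a) (cong rotl eq″))) (sym (trans (rot-suc p a) (cong rotl eq′))) s′)

  module TwoSites (a α β : ℕ) (n-eq : 2 + (α + (2 + β)) ≡ n) where

    b : ℕ
    b = 2 + α + a

    state : Subset n → State
    state p = ⟨ χ p a , χ p (1 + a) , seg (χ p) (2 + a) α , χ p b , χ p (1 + b) , seg (χ p) (2 + b) β ⟩

    state-shape : ∀ p p′ → SameShape (state p) (state p′)
    state-shape p p′ = trans (length-seg (χ p) _ α) (sym (length-seg (χ p′) _ α)) ,
                       trans (length-seg (χ p) _ β) (sym (length-seg (χ p′) _ β))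

    rot-a : ∀ p → rot p a ≡ flatten (state p)
    rot-a p = trans (cong (seg (χ p) a) (sym n-eq))
      (cong (λ w → χ p a ∷ χ p (1 + a) ∷ w)
        (trans (seg-++ (χ p) (2 + a) α (2 + β))
               (cong (λ c → seg (χ p) (2 + a) α ++ seg (χ p) c (2 + β)) (trans (ℕ.+-suc α (1 + a)) (cong suc (ℕ.+-suc α a))))))

    rot-b : ∀ p → rot p b ≡ flatten (swapSites (state p))
    rot-b p = trans (cong (seg (χ p) b) (trans (sym n-eq) n-eq′))
      (cong (λ w → χ p b ∷ χ p (1 + b) ∷ w)
        (trans (seg-++ (χ p) (2 + b) β (2 + α))
               (cong (seg (χ p) (2 + b) β ++_) (seg-cong (χ p) (χ p) (β + (2 + b)) a (2 + α) wrap))))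
      where
      n-eq′ : 2 + (α + (2 + β)) ≡ 2 + (β + (2 + α))
      n-eq′ = solve 2 (λ α β → con 2 :+ (α :+ (con 2 :+ β)) := con 2 :+ (β :+ (con 2 :+ α))) refl α β
      wrap : ∀ y → y < 2 + α → χ p (y + (β + (2 + b))) ≡ χ p (y + a)
      wrap y _ = χ-cong p (trans (cong (_% n) (trans
        (solve 4 (λ y α β a → y :+ (β :+ (con 2 :+ (con 2 :+ α :+ a))) :=
                              con 2 :+ (α :+ (con 2 :+ β)) :+ (y :+ a)) refl y α β a)
        (cong (_+ (y + a)) n-eq))) (n+-≋ (y + a)))

    -- `Step⇒⇝` yields some state with the right flattening; the equal cut lengths identify it with
    -- t.
    to : ∀ {s t} → SameShape s t → Step (flatten s) (flatten t) → s ⇝ t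
    to {s} {t} sh st with u , eq , s⇝u ← Step⇒⇝ s st
      with sh′ ← ⇝-shape s⇝u
      rewrite flatten-injective t u (trans (sym (proj₁ sh)) (proj₁ sh′) , trans (sym (proj₂ sh)) (proj₂ sh′)) eq
      = s⇝u

    StepAt-a⇒ : ∀ {p p′} → StepAt a p p′ → state p ⇝ state p′
    StepAt-a⇒ {p} {p′} (stepAt s) = to (state-shape p p′) (subst₂ Step (rot-a p) (rot-a p′) s)

    StepAt-a⇐ : ∀ p p′ → state p ⇝ state p′ → StepAt a p p′
    StepAt-a⇐ p p′ s = stepAt (subst₂ Step (sym (rot-a p)) (sym (rot-a p′)) (⇝⇒Step s))

    StepAt-b⇒ : ∀ {p p′} → StepAt b p p′ → state p ⇝′ state p′
    StepAt-b⇒ {p} {p′} (stepAt s) = to (swap′ (state-shape p p′)) (subst₂ Step (rot-b p) (rot-b p′) s)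
      where
      swap′ : ∀ {P Q : Set} → P × Q → Q × P
      swap′ (x , y) = y , x

    StepAt-b⇐ : ∀ p p′ → state p ⇝′ state p′ → StepAt b p p′
    StepAt-b⇐ p p′ s = stepAt (subst₂ Step (sym (rot-b p)) (sym (rot-b p′)) (⇝⇒Step s))

    cupAt-kept : ∀ {p p′} → CupAt a p → StepAt b p p′ → CupAt a p′
    cupAt-kept {p} {p′} (cupAt e e′) s = cupAt (proj₁ f) (proj₂ f)
      where f = cup-kept {state p} {state p′} e e′ (StepAt-b⇒ s)

    cupAt-made : ∀ {p p′} → StepAt a p p′ → ¬ CupAt b p → CupAt b p′ → StepAt b p p′
    cupAt-made {p} {p′} s ¬c (cupAt e e′) =
      StepAt-b⇐ p p′ (cup-made {state p} {state p′} (StepAt-a⇒ s) e e′ λ (f , f′) → ¬c (cupAt f f′))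

    -- The flattening of t still has n letters and its cuts lie where those of `state p` lie, so t
    -- can be read as the state of a subset.
    realise-b : ∀ {p t} → state p ⇝′ t → ∃ λ q → state q ≡ t × StepAt b p q
    realise-b {p} {t} r = q , cong swapSites (flatten-injective (swapSites (state q)) (swapSites t) shape
        (trans (sym (rot-b q)) eq)) , s
      where
      realised = Step⇒StepAt b p (subst (λ w → Step w (flatten (swapSites t))) (sym (rot-b p)) (⇝⇒Step r))
      q = proj₁ realised
      eq : rot q b ≡ flatten (swapSites t)
      eq = proj₁ (proj₂ realised)
      s : StepAt b p q
      s = proj₂ (proj₂ realised)
      shape : SameShape (swapSites (state q)) (swapSites t)
      shape = trans (proj₂ (state-shape q p)) (proj₁ (⇝-shape r)) , trans (proj₁ (state-shape q p)) (proj₂ (⇝-shape r))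

    StepAt-commute : ∀ {p p′ p″} → StepAt a p p′ → StepAt b p′ p″ → ∃ λ q → StepAt b p q × StepAt a q p″
    StepAt-commute {p} {p′} {p″} s s′ = q , proj₂ (proj₂ realised) ,
        StepAt-a⇐ q p″ (subst (_⇝ state p″) (sym (proj₁ (proj₂ realised))) (proj₂ (proj₂ commuted)))
      where
      commuted = ⇝-commute (StepAt-a⇒ s) (StepAt-b⇒ s′)
      realised = realise-b {p} (proj₁ (proj₂ commuted))
      q = proj₁ realised

  -- Let d be the number of steps from i to j. The hypotheses exclude d = 0, d = 1 and d = n - 1, so
  -- α = d - 2 and β = n - d - 2 are natural numbers.
  separate : ∀ i j → ¬ i ≋ j → ¬ suc i ≋ j → ¬ i ≋ suc j → ∃₂ λ α β → 2 + (α + (2 + β)) ≡ n × 2 + α + i ≋ j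
  separate i j i≢j 1+i≢j i≢1+j = go (steps i j) (steps< i j) (steps-≋ i j)
    where
    go : ∀ d → d < n → d + i ≋ j → ∃₂ λ α β → 2 + (α + (2 + β)) ≡ n × 2 + α + i ≋ j
    go zero          _   eq = ⊥-elim (i≢j eq)
    go (suc zero)    _   eq = ⊥-elim (1+i≢j eq)
    go (suc (suc α)) d<n eq with ℕ.m≤n⇒∃[o]m+o≡n d<n
    ... | suc β , eq′ = α , β ,
      trans (solve 2 (λ α β → con 2 :+ (α :+ (con 2 :+ β)) := con 3 :+ α :+ (con 1 :+ β)) refl α β) eq′ , eq
    ... | zero , eq′ = ⊥-elim (i≢1+j (begin
      i % n                 ≡⟨ n+-≋ i ⟨
      (n + i) % n           ≡⟨ cong (λ c → (c + i) % n) (trans (sym eq′) (ℕ.+-identityʳ (3 + α))) ⟩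
      (3 + α + i) % n       ≡⟨ +-cong-≋ {1} refl eq ⟩
      (1 + j) % n           ∎))
      where open ≡-Reasoning

  CupAt-cong : ∀ {a b p} → a ≋ b → CupAt a p → CupAt b p
  CupAt-cong {p = p} eq (cupAt e e′) =
    cupAt (trans (χ-cong p (sym eq)) e) (trans (χ-cong p (+-cong-≋ {1} refl (sym eq))) e′)

  record DistantAt (a b : ℕ) : Set where
    field
      kept    : ∀ {p p′} → CupAt a p → StepAt b p p′ → CupAt a p′
      made    : ∀ {p p′} → StepAt a p p′ → ¬ CupAt b p → CupAt b p′ → StepAt b p p′
      commute : ∀ {p p′ p″} → StepAt a p p′ → StepAt b p′ p″ → ∃ λ q → StepAt b p q × StepAt a q p″

  distantAt-cong : ∀ {a b c} → b ≋ c → DistantAt a b → DistantAt a c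
  distantAt-cong {a} {b} {c} eq D = record
    { kept    = λ {p} {p′} x s → D.kept x (StepAt-cong {c} {b} {p} {p′} (sym eq) s)
    ; made    = λ {p} {p′} s ¬x x → StepAt-cong {b} {c} {p} {p′} eq
                  (D.made s (λ x′ → ¬x (CupAt-cong {b} {c} {p} eq x′)) (CupAt-cong {c} {b} {p′} (sym eq) x))
    ; commute = λ {p} {p′} {p″} s s′ → let q , r , r′ = D.commute s (StepAt-cong {c} {b} {p′} {p″} (sym eq) s′)
                                       in q , StepAt-cong {b} {c} {p} {q} eq r , r′
    }
    where module D = DistantAt D

  distantAt : ∀ a b → ¬ a ≋ b → ¬ suc a ≋ b → ¬ a ≋ suc b → DistantAt a b
  distantAt a b a≢b 1+a≢b a≢1+b with α , β , n-eq , eq ← separate a b a≢b 1+a≢b a≢1+b = distantAt-cong eq record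
    { kept    = TwoSites.cupAt-kept a α β n-eq
    ; made    = TwoSites.cupAt-made a α β n-eq
    ; commute = TwoSites.StepAt-commute a α β n-eq
    }

-- Tableaux and their bottom rows

lookup-∪ : ∀ {m} (p q : Subset m) x → lookup (p ∪ q) x ≡ lookup p x ∨ lookup q x
lookup-∪ p q x = Vec.lookup-zipWith _∨_ x p q

lookup-⁅⁆ : ∀ {m} (y x : Fin m) → lookup ⁅ y ⁆ x ≡ does (x Fin.≟ y)
lookup-⁅⁆ Fin.zero    Fin.zero    = refl
lookup-⁅⁆ Fin.zero    (Fin.suc x) = Vec.lookup-replicate x false
lookup-⁅⁆ (Fin.suc y) Fin.zero    = refl
lookup-⁅⁆ (Fin.suc y) (Fin.suc x) = lookup-⁅⁆ y x

∣⁅x⁆∪p∣ : ∀ {m} x (p : Subset m) → lookup p x ≡ false → ∣ ⁅ x ⁆ ∪ p ∣ ≡ suc ∣ p ∣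
∣⁅x⁆∪p∣ Fin.zero    (false ∷ p) refl = cong (λ q → suc ∣ q ∣) (Subset.∪-identityˡ p)
∣⁅x⁆∪p∣ (Fin.suc x) (false ∷ p) eq   = ∣⁅x⁆∪p∣ x p eq
∣⁅x⁆∪p∣ (Fin.suc x) (true ∷ p)  eq   = cong suc (∣⁅x⁆∪p∣ x p eq)

lookup-ext : ∀ {a} {A : Set a} {m} {u v : Vec A m} → (∀ x → lookup u x ≡ lookup v x) → u ≡ v
lookup-ext {u = u} {v} eq = trans (sym (Vec.tabulate∘lookup u)) (trans (Vec.tabulate-cong eq) (Vec.tabulate∘lookup v))

positive : ℕ → Bool
positive zero    = false
positive (suc _) = true

module _ {n : ℕ} where

  set : ∀ {k} → Vec (Fin n) k → Subset n
  set r = ⋃ (List.map ⁅_⁆ (Vec.toList r))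

  infix 4 _∈ᵇ_
  _∈ᵇ_ : ∀ {k} → Fin n → Vec (Fin n) k → Bool
  x ∈ᵇ r = lookup (set r) x

  occurrences : ∀ {k} → Vec (Fin n) k → Fin n → ℕ
  occurrences r x = count (x Fin.≟_) r

  ∈ᵇ-[] : ∀ x → (x ∈ᵇ []) ≡ false
  ∈ᵇ-[] x = Vec.lookup-replicate x false

  ∈ᵇ-∷ : ∀ {k} x y (r : Vec (Fin n) k) → (x ∈ᵇ y ∷ r) ≡ does (x Fin.≟ y) ∨ (x ∈ᵇ r)
  ∈ᵇ-∷ x y r = trans (lookup-∪ ⁅ y ⁆ (set r) x) (cong (_∨ (x ∈ᵇ r)) (lookup-⁅⁆ y x))

  ∈ᵇ-occurrences : ∀ {k} x (r : Vec (Fin n) k) → (x ∈ᵇ r) ≡ positive (occurrences r x)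
  ∈ᵇ-occurrences x []      = ∈ᵇ-[] x
  ∈ᵇ-occurrences x (y ∷ r) with does (x Fin.≟ y) | ∈ᵇ-∷ x y r
  ... | true  | eq = eq
  ... | false | eq = trans eq (∈ᵇ-occurrences x r)

  occurrences-++ : ∀ {k l} (r : Vec (Fin n) k) (s : Vec (Fin n) l) x →
                   occurrences (r Vec.++ s) x ≡ occurrences r x + occurrences s x
  occurrences-++ []      s x = refl
  occurrences-++ (y ∷ r) s x with does (x Fin.≟ y)
  ... | true  = cong suc (occurrences-++ r s x)
  ... | false = occurrences-++ r s x

  ∣set∣ : ∀ {k} (r : Vec (Fin n) k) → (∀ x → occurrences r x ≤ 1) → ∣ set r ∣ ≡ k
  ∣set∣ []      ≤1 = Subset.∣⊥∣≡0 n
  ∣set∣ (y ∷ r) ≤1 = trans (∣⁅x⁆∪p∣ y (set r) fresh) (cong suc (∣set∣ r λ x → ℕ.≤-trans (tail≤ x) (≤1 x)))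
    where
    tail≤ : ∀ x → occurrences r x ≤ occurrences (y ∷ r) x
    tail≤ x with does (x Fin.≟ y)
    ... | true  = ℕ.n≤1+n _
    ... | false = ℕ.≤-refl
    fresh : (y ∈ᵇ r) ≡ false
    fresh with occurrences r y | ∈ᵇ-occurrences y r | ≤1 y
    ... | zero  | eq | _  = eq
    ... | suc _ | _  | le rewrite dec-true (y Fin.≟ y) refl with le
    ...   | s≤s ()

  Linked-∈ᵇ : ∀ {k x y} {r : Vec (Fin n) k} → Linked Fin._<_ (y ∷ r) → (x ∈ᵇ r) ≡ true → y Fin.< x
  Linked-∈ᵇ {x = x} [-] eq with () ← trans (sym (∈ᵇ-[] x)) eq
  Linked-∈ᵇ {x = x} {r = z ∷ r} (y<z ∷ lk) eq with x Fin.≟ z | ∈ᵇ-∷ x z r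
  ... | yes refl | _   = y<z
  ... | no _     | eq′ = Fin.<-trans y<z (Linked-∈ᵇ lk (trans (sym eq′) eq))

  ∈ᵇ-head : ∀ {k} y (r : Vec (Fin n) k) → (y ∈ᵇ y ∷ r) ≡ true
  ∈ᵇ-head y r = trans (∈ᵇ-∷ y y r) (cong (_∨ (y ∈ᵇ r)) (dec-true (y Fin.≟ y) refl))

  Linked-tail : ∀ {k y} {r : Vec (Fin n) k} → Linked Fin._<_ (y ∷ r) → Linked Fin._<_ r
  Linked-tail [-]      = []
  Linked-tail (_ ∷ lk) = lk

  -- Different heads would each lie in the other's tail and thus each be smaller than the other.
  Linked-unique : ∀ {k} {r s : Vec (Fin n) k} → Linked Fin._<_ r → Linked Fin._<_ s →
                  (∀ x → (x ∈ᵇ r) ≡ (x ∈ᵇ s)) → r ≡ s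
  Linked-unique {r = []}    {[]}    _  _  _  = refl
  Linked-unique {r = y ∷ r} {z ∷ s} lr ls eq with y Fin.≟ z
  ... | no y≢z = ⊥-elim (Fin.<-asym (Linked-∈ᵇ lr z∈r) (Linked-∈ᵇ ls y∈s))
    where
    y∈s : (y ∈ᵇ s) ≡ true
    y∈s = trans (sym (trans (∈ᵇ-∷ y z s) (cong (_∨ (y ∈ᵇ s)) (dec-false (y Fin.≟ z) y≢z))))
                (trans (sym (eq y)) (∈ᵇ-head y r))
    z∈r : (z ∈ᵇ r) ≡ true
    z∈r = trans (sym (trans (∈ᵇ-∷ z y r) (cong (_∨ (z ∈ᵇ r)) (dec-false (z Fin.≟ y) λ z≡y → y≢z (sym z≡y)))))
                (trans (eq z) (∈ᵇ-head z s))
  ... | yes refl = cong (y ∷_) (Linked-unique (Linked-tail lr) (Linked-tail ls) eq′)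
    where
    fresh : ∀ {r : Vec (Fin n) _} → Linked Fin._<_ (y ∷ r) → (y ∈ᵇ r) ≡ false
    fresh {r} lk with y ∈ᵇ r in e
    ... | false = refl
    ... | true  = ⊥-elim (Fin.<-irrefl refl (Linked-∈ᵇ lk e))
    eq′ : ∀ x → (x ∈ᵇ r) ≡ (x ∈ᵇ s)
    eq′ x with x Fin.≟ y | ∈ᵇ-∷ x y r | ∈ᵇ-∷ x y s
    ... | yes refl | _ | _  = trans (fresh lr) (sym (fresh ls))
    ... | no _     | e | e′ = trans (sym e) (trans (eq x) e′)

  -- Membership in an image is membership of the preimage, and `Perm.transpose j i` is the inverse
  -- of `Perm.transpose i j`; hence the reversed indices.
  ∈ᵇ-transpose : ∀ {k} i j x (r : Vec (Fin n) k) →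
                 (x ∈ᵇ Vec.map (Perm.transpose i j) r) ≡ (Perm.transpose j i x ∈ᵇ r)
  ∈ᵇ-transpose i j x []      = trans (∈ᵇ-[] x) (sym (∈ᵇ-[] (Perm.transpose j i x)))
  ∈ᵇ-transpose i j x (y ∷ r) =
    trans (∈ᵇ-∷ x (Perm.transpose i j y) (Vec.map (Perm.transpose i j) r))
    (trans (cong₂ _∨_ (same (x Fin.≟ Perm.transpose i j y) (Perm.transpose j i x Fin.≟ y)) (∈ᵇ-transpose i j x r))
           (sym (∈ᵇ-∷ (Perm.transpose j i x) y r)))
    where
    same : (d : Dec (x ≡ Perm.transpose i j y)) (e : Dec (Perm.transpose j i x ≡ y)) → does d ≡ does e
    same (yes p) (yes q) = refl
    same (no p)  (no q)  = refl
    same (yes p) (no q)  = ⊥-elim (q (trans (cong (Perm.transpose j i) p) (Perm.transpose-inverse j i)))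
    same (no p)  (yes q) = ⊥-elim (p (trans (sym (Perm.transpose-inverse i j)) (cong (Perm.transpose i j) q)))

  transpose-first : ∀ (i j : Fin n) → Perm.transpose i j i ≡ j
  transpose-first i j rewrite dec-true (i Fin.≟ i) refl = refl

  transpose-second : ∀ {i j : Fin n} → i ≢ j → Perm.transpose i j j ≡ i
  transpose-second {i} {j} i≢j
    rewrite dec-false (j Fin.≟ i) (λ e → i≢j (sym e)) | dec-true (j Fin.≟ j) refl = refl

  transpose-other : ∀ {i j x : Fin n} → x ≢ i → x ≢ j → Perm.transpose i j x ≡ x
  transpose-other {i} {j} {x} x≢i x≢j
    rewrite dec-false (x Fin.≟ i) x≢i | dec-false (x Fin.≟ j) x≢j = refl

elems : ∀ {m} (p : Subset m) → Vec (Fin m) ∣ p ∣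
elems []          = []
elems (true ∷ p)  = Fin.zero ∷ Vec.map Fin.suc (elems p)
elems (false ∷ p) = Vec.map Fin.suc (elems p)

Linked-map-suc : ∀ {m k} {r : Vec (Fin m) k} → Linked Fin._<_ r → Linked Fin._<_ (Vec.map Fin.suc r)
Linked-map-suc lk = Linked.map⁺ (Linked.map s≤s lk)

elems-Linked : ∀ {m} (p : Subset m) → Linked Fin._<_ (elems p)
elems-Linked []          = []
elems-Linked (false ∷ p) = Linked-map-suc (elems-Linked p)
elems-Linked (true ∷ p)  = cons (Linked-map-suc (elems-Linked p))
  where
  cons : ∀ {m k} {r : Vec (Fin m) k} → Linked Fin._<_ (Vec.map Fin.suc r) → Linked Fin._<_ (Fin.zero ∷ Vec.map Fin.suc r)
  cons {r = []}    lk = [-]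
  cons {r = x ∷ r} lk = s≤s z≤n ∷ lk

occurrences-map-suc-zero : ∀ {m k} (r : Vec (Fin m) k) → occurrences (Vec.map Fin.suc r) Fin.zero ≡ 0
occurrences-map-suc-zero []      = refl
occurrences-map-suc-zero (x ∷ r) = occurrences-map-suc-zero r

occurrences-map-suc-suc : ∀ {m k} (r : Vec (Fin m) k) x → occurrences (Vec.map Fin.suc r) (Fin.suc x) ≡ occurrences r x
occurrences-map-suc-suc []      x = refl
occurrences-map-suc-suc (y ∷ r) x with does (x Fin.≟ y)
... | true  = cong suc (occurrences-map-suc-suc r x)
... | false = occurrences-map-suc-suc r x

occurrences-elems : ∀ {m} (p : Subset m) x → occurrences (elems p) x ≡ (if lookup p x then 1 else 0)
occurrences-elems (true ∷ p)  Fin.zero    = cong suc (occurrences-map-suc-zero (elems p))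
occurrences-elems (false ∷ p) Fin.zero    = occurrences-map-suc-zero (elems p)
occurrences-elems (true ∷ p)  (Fin.suc x) = trans (occurrences-map-suc-suc (elems p) x) (occurrences-elems p x)
occurrences-elems (false ∷ p) (Fin.suc x) = trans (occurrences-map-suc-suc (elems p) x) (occurrences-elems p x)

set-elems : ∀ {m} (p : Subset m) → set (elems p) ≡ p
set-elems p = lookup-ext λ x →
  trans (∈ᵇ-occurrences x (elems p)) (trans (cong positive (occurrences-elems p x)) (indicator (lookup p x)))
  where
  indicator : ∀ b → positive (if b then 1 else 0) ≡ b
  indicator true  = refl
  indicator false = refl

tableau : ∀ {n k l} .{{_ : NonZero n}} (p : Subset n) → ∣ ∁ p ∣ ≡ k → ∣ p ∣ ≡ l →
          ∃ λ t → TwoRow._² n k l t ≡ p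
tableau {n} p refl refl =
  TwoRow.mkRSYT (elems (∁ p)) (elems p) (elems-Linked (∁ p) , elems-Linked p , once) , set-elems p
  where
  once : ∀ x → occurrences (elems (∁ p) Vec.++ elems p) x ≡ 1
  once x = trans (occurrences-++ (elems (∁ p)) (elems p) x)
    (trans (cong₂ _+_ (occurrences-elems (∁ p) x) (occurrences-elems p x)) sum)
    where
    sum : (if lookup (∁ p) x then 1 else 0) + (if lookup p x then 1 else 0) ≡ 1
    sum rewrite Vec.lookup-map x not p with lookup p x
    ... | true  = refl
    ... | false = refl

module Tableaux (n λ₁ λ₂ : ℕ) .{{_ : NonZero n}} where
  open TwoRow n λ₁ λ₂
  open RSYT

  valid : ∀ t → IsRSYT (row₁ t) (row₂ t)
  valid (mkRSYT r₁ r₂ ok) = recompute (isRSYT? r₁ r₂) ok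

  occurrences-rows : ∀ t x → occurrences (row₁ t) x + occurrences (row₂ t) x ≡ 1
  occurrences-rows t x = trans (sym (occurrences-++ (row₁ t) (row₂ t) x)) (proj₂ (proj₂ (valid t)) x)

  lookup-¹ : ∀ t x → lookup (t ¹) x ≡ not (lookup (t ²) x)
  lookup-¹ t x = trans (∈ᵇ-occurrences x (row₁ t))
    (trans (complementary (occurrences (row₁ t) x) _ (occurrences-rows t x))
           (cong not (sym (∈ᵇ-occurrences x (row₂ t)))))
    where
    complementary : ∀ a b → a + b ≡ 1 → positive a ≡ not (positive b)
    complementary zero    (suc zero) _ = refl
    complementary (suc zero) zero    _ = refl
    complementary (suc zero) (suc b) ()
    complementary (suc (suc a)) b ()

  ∣²∣ : ∀ t → ∣ t ² ∣ ≡ λ₂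
  ∣²∣ t = ∣set∣ (row₂ t) λ x → ℕ.m+n≤o⇒n≤o (occurrences (row₁ t) x) (ℕ.≤-reflexive (occurrences-rows t x))

  ²-injective : ∀ {s t} → s ² ≡ t ² → s ≡ t
  ²-injective {s@(mkRSYT _ _ _)} {t@(mkRSYT _ _ _)} eq = same
    (Linked-unique (proj₁ (valid s)) (proj₁ (valid t)) λ x →
      trans (lookup-¹ s x) (trans (cong (λ p → not (lookup p x)) eq) (sym (lookup-¹ t x))))
    (Linked-unique (proj₁ (proj₂ (valid s))) (proj₁ (proj₂ (valid t))) λ x → cong (λ p → lookup p x) eq)
    where
    same : ∀ {s t} → row₁ s ≡ row₁ t → row₂ s ≡ row₂ t → s ≡ t
    same {mkRSYT _ _ _} {mkRSYT _ _ _} refl refl = refl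

  -- Only the rows have to increase. So the elements of p and those of its complement, listed in
  -- order, always form a tableau.
  ²-surjective : ∀ p → λ₁ + λ₂ ≡ n → ∣ p ∣ ≡ λ₂ → ∃ λ t → t ² ≡ p
  ²-surjective p n-eq ∣p∣ = tableau p (trans (Subset.∣∁p∣≡n∸∣p∣ p) (trans (cong₂ _∸_ (sym n-eq) ∣p∣) (ℕ.m+n∸n≡m λ₁ λ₂))) ∣p∣

  Interchanged⇒ : ∀ {i j s t} → Interchanged i j s t → ∀ x → lookup (t ²) x ≡ lookup (s ²) (Perm.transpose j i x)
  Interchanged⇒ {i} {j} {s} {t} (_ , eq) x = trans (cong (λ p → lookup p x) eq) (∈ᵇ-transpose i j x (row₂ s))

  Interchanged⇐ : ∀ {i j s t} → (∀ x → lookup (t ²) x ≡ lookup (s ²) (Perm.transpose j i x)) → Interchanged i j s t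
  Interchanged⇐ {i} {j} {s} {t} eq =
    lookup-ext (λ x → trans (lookup-¹ t x) (trans (cong not (eq x)) (trans (sym (lookup-¹ s _)) (sym (∈ᵇ-transpose i j x (row₁ s)))))) ,
    lookup-ext (λ x → trans (eq x) (sym (∈ᵇ-transpose i j x (row₂ s))))

-- Moves as Temperley–Lieb steps

#-seg-trim : ∀ f g a m ℓ → ℓ ≤ m → (∀ y → y < ℓ → f (y + a) ≡ g (y + a)) →
             (∀ y → ℓ ≤ y → y < m → f (y + a) ≡ ○) → # (seg f a m) ≡ # (seg g a ℓ)
#-seg-trim f g a zero    zero    _ _ _ = refl
#-seg-trim f g a (suc m) zero    _ eq out rewrite out 0 z≤n (s≤s z≤n) =
  #-seg-trim f g (suc a) m zero z≤n (λ _ ()) λ y _ y<m → trans (cong f (ℕ.+-suc y a)) (out (suc y) z≤n (s≤s y<m))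
#-seg-trim f g a (suc m) (suc ℓ) (s≤s ℓ≤m) eq out rewrite eq 0 (s≤s z≤n) = #-∷ (g a)
  (#-seg-trim f g (suc a) m ℓ ℓ≤m
    (λ y y<ℓ → trans (cong f (ℕ.+-suc y a)) (trans (eq (suc y) (s≤s y<ℓ)) (cong g (sym (ℕ.+-suc y a)))))
    (λ y ℓ≤y y<m → trans (cong f (ℕ.+-suc y a)) (out (suc y) (s≤s ℓ≤y) (s≤s y<m))))
  where
  #-∷ : ∀ b {v w} → # v ≡ # w → # (b ∷ v) ≡ # (b ∷ w)
  #-∷ ○ e = e
  #-∷ ● e = cong suc e

module Positions (n : ℕ) .{{_ : NonZero n}} where
  open Cyclic n
  open CyclicWords n
  open import Data.Integer.Base using (+_; -[1+_])

  private
    linear : ∀ {z c m : ℤ} {r q n : ℤ} → z ℤ.+ c ℤ.* n ≡ m → z ≡ r ℤ.+ q ℤ.* n → m ≡ r ℤ.+ (q ℤ.+ c) ℤ.* n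
    linear {c = c} {r = r} {q} {n} refl refl = lemma r q n c
      where
      lemma : ∀ r q n c → r ℤ.+ q ℤ.* n ℤ.+ c ℤ.* n ≡ r ℤ.+ (q ℤ.+ c) ℤ.* n
      lemma = solve-∀

    remainder : ∀ {m r} q → r < n → + m ≡ + r ℤ.+ q ℤ.* + n → r ≡ m % n
    remainder {m} {r} (+ d) r<n eq = sym (trans (cong (_% n) (ℤ.+-injective m≡))
      (trans ([m+kn]%n≡m%n r d n) (m<n⇒m%n≡m r<n)))
      where
      m≡ : + m ≡ + (r + d * n)
      m≡ = trans eq (cong (ℤ._+_ (+ r)) (sym (ℤ.pos-* d n)))
    -- A negative quotient would make r equal to m plus a positive multiple of n.
    remainder {m} {r} (-[1+ d ]) r<n eq = ⊥-elim (ℕ.<-irrefl refl (ℕ.<-≤-trans r<n (ℕ.≤-trans (ℕ.m≤m+n n (d * n))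
      (ℕ.≤-trans (ℕ.m≤n+m (suc d * n) m) (ℕ.≤-reflexive (ℤ.+-injective m+≡r))))))
      where
      lemma : ∀ r s n → r ℤ.+ ℤ.- s ℤ.* n ℤ.+ s ℤ.* n ≡ r
      lemma = solve-∀
      m+≡r : + (m + suc d * n) ≡ + r
      m+≡r = trans (cong₂ ℤ._+_ eq (ℤ.pos-* (suc d) n)) (lemma (+ r) (+ suc d) (+ n))

  -- The passage from the integers in `residue`, `gap` and the cyclic intervals to natural
  -- positions. The later calls choose c so as to cancel the multiples of n that `value-⟦⟧`
  -- subtracts.
  %ℕ-unique : ∀ z c m → z ℤ.+ c ℤ.* + n ≡ + m → z ℤ.%ℕ n ≡ m % n
  %ℕ-unique z c m eq = remainder (z ℤ./ℕ n ℤ.+ c) (ℤ.n%ℕd<d z n)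
    (linear {z} {c} {r = + (z ℤ.%ℕ n)} {z ℤ./ℕ n} eq (ℤ.a≡a%ℕn+[a/ℕn]*n z n))

  residue-unique : ∀ z c m → z ℤ.- 1ℤ ℤ.+ c ℤ.* + n ≡ + m → residue z ≡ ⟦ m ⟧
  residue-unique z c m eq = Fin.toℕ-injective
    (trans (Fin.toℕ-fromℕ< (ℤ.n%ℕd<d (z ℤ.- 1ℤ) n)) (trans (%ℕ-unique (z ℤ.- 1ℤ) c m eq) (sym (toℕ-⟦⟧ m))))

  private
    pos-divMod : ∀ k → + k ≡ + (k % n) ℤ.+ + (k / n) ℤ.* + n
    pos-divMod k = trans (cong +_ (m≡m%n+[m/n]*n k n)) (cong (ℤ._+_ (+ (k % n))) (ℤ.pos-* (k / n) n))

    value-⟦⟧ : ∀ k → value ⟦ k ⟧ ≡ 1ℤ ℤ.+ + k ℤ.- + (k / n) ℤ.* + n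
    value-⟦⟧ k rewrite toℕ-⟦⟧ k = trans (lemma (+ (k % n)) (+ (k / n)) (+ n))
      (cong (λ c → 1ℤ ℤ.+ c ℤ.- + (k / n) ℤ.* + n) (sym (pos-divMod k)))
      where
      lemma : ∀ r q n → 1ℤ ℤ.+ r ≡ 1ℤ ℤ.+ (r ℤ.+ q ℤ.* n) ℤ.- q ℤ.* n
      lemma = solve-∀

  ⊕-⟦⟧ : ∀ k a → ⟦ a ⟧ ⊕ k ≡ ⟦ k + a ⟧
  ⊕-⟦⟧ k a = residue-unique (value ⟦ a ⟧ ℤ.+ + k) (+ (a / n)) (k + a)
    (trans (cong (λ v → v ℤ.+ + k ℤ.- 1ℤ ℤ.+ + (a / n) ℤ.* + n) (value-⟦⟧ a)) (lemma (+ k) (+ a) (+ (a / n) ℤ.* + n)))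
    where
    lemma : ∀ k a c → 1ℤ ℤ.+ a ℤ.- c ℤ.+ k ℤ.- 1ℤ ℤ.+ c ≡ k ℤ.+ a
    lemma = solve-∀

  ⊖-⟦⟧ : ∀ k a → ⟦ k + a ⟧ ⊖ k ≡ ⟦ a ⟧
  ⊖-⟦⟧ k a = residue-unique (value ⟦ k + a ⟧ ℤ.- + k) (+ ((k + a) / n)) a
    (trans (cong (λ v → v ℤ.- + k ℤ.- 1ℤ ℤ.+ + ((k + a) / n) ℤ.* + n) (value-⟦⟧ (k + a))) (lemma (+ k) (+ a) (+ ((k + a) / n) ℤ.* + n)))
    where
    lemma : ∀ k a c → 1ℤ ℤ.+ (k ℤ.+ a) ℤ.- c ℤ.- k ℤ.- 1ℤ ℤ.+ c ≡ a
    lemma = solve-∀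

  gap-⟦⟧ : ∀ g a → g < n → gap ⟦ a ⟧ ⟦ suc g + a ⟧ ≡ suc g
  gap-⟦⟧ g a g<n = cong suc (trans (cong toℕ (residue-unique (value ⟦ suc g + a ⟧ ℤ.- value ⟦ a ⟧) (+ ((suc g + a) / n) ℤ.- + (a / n)) g
    (trans (cong₂ (λ v u → v ℤ.- u ℤ.- 1ℤ ℤ.+ (+ ((suc g + a) / n) ℤ.- + (a / n)) ℤ.* + n) (value-⟦⟧ (suc g + a)) (value-⟦⟧ a))
           (lemma (+ g) (+ a) (+ ((suc g + a) / n)) (+ (a / n)) (+ n)))))
    (trans (toℕ-⟦⟧ g) (m<n⇒m%n≡m g<n)))
    where
    lemma : ∀ g a c d n → (1ℤ ℤ.+ (1ℤ ℤ.+ g ℤ.+ a) ℤ.- c ℤ.* n) ℤ.- (1ℤ ℤ.+ a ℤ.- d ℤ.* n) ℤ.- 1ℤ ℤ.+ (c ℤ.- d) ℤ.* n ≡ g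
    lemma = solve-∀

  difference-⟦⟧ : ∀ y a → y < n → (value ⟦ y + a ⟧ ℤ.- value ⟦ a ⟧) ℤ.%ℕ n ≡ y
  difference-⟦⟧ y a y<n = trans (%ℕ-unique (value ⟦ y + a ⟧ ℤ.- value ⟦ a ⟧) (+ ((y + a) / n) ℤ.- + (a / n)) y
    (trans (cong₂ (λ v u → v ℤ.- u ℤ.+ (+ ((y + a) / n) ℤ.- + (a / n)) ℤ.* + n) (value-⟦⟧ (y + a)) (value-⟦⟧ a))
           (lemma (+ y) (+ a) (+ ((y + a) / n)) (+ (a / n)) (+ n)))) (m<n⇒m%n≡m y<n)
    where
    lemma : ∀ y a c d n → (1ℤ ℤ.+ (y ℤ.+ a) ℤ.- c ℤ.* n) ℤ.- (1ℤ ℤ.+ a ℤ.- d ℤ.* n) ℤ.+ (c ℤ.- d) ℤ.* n ≡ y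
    lemma = solve-∀

  distinct : ∀ a {y z} → y < n → z < n → y ≢ z → ¬ (y + a ≋ z + a)
  distinct a y<n z<n y≢z eq = y≢z (<-≋ y<n z<n (+-cancelʳ-≋ a eq))

  -- Here ℓ is the number of entries of the interval. The value 0 is the case a = c + 1 declared
  -- empty, and ℓ < n keeps it apart from a full turn, which has the same endpoints.
  ∣∩⟨⟩∣ : ∀ p a c ℓ → suc c ≡ ℓ + a → ℓ < n → ∣ p ∩ ⟨ ⟦ a ⟧ , ⟦ c ⟧ ⟩ ∣ ≡ # (seg (χ p) a ℓ)
  ∣∩⟨⟩∣ p a c zero    refl ℓ<n
    rewrite dec-true (⟦ suc c ⟧ Fin.≟ ⟦ c ⟧ ⊕ 1) (sym (⊕-⟦⟧ 1 c))
    = trans (cong ∣_∣ (Subset.∩-zeroʳ p)) (Subset.∣⊥∣≡0 n)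
  ∣∩⟨⟩∣ p a c (suc m) refl ℓ<n
    rewrite dec-false (⟦ a ⟧ Fin.≟ ⟦ m + a ⟧ ⊕ 1) (λ e → distinct a (ℕ.≤-<-trans z≤n ℓ<n) ℓ<n (λ ())
              (⟦⟧-injective {0 + a} (trans e (⊕-⟦⟧ 1 (m + a)))))
    = trans (sym (#-rot (p ∩ I) a)) (#-seg-trim (χ (p ∩ I)) (χ p) a n (suc m) (ℕ.<⇒≤ ℓ<n) inside outside)
    where
    inInterval : Fin n → Bool
    inInterval x = does ((value x ℤ.- value ⟦ a ⟧) ℤ.%ℕ n ℕ.≤? (value ⟦ m + a ⟧ ℤ.- value ⟦ a ⟧) ℤ.%ℕ n)
    I = tabulate inInterval
    χ-∩ : ∀ y → y < n → χ (p ∩ I) (y + a) ≡ χ p (y + a) ∧ does (y ℕ.≤? m)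
    χ-∩ y y<n = trans (Vec.lookup-zipWith _∧_ ⟦ y + a ⟧ p I) (cong (χ p (y + a) ∧_)
      (trans (Vec.lookup∘tabulate inInterval ⟦ y + a ⟧)
        (cong₂ (λ u v → does (u ℕ.≤? v)) (difference-⟦⟧ y a y<n) (difference-⟦⟧ m a (ℕ.<-trans (ℕ.n<1+n m) ℓ<n)))))
    inside : ∀ y → y < suc m → χ (p ∩ I) (y + a) ≡ χ p (y + a)
    inside y y≤m = trans (χ-∩ y (ℕ.<-trans y≤m ℓ<n))
      (trans (cong (χ p (y + a) ∧_) (dec-true (y ℕ.≤? m) (ℕ.≤-pred y≤m))) (Bool.∧-identityʳ _))
    outside : ∀ y → suc m ≤ y → y < n → χ (p ∩ I) (y + a) ≡ ○
    outside y m<y y<n = trans (χ-∩ y y<n)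
      (trans (cong (χ p (y + a) ∧_) (dec-false (y ℕ.≤? m) (ℕ.<⇒≱ m<y))) (Bool.∧-zeroʳ _))

-- Balanced words in terms of counts

parity : ∀ m → (∃ λ k → m ≡ k + k) ⊎ (∃ λ k → m ≡ suc (k + k))
parity zero = inj₁ (0 , refl)
parity (suc m) with parity m
... | inj₁ (k , refl) = inj₂ (k , refl)
... | inj₂ (k , refl) = inj₁ (suc k , cong suc (sym (ℕ.+-suc k k)))

half-≤ : ∀ {k x} → k + k ≤ suc (x + x) → k ≤ x
half-≤ {k} {x} le with k ℕ.≤? x
... | yes k≤x = k≤x
... | no k≰x  = ⊥-elim (ℕ.<-irrefl refl (ℕ.≤-trans (ℕ.≤-reflexive (cong suc (sym (ℕ.+-suc x x))))
                  (ℕ.≤-trans (ℕ.+-mono-≤ (ℕ.≰⇒> k≰x) (ℕ.≰⇒> k≰x)) le)))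

half-≡ : ∀ {k x} → k + k ≡ x + x → k ≡ x
half-≡ eq = ℕ.≤-antisym (half-≤ (ℕ.m≤n⇒m≤1+n (ℕ.≤-reflexive eq)))
                        (half-≤ (ℕ.m≤n⇒m≤1+n (ℕ.≤-reflexive (sym eq))))

-- Each closer raises the number of pending closers by one and each opener lowers it by one; the
-- equation states the resulting balance without subtraction.
GPass-# : ∀ {j w k} → GPass j w k → k + length w ≡ j + (# w + # w)
GPass-# nil = refl
GPass-# (open′ {m = m} p) = trans (ℕ.+-suc m _) (GPass-# p)
GPass-# {j} (close {w = w} {m} p) = trans (cong suc (trans (ℕ.+-suc m _) (cong suc (GPass-# p))))
  (solve 2 (λ j x → con 2 :+ (j :+ (x :+ x)) := j :+ (con 1 :+ x :+ (con 1 :+ x))) refl j (# w))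

#-∷ʳ : ∀ f a m → # (seg f a (suc m)) ≡ # (seg f a m) + # [ f (m + a) ]
#-∷ʳ f a m = trans (cong (λ k → # (seg f a k)) (ℕ.+-comm 1 m))
  (trans (cong # (seg-++ f a m 1)) (#-++ (seg f a m) _))

#₂ : Word → ℕ
#₂ w = # w + # w

-- An opener met with no closer pending would begin a suffix with more openers than closers.
GPass-run : ∀ f a ℓ → (∀ r m → r + m ≡ ℓ → m ≤ #₂ (seg f (r + a) m)) → ∃ λ k → GPass 0 (seg f a ℓ) k
GPass-run f a zero    _ = 0 , nil
GPass-run f a (suc ℓ) suffixes
  with GPass-run f (suc a) ℓ (λ r m eq → subst (λ c → m ≤ #₂ (seg f c m)) (sym (ℕ.+-suc r a)) (suffixes (suc r) m (cong suc eq)))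
     | suffixes 0 (suc ℓ) refl
... | k , p | le with f a
...   | ● = suc k , close p
...   | ○ with k | p | trans (cong (k +_) (sym (length-seg f (suc a) ℓ))) (GPass-# p)
...     | suc k′ | p′ | _  = k′ , open′ p′
...     | zero   | _  | eq = ⊥-elim (ℕ.<-irrefl eq le)

balanced⇐ : ∀ f a ℓ → (∀ r m → r + m ≡ ℓ → m ≤ #₂ (seg f (r + a) m)) → #₂ (seg f a ℓ) ≡ ℓ → GPass 0 (seg f a ℓ) 0
balanced⇐ f a ℓ suffixes total with k , p ← GPass-run f a ℓ suffixes =
  subst (GPass 0 (seg f a ℓ)) (ℕ.+-cancelʳ-≡ ℓ k 0 (trans (cong (k +_) (sym (length-seg f a ℓ))) (trans (GPass-# p) total))) p

balanced⇒total : ∀ f a ℓ → GPass 0 (seg f a ℓ) 0 → #₂ (seg f a ℓ) ≡ ℓ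
balanced⇒total f a ℓ p = trans (sym (GPass-# p)) (length-seg f a ℓ)

balanced⇒suffixes : ∀ f a ℓ → GPass 0 (seg f a ℓ) 0 → ∀ r m → r + m ≡ ℓ → m ≤ #₂ (seg f (r + a) m)
balanced⇒suffixes f a ℓ p r m refl
  with k , q , _ ← GPass-++⁻ (seg f a r) (subst (λ w → GPass 0 w 0) (seg-++ f a r m) p)
  = ℕ.≤-trans (ℕ.m≤n+m m k) (ℕ.≤-reflexive (trans (cong (k +_) (sym (length-seg f (r + a) m))) (GPass-# q)))

-- Conditions (b), (d) and (e) on the 2 + 2μ letters strictly between the two
-- interchanged entries of a move of the second kind.
record Inner (f : ℕ → Bool) (a μ : ℕ) : Set where
  field
    first    : f a ≡ ○
    last     : f (suc (μ + μ) + a) ≡ ●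
    total    : # (seg f (suc a) (μ + μ)) ≡ μ
    suffixes : ∀ r k → r + (k + k) ≡ μ + μ → k ≤ # (seg f (suc r + a) (k + k))

private
  arith₁ : ∀ x → x + 1 + (x + 1) ≡ 2 + (x + x)
  arith₁ = solve 1 (λ x → x :+ con 1 :+ (x :+ con 1) := con 2 :+ (x :+ x)) refl

#₂-∷ʳ● : ∀ f a m → f (m + a) ≡ ● → #₂ (seg f a (suc m)) ≡ 2 + #₂ (seg f a m)
#₂-∷ʳ● f a m eq = trans (cong (λ x → x + x) (trans (#-∷ʳ f a m) (cong (λ b → # (seg f a m) + # [ b ]) eq)))
  (arith₁ (# (seg f a m)))

#-tail : ∀ b w → # w ≤ # (b ∷ w)
#-tail ○ w = ℕ.≤-refl
#-tail ● w = ℕ.n≤1+n (# w)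

suffix-end : ∀ (f : ℕ → Bool) {r m N a} → r + m ≡ N → f (suc N + a) ≡ ● → f (m + (suc r + a)) ≡ ●
suffix-end f {r} {m} {N} {a} refl last = trans (cong f
  (solve 3 (λ r m a → m :+ (con 1 :+ r :+ a) := con 1 :+ (r :+ m) :+ a) refl r m a)) last

-- The field `suffixes` bounds only even lengths and stops before the last letter. That letter is a
-- closer, and the slack it gives covers the remaining lengths, after dropping a first letter where
-- the parity requires it.
inner⇒balanced : ∀ f a μ → Inner f a μ → GPass 0 (seg f a (2 + (μ + μ))) 0
inner⇒balanced f a μ I = balanced⇐ f a (2 + (μ + μ)) suf tot
  where
  open Inner I
  tot : #₂ (seg f a (2 + (μ + μ))) ≡ 2 + (μ + μ)
  tot = begin
    #₂ (f a ∷ seg f (suc a) (suc (μ + μ)))   ≡⟨ cong (λ b → #₂ (b ∷ seg f (suc a) (suc (μ + μ)))) first ⟩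
    #₂ (seg f (suc a) (suc (μ + μ)))         ≡⟨ #₂-∷ʳ● f (suc a) (μ + μ) (trans (cong f (ℕ.+-suc (μ + μ) a)) last) ⟩
    2 + #₂ (seg f (suc a) (μ + μ))           ≡⟨ cong (λ x → 2 + (x + x)) total ⟩
    2 + (μ + μ)                              ∎
    where open ≡-Reasoning
  suf : ∀ r m → r + m ≡ 2 + (μ + μ) → m ≤ #₂ (seg f (r + a) m)
  suf r       zero    _    = z≤n
  suf zero    (suc m) refl = ℕ.≤-reflexive (sym tot)
  suf (suc r) (suc m) eq   = ℕ.≤-trans (bound m r+m (parity m))
    (ℕ.≤-reflexive (sym (#₂-∷ʳ● f (suc r + a) m (suffix-end f r+m last))))
    where
    r+m : r + m ≡ μ + μ
    r+m = ℕ.suc-injective (trans (sym (ℕ.+-suc r m)) (ℕ.suc-injective eq))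
    bound : ∀ m → r + m ≡ μ + μ → (∃ λ k → m ≡ k + k) ⊎ (∃ λ k → m ≡ suc (k + k)) → suc m ≤ 2 + #₂ (seg f (suc r + a) m)
    bound _ e (inj₁ (k , refl)) = ℕ.m≤n⇒m≤1+n (s≤s (ℕ.+-mono-≤ (suffixes r k e) (suffixes r k e)))
    bound _ e (inj₂ (k , refl)) = s≤s (s≤s (ℕ.+-mono-≤ k≤ k≤))
      where
      k≤ : k ≤ # (seg f (suc r + a) (suc (k + k)))
      k≤ = ℕ.≤-trans (suffixes (suc r) k (trans (sym (ℕ.+-suc r (k + k))) e)) (#-tail (f (suc r + a)) _)

-- The suffix of length one forces the last letter, and the total count against the longest proper
-- suffix forces the first. For a suffix shortened by its last letter, with x closers, balance gives
-- 2k ≤ 1 + 2x, which parity sharpens to k ≤ x.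
balanced⇒inner : ∀ f a μ → GPass 0 (seg f a (2 + (μ + μ))) 0 → Inner f a μ
balanced⇒inner f a μ p = record { first = first ; last = last ; total = total ; suffixes = suffixes }
  where
  N = 2 + (μ + μ)
  suf = balanced⇒suffixes f a N p
  tot = balanced⇒total f a N p
  last : f (suc (μ + μ) + a) ≡ ●
  last = end (f (suc (μ + μ) + a)) (suf (suc (μ + μ)) 1 (ℕ.+-comm (suc (μ + μ)) 1))
    where
    end : ∀ b → 1 ≤ #₂ [ b ] → b ≡ ●
    end ● _ = refl
  tail : # (seg f (suc a) (suc (μ + μ))) + # (seg f (suc a) (suc (μ + μ))) ≡ 2 + #₂ (seg f (suc a) (μ + μ))
  tail = #₂-∷ʳ● f (suc a) (μ + μ) (trans (cong f (ℕ.+-suc (μ + μ) a)) last)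
  first : f a ≡ ○
  first = start (f a) (seg f (suc a) (suc (μ + μ))) (suf 1 (suc (μ + μ)) refl) tot
    where
    start : ∀ b w → suc (μ + μ) ≤ #₂ w → #₂ (b ∷ w) ≡ 2 + (μ + μ) → b ≡ ○
    start ○ w _  _  = refl
    start ● w le eq = ⊥-elim (ℕ.<-irrefl (sym (ℕ.suc-injective (trans (sym (ℕ.+-suc (# w) (# w))) (ℕ.suc-injective eq)))) le)
  total : # (seg f (suc a) (μ + μ)) ≡ μ
  total = half-≡ (ℕ.suc-injective (ℕ.suc-injective (trans (sym tail)
    (trans (cong (λ b → #₂ (b ∷ seg f (suc a) (suc (μ + μ)))) (sym first)) tot))))
  suffixes : ∀ r k → r + (k + k) ≡ μ + μ → k ≤ # (seg f (suc r + a) (k + k))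
  suffixes r k eq = half-≤ (ℕ.≤-pred (ℕ.≤-trans (suf (suc r) (suc (k + k)) (cong suc (trans (ℕ.+-suc r (k + k)) (cong suc eq))))
    (ℕ.≤-reflexive (#₂-∷ʳ● f (suc r + a) (k + k) (suffix-end f eq last)))))

-- For k = 0 the word D is balanced; it becomes the letters strictly between the two interchanged
-- entries.
FHit⁻ : ∀ {k w v} → FHit k w v → ∃₂ λ D S → w ≡ D ++ ● ∷ S × v ≡ D ++ ○ ∷ S × FPass k D 0
FHit⁻ stop = [] , _ , refl , refl , nil
FHit⁻ (open′ h) with D , S , refl , refl , p ← FHit⁻ h = ○ ∷ D , S , refl , refl , open′ p
FHit⁻ (close h) with D , S , refl , refl , p ← FHit⁻ h = ● ∷ D , S , refl , refl , close p

GHit⁻ : ∀ {k w v} → GHit k w v → ∃₂ λ S D → w ≡ S ++ ○ ∷ D × v ≡ S ++ ● ∷ D × GPass k D 0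
GHit⁻ (stop p) = [] , _ , refl , refl , p
GHit⁻ (there {b = b} h) with S , D , refl , refl , p ← GHit⁻ h = b ∷ S , D , refl , refl , p

nth-++-at : ∀ D {b S} → nth (D ++ b ∷ S) (length D) ≡ b
nth-++-at []      = refl
nth-++-at (_ ∷ D) = nth-++-at D

nth-++-other : ∀ D {b c S} y → y ≢ length D → nth (D ++ b ∷ S) y ≡ nth (D ++ c ∷ S) y
nth-++-other []      zero    y≢ = ⊥-elim (y≢ refl)
nth-++-other []      (suc y) y≢ = refl
nth-++-other (_ ∷ D) zero    y≢ = refl
nth-++-other (_ ∷ D) (suc y) y≢ = nth-++-other D y λ eq → y≢ (cong suc eq)

does-true : ∀ {a} {P : Set a} (d : Dec P) → does d ≡ true → P
does-true (yes p) _ = p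

-- Interchanging two letters of a cyclic word

module CyclicMoves (n : ℕ) .{{_ : NonZero n}} where
  open CyclicWords n
  open Positions n

  record Flip (p p′ : Subset n) (a b : ℕ) : Set where
    field
      at-a   : χ p′ a ≡ χ p b
      at-b   : χ p′ b ≡ χ p a
      others : ∀ x → ¬ x ≋ a → ¬ x ≋ b → χ p′ x ≡ χ p x

  -- All conditions on a move of the second kind except (c), for i = ⟦ 1 + o ⟧ and
  -- j = ⟦ 2 + ℓ + o ⟧; the condition i ≢ j ⊕ 1 has become 3 + ℓ ≤ n.
  record Arc (p p′ : Subset n) (o ℓ : ℕ) : Set where
    field
      short    : 3 + ℓ ≤ n
      first    : χ p (1 + o) ≡ ●
      last     : χ p (2 + ℓ + o) ≡ ○
      flip     : Flip p p′ (1 + o) (2 + ℓ + o)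
      balanced : GPass 0 (seg (χ p) (2 + o) ℓ) 0
    open Flip flip public

  flip-seg : ∀ {p p′ a b} → Flip p p′ a b → ∀ c m → (∀ y → y < m → ¬ y + c ≋ a × ¬ y + c ≋ b) → seg (χ p′) c m ≡ seg (χ p) c m
  flip-seg F c m out = seg-cong _ _ c c m λ y y<m → Flip.others F (y + c) (proj₁ (out y y<m)) (proj₂ (out y y<m))

  rot-split : ∀ l r → 2 + (l + (1 + r)) ≡ n → ∀ p a → rot p a ≡
              χ p a ∷ χ p (1 + a) ∷ seg (χ p) (2 + a) l ++ χ p (2 + l + a) ∷ seg (χ p) (3 + l + a) r
  rot-split l r eq p a = trans (cong (seg (χ p) a) (sym eq)) (cong (λ w → χ p a ∷ χ p (1 + a) ∷ w)
    (trans (seg-++ (χ p) (2 + a) l (1 + r)) (cong (λ c → seg (χ p) (2 + a) l ++ seg (χ p) c (1 + r))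
      (solve 2 (λ l a → l :+ (con 2 :+ a) := con 2 :+ l :+ a) refl l a))))

  flip⇒step : ∀ {p p′ a} → 3 ≤ n → CupAt a p → Flip p p′ a (1 + a) → StepAt a p′ p
  flip⇒step {p} {p′} {a} 3≤n (cupAt e e′) F with r , eq ← ℕ.m≤n⇒∃[o]m+o≡n (ℕ.≤-trans (ℕ.n≤1+n 2) 3≤n)
    = stepAt (subst₂ Step
        (sym (trans (rot-2+ eq p′ a) (cong₂ _∷_ (trans (Flip.at-a F) e′) (cong₂ _∷_ (trans (Flip.at-b F) e) same))))
        (sym (trans (rot-2+ eq p a) (cong₂ (λ b c → b ∷ c ∷ seg (χ p) (2 + a) r) e e′)))
        swap)
    where
    far : ∀ z → z < 2 → ∀ y → y < r → ¬ y + (2 + a) ≋ z + a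
    far z z<2 y y<r e = distinct a {y + 2} {z}
      (ℕ.<-≤-trans (subst (_< 2 + r) (ℕ.+-comm 2 y) (s≤s (s≤s y<r))) (ℕ.≤-reflexive eq)) (ℕ.<-trans z<2 3≤n)
      (λ e′ → ℕ.<⇒≢ (ℕ.<-≤-trans z<2 (ℕ.m≤n+m 2 y)) (sym e′)) (trans (cong (_% n) (ℕ.+-assoc y 2 a)) e)
    same : seg (χ p′) (2 + a) r ≡ seg (χ p) (2 + a) r
    same = flip-seg F (2 + a) r λ y y<r → far 0 (s≤s z≤n) y y<r , far 1 (s≤s (s≤s z≤n)) y y<r

  module _ {p p′ o ℓ} (A : Arc p p′ o ℓ) where
    open Arc A

    away : ∀ y → y < n → y ≢ 0 → y ≢ 1 + ℓ → χ p′ (y + (1 + o)) ≡ χ p (y + (1 + o))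
    away y y<n y≢0 y≢ = others (y + (1 + o))
      (distinct (1 + o) y<n (ℕ.≤-trans (s≤s z≤n) short) y≢0)
      (λ e → distinct (1 + o) y<n (ℕ.≤-trans (ℕ.n≤1+n _) short) y≢ (trans e (cong (λ c → (1 + c) % n) (sym (ℕ.+-suc ℓ o)))))

    away-at : ∀ y x → y + (1 + o) ≡ x → y < n → y ≢ 0 → y ≢ 1 + ℓ → χ p′ x ≡ χ p x
    away-at y _ refl = away y

    before : χ p′ o ≡ χ p o
    before = others o (distinct o {0} {1} (ℕ.≤-trans (s≤s z≤n) short) (ℕ.≤-trans (s≤s (s≤s z≤n)) short) (λ ()))
                      (distinct o {0} {2 + ℓ} (ℕ.≤-trans (s≤s z≤n) short) short (λ ()))

    inner-same : seg (χ p′) (2 + o) ℓ ≡ seg (χ p) (2 + o) ℓ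
    inner-same = seg-cong _ _ (2 + o) (2 + o) ℓ λ y y<ℓ → away-at (1 + y) _
      (solve 2 (λ y o → con 1 :+ y :+ (con 1 :+ o) := y :+ (con 2 :+ o)) refl y o)
      (ℕ.≤-trans (s≤s y<ℓ) (ℕ.≤-trans (ℕ.m≤n+m (1 + ℓ) 2) short)) (λ ()) λ e → ℕ.<⇒≢ y<ℓ (ℕ.suc-injective e)

    after-same : ∀ c r → 2 + ℓ + (c + r) ≤ n → seg (χ p′) (3 + ℓ + c + o) r ≡ seg (χ p) (3 + ℓ + c + o) r
    after-same c r le = seg-cong _ _ (3 + ℓ + c + o) (3 + ℓ + c + o) r λ y y<r → away-at (2 + ℓ + c + y) _
      (solve 4 (λ ℓ c y o → con 2 :+ ℓ :+ c :+ y :+ (con 1 :+ o) := y :+ (con 3 :+ ℓ :+ c :+ o)) refl ℓ c y o)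
      (ℕ.<-≤-trans (ℕ.+-monoʳ-< (2 + ℓ + c) y<r) (ℕ.≤-trans (ℕ.≤-reflexive (ℕ.+-assoc (2 + ℓ) c r)) le))
      (λ ()) λ e → ℕ.<⇒≢ (s≤s (s≤s (ℕ.≤-trans (ℕ.m≤m+n ℓ c) (ℕ.m≤m+n (ℓ + c) y)))) (sym e)

    outer-same : ∀ r → 3 + ℓ + r ≡ n → seg (χ p′) (3 + ℓ + o) r ≡ seg (χ p) (3 + ℓ + o) r
    outer-same r eq = subst (λ c → seg (χ p′) (3 + c + o) r ≡ seg (χ p) (3 + c + o) r) (ℕ.+-identityʳ ℓ)
      (after-same 0 r (ℕ.≤-trans (ℕ.n≤1+n _) (ℕ.≤-reflexive eq)))

    -- The first half of condition (c). After the interchange the site at o reads ○ ○, and its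
    -- search runs over the balanced letters to the closer now at j and undoes the interchange.
    arc⇒step-right : χ p o ≡ ○ → StepAt o p′ p
    arc⇒step-right e with r , eq ← ℕ.m≤n⇒∃[o]m+o≡n short
      = stepAt (subst₂ Step
          (sym (trans (rot-split ℓ r eq′ p′ o)
            (cong₂ _∷_ (trans before e)
            (cong₂ _∷_ (trans at-a last) (cong₂ _++_ inner-same (cong₂ _∷_ (trans at-b first) (outer-same r eq)))))))
          (sym (trans (rot-split ℓ r eq′ p o)
            (cong₂ _∷_ e (cong₂ _∷_ first (cong (λ b → seg (χ p) (2 + o) ℓ ++ b ∷ seg (χ p) (3 + ℓ + o) r) last)))))
          (right (FHit-++ʳ (GPass⇒FPass balanced) stop)))
      where
      eq′ : 2 + (ℓ + (1 + r)) ≡ n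
      eq′ = trans (cong (2 +_) (ℕ.+-suc ℓ r)) eq

    -- The second half of condition (c). After the interchange the site at j reads ● ●; in the
    -- rotation starting there the balanced letters come last, so the search from the right runs
    -- over them to the opener now at i.
    arc⇒step-left : χ p (3 + ℓ + o) ≡ ● → StepAt (2 + ℓ + o) p′ p
    arc⇒step-left e with r , eq ← ℕ.m≤n⇒∃[o]m+o≡n short
      = stepAt (subst₂ Step
          (sym (trans (split p′)
            (cong₂ _∷_ (trans at-b first)
            (cong₂ _∷_ (trans next e) (cong₂ _++_ between (cong₂ _∷_ (trans at-a last) inner-same))))))
          (sym (trans (split p)
            (cong₂ _∷_ last (cong₂ _∷_ e (cong (λ b → seg (χ p) (4 + ℓ + o) r ++ b ∷ seg (χ p) (2 + o) ℓ) first)))))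
          (left (GHit-++ʳ (seg (χ p) (4 + ℓ + o) r) (stop balanced))))
      where
      wrap : ∀ c → c + (2 + r + (2 + ℓ + o)) ≋ c + (1 + o)
      wrap c = trans (cong (_% n) (trans (solve 4 (λ c r ℓ o → c :+ (con 2 :+ r :+ (con 2 :+ ℓ :+ o)) :=
        con 3 :+ ℓ :+ r :+ (c :+ (con 1 :+ o))) refl c r ℓ o) (cong (_+ (c + (1 + o))) eq))) (n+-≋ (c + (1 + o)))
      split : ∀ q → rot q (2 + ℓ + o) ≡
              χ q (2 + ℓ + o) ∷ χ q (3 + ℓ + o) ∷ seg (χ q) (4 + ℓ + o) r ++ χ q (1 + o) ∷ seg (χ q) (2 + o) ℓ
      split q = trans (rot-split r ℓ (trans (cong (2 +_) (trans (ℕ.+-suc r ℓ) (cong suc (ℕ.+-comm r ℓ)))) eq) q (2 + ℓ + o))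
        (cong (λ w → χ q (2 + ℓ + o) ∷ χ q (3 + ℓ + o) ∷ seg (χ q) (4 + ℓ + o) r ++ w)
          (cong₂ _∷_ (χ-cong q (wrap 0)) (seg-cong (χ q) (χ q) _ _ ℓ λ y _ → χ-cong q (+-cong-≋ {y} refl (wrap 1)))))
      next : χ p′ (3 + ℓ + o) ≡ χ p (3 + ℓ + o)
      next = away-at (2 + ℓ) _ (trans (ℕ.+-suc (2 + ℓ) o) refl) short (λ ()) (λ e → ℕ.<⇒≢ ℕ.≤-refl (sym e))
      between : seg (χ p′) (4 + ℓ + o) r ≡ seg (χ p) (4 + ℓ + o) r
      between = subst (λ c → seg (χ p′) c r ≡ seg (χ p) c r) (cong (λ c → 3 + (c + o)) (ℕ.+-comm ℓ 1))
        (after-same 1 r (ℕ.≤-reflexive (trans (ℕ.+-suc (2 + ℓ) r) eq)))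

  rot-length : ∀ p {k w} → rot p k ≡ w → length w ≡ n
  rot-length p {k} e = trans (cong length (sym e)) (length-rot p k)

  χ-rot : ∀ p {k w} → rot p k ≡ w → ∀ y → y < n → χ p (y + k) ≡ nth w y
  χ-rot p {k} e y y<n = trans (sym (rot-nth p k y y<n)) (cong (λ w → nth w y) e)

  others-rot : ∀ p p′ {k w w′} → rot p k ≡ w → rot p′ k ≡ w′ → ∀ a b →
               (∀ y → y ≢ a → y ≢ b → nth w′ y ≡ nth w y) →
               ∀ x → ¬ x ≋ a + k → ¬ x ≋ b + k → χ p′ x ≡ χ p x
  others-rot p p′ {k} {w} {w′} e e′ a b eq x x≢a x≢b = begin
    χ p′ x                   ≡⟨ χ-cong p′ (steps-≋ k x) ⟨
    χ p′ (steps k x + k)     ≡⟨ χ-rot p′ e′ _ (steps< k x) ⟩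
    nth w′ (steps k x)       ≡⟨ eq _ (λ y≡a → x≢a (trans (sym (steps-≋ k x)) (cong (λ y → (y + k) % n) y≡a))) (λ y≡b → x≢b (trans (sym (steps-≋ k x)) (cong (λ y → (y + k) % n) y≡b))) ⟩
    nth w (steps k x)        ≡⟨ χ-rot p e _ (steps< k x) ⟨
    χ p (steps k x + k)      ≡⟨ χ-cong p (steps-≋ k x) ⟩
    χ p x                    ∎
    where open ≡-Reasoning

  data StepView (k : ℕ) (p p′ : Subset n) : Set where
    swaps : CupAt k p → Flip p p′ k (1 + k) → StepView k p p′
    arcʳ  : ∀ {ℓ} → Arc p p′ k ℓ → χ p k ≡ ○ → StepView k p p′
    -- The arc precedes its site on the cycle, so with natural positions its end meets k only modulo
    -- n.
    arcˡ  : ∀ {o ℓ} → Arc p p′ o ℓ → 2 + ℓ + o ≋ k → χ p (3 + ℓ + o) ≡ ● → StepView k p p′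

  stepView : ∀ {k p p′} → 3 ≤ n → StepAt k p′ p → StepView k p p′
  stepView {k} {p} {p′} 3≤n (stepAt s) = view s refl refl
    where
    0<n : 0 < n
    0<n = ℕ.≤-trans (s≤s z≤n) 3≤n
    1<n : 1 < n
    1<n = ℕ.≤-trans (s≤s (s≤s z≤n)) 3≤n
    view : ∀ {w v} → Step w v → rot p k ≡ v → rot p′ k ≡ w → StepView k p p′
    view swap e e′ = swaps (cupAt (χ-rot p e 0 0<n) (χ-rot p e 1 1<n)) record
      { at-a   = trans (χ-rot p′ e′ 0 0<n) (sym (χ-rot p e 1 1<n))
      ; at-b   = trans (χ-rot p′ e′ 1 1<n) (sym (χ-rot p e 0 0<n))
      ; others = others-rot p p′ e e′ 0 1 λ
        { zero y≢0 _ → ⊥-elim (y≢0 refl) ; (suc zero) _ y≢1 → ⊥-elim (y≢1 refl) ; (suc (suc y)) _ _ → refl }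
      }
    view (right h) e e′ with D , S , refl , refl , bal ← FHit⁻ h = arcʳ {ℓ = length D} (record
      { short    = ℕ.≤-trans (ℕ.m≤m+n (3 + ℓ) r) (ℕ.≤-reflexive eq)
      ; first    = χ-rot p e 1 1<n
      ; last     = trans (χ-rot p e (2 + ℓ) ℓ<n) (nth-++-at D)
      ; flip     = record
        { at-a   = trans (χ-rot p′ e′ 1 1<n) (sym (trans (χ-rot p e (2 + ℓ) ℓ<n) (nth-++-at D)))
        ; at-b   = trans (trans (χ-rot p′ e′ (2 + ℓ) ℓ<n) (nth-++-at D)) (sym (χ-rot p e 1 1<n))
        ; others = others-rot p p′ e e′ 1 (2 + ℓ) λ
          { zero _ _ → refl ; (suc zero) y≢1 _ → ⊥-elim (y≢1 refl)
          ; (suc (suc y)) _ y≢ → nth-++-other D y λ eq → y≢ (cong (2 +_) eq) }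
        }
      ; balanced = subst (λ w → GPass 0 w 0) (sym D≡) (FPass⇒GPass bal)
      }) (χ-rot p e 0 0<n)
      where
      ℓ = length D
      r = length S
      eq : 3 + ℓ + r ≡ n
      eq = trans (cong (2 +_) (sym (trans (List.length-++ D) (ℕ.+-suc ℓ r)))) (rot-length p e)
      ℓ<n : 2 + ℓ < n
      ℓ<n = ℕ.≤-trans (ℕ.m≤m+n (3 + ℓ) r) (ℕ.≤-reflexive eq)
      D≡ : seg (χ p) (2 + k) ℓ ≡ D
      D≡ = proj₁ (++-injective-length _ D (length-seg (χ p) (2 + k) ℓ) (List.∷-injectiveʳ (List.∷-injectiveʳ
        (trans (sym (rot-split ℓ r (trans (cong (2 +_) (ℕ.+-suc ℓ r)) eq) p k)) e))))
    -- The two letters of the site are followed by S, so i stands at 2 + length S + k, and j is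
    -- reached one full turn after k.
    view (left h) e e′ with S , D , refl , refl , bal ← GHit⁻ h = arcˡ {o = 1 + length S + k} {length D} (record
      { short    = ℕ.≤-trans (ℕ.m≤m+n (3 + ℓ) r) (ℕ.≤-reflexive eq)
      ; first    = first
      ; last     = last
      ; flip     = record
        { at-a   = trans (trans (χ-rot p′ e′ (2 + r) r<n) (nth-++-at S)) (sym last)
        ; at-b   = trans (χ-cong p′ wrap) (trans (χ-rot p′ e′ 0 0<n) (sym first))
        ; others = λ x x≢a x≢b → others-rot p p′ e e′ (2 + r) 0
          (λ { zero _ y≢0 → ⊥-elim (y≢0 refl) ; (suc zero) _ _ → refl
             ; (suc (suc y)) y≢ _ → nth-++-other S y λ eq → y≢ (cong (2 +_) eq) })
          x x≢a (λ x≋k → x≢b (trans x≋k (sym wrap)))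
        }
      ; balanced = subst (λ w → GPass 0 w 0) (sym D≡) bal
      }) wrap (trans (χ-cong p (+-cong-≋ {1} refl wrap)) (χ-rot p e 1 1<n))
      where
      ℓ = length D
      r = length S
      eq : 3 + ℓ + r ≡ n
      eq = trans (cong (2 +_) (sym (trans (List.length-++ S) (trans (ℕ.+-suc r ℓ) (cong suc (ℕ.+-comm r ℓ)))))) (rot-length p e)
      r<n : 2 + r < n
      r<n = ℕ.≤-trans (s≤s (s≤s (s≤s (ℕ.m≤n+m r ℓ)))) (ℕ.≤-reflexive eq)
      wrap : 2 + ℓ + (1 + r + k) ≋ k
      wrap = trans (cong (_% n) (trans (solve 3 (λ ℓ r k → con 2 :+ ℓ :+ (con 1 :+ r :+ k) := con 3 :+ ℓ :+ r :+ k) refl ℓ r k)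
        (cong (_+ k) eq))) (n+-≋ k)
      first : χ p (2 + r + k) ≡ ●
      first = trans (χ-rot p e (2 + r) r<n) (nth-++-at S)
      last : χ p (2 + ℓ + (1 + r + k)) ≡ ○
      last = trans (χ-cong p wrap) (χ-rot p e 0 0<n)
      D≡ : seg (χ p) (3 + r + k) ℓ ≡ D
      D≡ = List.∷-injectiveʳ (proj₂ (++-injective-length _ S (length-seg (χ p) (2 + k) r) (List.∷-injectiveʳ (List.∷-injectiveʳ
        (trans (sym (rot-split r ℓ (trans (cong (2 +_) (trans (ℕ.+-suc r ℓ) (cong suc (ℕ.+-comm r ℓ)))) eq) p k)) e)))))

double/2 : ∀ μ → (μ + μ) / 2 ≡ μ
double/2 μ = trans (cong (_/ 2) (solve 1 (λ μ → μ :+ μ := μ :* con 2) refl μ)) (m*n/n≡m μ 2)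

odd-∤ : ∀ x → ¬ 2 ∣ suc (x + x)
odd-∤ x d with ∣1⇒≡1 (∣m+n∣m⇒∣n (subst (2 ∣_) (ℕ.+-comm 1 (x + x)) d)
                       (divides x (solve 1 (λ μ → μ :+ μ := μ :* con 2) refl x)))
... | ()

-- Moves between tableaux

module Moves (n λ₁ λ₂ : ℕ) .{{_ : NonZero n}} where
  open Cyclic n
  open CyclicWords n
  open Positions n
  open CyclicMoves n
  open TwoRow n λ₁ λ₂
  open Tableaux n λ₁ λ₂

  ∈²⇒ : ∀ {t x} → x ∈ t ² → lookup (t ²) x ≡ ●
  ∈²⇒ = Vec.[]=⇒lookup

  ∈²⇐ : ∀ t x → lookup (t ²) x ≡ ● → x ∈ t ²
  ∈²⇐ t x = Vec.lookup⇒[]= x (t ²)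

  ∈¹⇒ : ∀ t {x} → x ∈ t ¹ → lookup (t ²) x ≡ ○
  ∈¹⇒ t {x} x∈ = Bool.not-injective (trans (sym (lookup-¹ t x)) (Vec.[]=⇒lookup x∈))

  ∈¹⇐ : ∀ t x → lookup (t ²) x ≡ ○ → x ∈ t ¹
  ∈¹⇐ t x eq = Vec.lookup⇒[]= x (t ¹) (trans (lookup-¹ t x) (cong not eq))

  lookup-χ : ∀ p i → lookup p i ≡ χ p (toℕ i)
  lookup-χ p i = cong (lookup p) (sym (⟦toℕ⟧ i))

  ⊕1 : ∀ i → i ⊕ 1 ≡ ⟦ suc (toℕ i) ⟧
  ⊕1 i = trans (cong (_⊕ 1) (sym (⟦toℕ⟧ i))) (⊕-⟦⟧ 1 (toℕ i))

  descent? : ∀ t i → Dec (i ∈ t ¹ × i ⊕ 1 ∈ t ²)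
  descent? t i = i ∈? t ¹ ×-dec i ⊕ 1 ∈? t ²

  ∈des⇒ : ∀ t i → i ∈ des t → CupAt (toℕ i) (t ²)
  ∈des⇒ t i i∈ with does-true (descent? t i) (trans (sym (Vec.lookup∘tabulate (λ i → does (descent? t i)) i)) (Vec.[]=⇒lookup i∈))
  ... | i∈¹ , i+1∈² = cupAt (trans (sym (lookup-χ (t ²) i)) (∈¹⇒ t i∈¹))
                            (trans (cong (lookup (t ²)) (sym (⊕1 i))) (∈²⇒ {t} i+1∈²))

  ∈des⇐ : ∀ t i → CupAt (toℕ i) (t ²) → i ∈ des t
  ∈des⇐ t i (cupAt e e′) = Vec.lookup⇒[]= i (des t) (trans (Vec.lookup∘tabulate (λ i → does (descent? t i)) i)
    (dec-true (descent? t i) (∈¹⇐ t i (trans (lookup-χ (t ²) i) e) ,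
                              ∈²⇐ t (i ⊕ 1) (trans (cong (lookup (t ²)) (⊕1 i)) e′))))

  interchanged⇒flip : ∀ {s t a b} → ¬ a ≋ b → Interchanged ⟦ a ⟧ ⟦ b ⟧ s t → Flip (s ²) (t ²) a b
  interchanged⇒flip {s} {t} {a} {b} a≢b I = record
    { at-a   = trans (Interchanged⇒ {⟦ a ⟧} {⟦ b ⟧} {s} {t} I ⟦ a ⟧) (cong (lookup (s ²)) (transpose-second λ e → a≢b (⟦⟧-injective {a} (sym e))))
    ; at-b   = trans (Interchanged⇒ {⟦ a ⟧} {⟦ b ⟧} {s} {t} I ⟦ b ⟧) (cong (lookup (s ²)) (transpose-first ⟦ b ⟧ ⟦ a ⟧))
    ; others = λ x x≢a x≢b → trans (Interchanged⇒ {⟦ a ⟧} {⟦ b ⟧} {s} {t} I ⟦ x ⟧)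
        (cong (lookup (s ²)) (transpose-other (λ e → x≢b (⟦⟧-injective {x} e)) (λ e → x≢a (⟦⟧-injective {x} e))))
    }

  flip⇒interchanged : ∀ {s t a b} → ¬ a ≋ b → Flip (s ²) (t ²) a b → Interchanged ⟦ a ⟧ ⟦ b ⟧ s t
  flip⇒interchanged {s} {t} {a} {b} a≢b F = Interchanged⇐ {⟦ a ⟧} {⟦ b ⟧} {s} {t} pointwise
    where
    open Flip F
    pointwise : ∀ x → lookup (t ²) x ≡ lookup (s ²) (Perm.transpose ⟦ b ⟧ ⟦ a ⟧ x)
    pointwise x = at x (x Fin.≟ ⟦ a ⟧) (x Fin.≟ ⟦ b ⟧)
      where
      at : ∀ x → Dec (x ≡ ⟦ a ⟧) → Dec (x ≡ ⟦ b ⟧) → lookup (t ²) x ≡ lookup (s ²) (Perm.transpose ⟦ b ⟧ ⟦ a ⟧ x)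
      at _ (yes refl) _ = trans at-a (cong (lookup (s ²)) (sym (transpose-second λ e → a≢b (⟦⟧-injective {a} (sym e)))))
      at _ (no _) (yes refl) = trans at-b (cong (lookup (s ²)) (sym (transpose-first ⟦ b ⟧ ⟦ a ⟧)))
      at x (no x≢a) (no x≢b) = trans (lookup-χ (t ²) x)
        (trans (others (toℕ x) (λ e → x≢a (trans (sym (⟦toℕ⟧ x)) (⟦⟧-cong e))) (λ e → x≢b (trans (sym (⟦toℕ⟧ x)) (⟦⟧-cong e))))
               (trans (sym (lookup-χ (s ²) x)) (cong (lookup (s ²)) (sym (transpose-other x≢b x≢a)))))

  Second : RSYT → RSYT → Fin n → Fin n → Set
  Second s t i j =
    (i ∈ s ² × j ∈ s ¹ × i ≢ j ⊕ 1 × Interchanged i j s t) ×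
    ¬ (2 ∣ gap i j) ×
    (i ⊕ 1 ∈ s ¹ × j ⊖ 1 ∈ s ²) ×
    (i ⊖ 1 ∈ s ¹ ⊎ j ⊕ 1 ∈ s ²) ×
    CondD s i j ×
    CondE s i j

  module _ (s : RSYT) (o : ℕ) where

    f : ℕ → Bool
    f = χ (s ²)

    ⊖-at : ∀ k x y → x ≡ k + y → ⟦ x ⟧ ⊖ k ≡ ⟦ y ⟧
    ⊖-at k _ y refl = ⊖-⟦⟧ k y

    -- The interval from j - 1 - 2k to j - 2 has 2k entries and begins r = 2μ - 2k steps after i +
    -- 2.
    condD-count : ∀ μ r k → 4 + (μ + μ) < n → r + (k + k) ≡ μ + μ →
      ∣ s ² ∩ ⟨ ⟦ 4 + (μ + μ) + o ⟧ ⊖ (1 + 2 * k) , ⟦ 4 + (μ + μ) + o ⟧ ⊖ 2 ⟩ ∣ ≡ # (seg f (suc r + (2 + o)) (k + k))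
    condD-count μ r k N<n eq = trans
      (cong₂ (λ i j → ∣ s ² ∩ ⟨ i , j ⟩ ∣)
        (⊖-at (1 + 2 * k) (4 + (μ + μ) + o) (suc r + (2 + o)) (trans (cong (λ m → 4 + m + o) (sym eq))
          (solve 3 (λ r k o → con 4 :+ (r :+ (k :+ k)) :+ o := con 1 :+ con 2 :* k :+ (con 1 :+ r :+ (con 2 :+ o))) refl r k o)))
        (⊖-⟦⟧ 2 (2 + (μ + μ) + o)))
      (∣∩⟨⟩∣ (s ²) (suc r + (2 + o)) (2 + (μ + μ) + o) (k + k)
        (trans (cong (λ m → 3 + m + o) (sym eq))
          (solve 3 (λ r k o → con 3 :+ (r :+ (k :+ k)) :+ o := k :+ k :+ (con 1 :+ r :+ (con 2 :+ o))) refl r k o))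
        (ℕ.≤-trans (s≤s (ℕ.≤-trans (ℕ.m≤n+m (k + k) r) (ℕ.≤-trans (ℕ.≤-reflexive eq) (ℕ.m≤n+m (μ + μ) 4)))) N<n))

    condE-count : ∀ μ → 4 + (μ + μ) < n →
      ∣ s ² ∩ ⟨ ⟦ 1 + o ⟧ ⊕ 2 , ⟦ 4 + (μ + μ) + o ⟧ ⊖ 2 ⟩ ∣ ≡ # (seg f (3 + o) (μ + μ))
    condE-count μ N<n = trans
      (cong₂ (λ i j → ∣ s ² ∩ ⟨ i , j ⟩ ∣) (⊕-⟦⟧ 2 (1 + o)) (⊖-⟦⟧ 2 (2 + (μ + μ) + o)))
      (∣∩⟨⟩∣ (s ²) (3 + o) (2 + (μ + μ) + o) (μ + μ)
        (solve 2 (λ m o → con 3 :+ m :+ o := m :+ (con 3 :+ o)) refl (μ + μ) o)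
        (ℕ.≤-trans (s≤s (ℕ.m≤n+m (μ + μ) 4)) N<n))

    gap-at : ∀ ℓ → suc ℓ < n → gap ⟦ 1 + o ⟧ ⟦ 2 + ℓ + o ⟧ ≡ suc ℓ
    gap-at ℓ ℓ<n = trans (cong (λ x → gap ⟦ 1 + o ⟧ ⟦ x ⟧) (cong suc (sym (ℕ.+-suc ℓ o))))
                         (gap-⟦⟧ ℓ (1 + o) (ℕ.<-trans (ℕ.n<1+n ℓ) ℓ<n))

    -- The gap is ℓ + 1, so condition (a) makes ℓ even. Either ℓ = 0, which is j = i + 1, or ℓ = 2 +
    -- 2μ, and then (gap - 3)/2 is μ.
    conds⇒balanced : ∀ ℓ → 3 + ℓ ≤ n → ¬ (2 ∣ gap ⟦ 1 + o ⟧ ⟦ 2 + ℓ + o ⟧) →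
      f (2 + o) ≡ ○ → f (1 + ℓ + o) ≡ ● → CondD s ⟦ 1 + o ⟧ ⟦ 2 + ℓ + o ⟧ → CondE s ⟦ 1 + o ⟧ ⟦ 2 + ℓ + o ⟧ →
      GPass 0 (seg f (2 + o) ℓ) 0
    conds⇒balanced ℓ short odd first last D E with parity ℓ
    ... | inj₂ (x , refl) = ⊥-elim (odd (divides (suc x) (trans (gap-at ℓ (ℕ.≤-trans (ℕ.n≤1+n _) short))
                              (solve 1 (λ x → con 2 :+ (x :+ x) := (con 1 :+ x) :* con 2) refl x))))
    ... | inj₁ (zero , refl) = nil
    ... | inj₁ (suc μ , eq) = go ℓ (trans eq (cong suc (ℕ.+-suc μ μ))) short last D E
      where
      go : ∀ ℓ → ℓ ≡ 2 + (μ + μ) → 3 + ℓ ≤ n → f (1 + ℓ + o) ≡ ● →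
           CondD s ⟦ 1 + o ⟧ ⟦ 2 + ℓ + o ⟧ → CondE s ⟦ 1 + o ⟧ ⟦ 2 + ℓ + o ⟧ → GPass 0 (seg f (2 + o) ℓ) 0
      go _ refl short last D E = inner⇒balanced f (2 + o) μ record
        { first    = first
        ; last     = trans (cong f (solve 2 (λ m o → con 1 :+ m :+ (con 2 :+ o) := con 3 :+ m :+ o) refl (μ + μ) o)) last
        ; total    = trans (sym (condE-count μ short)) (trans (E j≢i+1) half)
        ; suffixes = λ r k eq → suffix r k eq
        }
        where
        half : (gap ⟦ 1 + o ⟧ ⟦ 4 + (μ + μ) + o ⟧ ∸ 3) / 2 ≡ μ
        half = trans (cong (λ g → (g ∸ 3) / 2) (gap-at (2 + (μ + μ)) (ℕ.≤-trans (ℕ.n≤1+n _) short))) (double/2 μ)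
        j≢i+1 : ⟦ 4 + (μ + μ) + o ⟧ ≢ ⟦ 1 + o ⟧ ⊕ 1
        j≢i+1 e = distinct o {4 + (μ + μ)} {2} short (ℕ.≤-trans (s≤s (s≤s (s≤s z≤n))) short) (λ ())
          (⟦⟧-injective {4 + (μ + μ) + o} (trans e (⊕-⟦⟧ 1 (1 + o))))
        suffix : ∀ r k → r + (k + k) ≡ μ + μ → k ≤ # (seg f (suc r + (2 + o)) (k + k))
        suffix r zero    _  = z≤n
        suffix r (suc k) eq = subst (suc k ≤_) (condD-count μ r (suc k) short eq)
          (D (suc k) (s≤s z≤n) (subst (suc k ≤_) (sym half)
            (half-≤ (ℕ.m≤n⇒m≤1+n (ℕ.≤-trans (ℕ.m≤n+m (suc k + suc k) r) (ℕ.≤-reflexive eq))))))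

    -- For ℓ = 0 condition (b) repeats that j is in the top row and i in the bottom row; hence the
    -- premises in `first` and `last`.
    record Conds (ℓ : ℕ) : Set where
      field
        odd   : ¬ (2 ∣ gap ⟦ 1 + o ⟧ ⟦ 2 + ℓ + o ⟧)
        first : f (1 + o) ≡ ● → f (2 + ℓ + o) ≡ ○ → f (2 + o) ≡ ○
        last  : f (1 + o) ≡ ● → f (2 + ℓ + o) ≡ ○ → f (1 + ℓ + o) ≡ ●
        condD : CondD s ⟦ 1 + o ⟧ ⟦ 2 + ℓ + o ⟧
        condE : CondE s ⟦ 1 + o ⟧ ⟦ 2 + ℓ + o ⟧

    balanced⇒conds : ∀ ℓ → 3 + ℓ ≤ n → GPass 0 (seg f (2 + o) ℓ) 0 → Conds ℓ
    balanced⇒conds ℓ short bal = go ℓ (# (seg f (2 + o) ℓ)) (sym (balanced⇒total f (2 + o) ℓ bal)) short bal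
      where
      go : ∀ ℓ x → ℓ ≡ x + x → 3 + ℓ ≤ n → GPass 0 (seg f (2 + o) ℓ) 0 → Conds ℓ
      go _ zero refl short bal = record
        { odd   = λ d → odd-∤ 0 (subst (2 ∣_) (gap-at 0 (ℕ.≤-trans (ℕ.n≤1+n _) short)) d)
        ; first = λ _ e → e
        ; last  = λ e _ → e
        ; condD = λ k 1≤k k≤ → ⊥-elim (ℕ.<⇒≱ 1≤k (ℕ.≤-trans k≤ (ℕ.≤-reflexive
                    (cong (λ g → (g ∸ 3) / 2) (gap-at 0 (ℕ.≤-trans (ℕ.n≤1+n _) short))))))
        ; condE = λ j≢ → ⊥-elim (j≢ (sym (⊕-⟦⟧ 1 (1 + o))))
        }
      go ℓ (suc μ) eq short bal = go′ ℓ (trans eq (cong suc (ℕ.+-suc μ μ))) short bal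
        where
        go′ : ∀ ℓ → ℓ ≡ 2 + (μ + μ) → 3 + ℓ ≤ n → GPass 0 (seg f (2 + o) ℓ) 0 → Conds ℓ
        go′ _ refl short bal = record
          { odd   = λ d → odd-∤ (suc μ) (subst (2 ∣_) (trans (gap-at (2 + (μ + μ)) ℓ<n) (cong (2 +_) (sym (ℕ.+-suc μ μ)))) d)
          ; first = λ _ _ → Inner.first I
          ; last  = λ _ _ → trans (cong f (solve 2 (λ m o → con 3 :+ m :+ o := con 1 :+ m :+ (con 2 :+ o)) refl (μ + μ) o)) (Inner.last I)
          ; condD = λ k 1≤k k≤ → let r , eq = ℕ.m≤n⇒∃[o]m+o≡n (ℕ.+-mono-≤ (subst (k ≤_) half k≤) (subst (k ≤_) half k≤))
                                     eq′ = trans (ℕ.+-comm r (k + k)) eq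
                                 in subst (k ≤_) (sym (condD-count μ r k short eq′)) (Inner.suffixes I r k eq′)
          ; condE = λ _ → trans (condE-count μ short) (trans (Inner.total I) (sym half))
          }
          where
          I = balanced⇒inner f (2 + o) μ bal
          ℓ<n : suc (2 + (μ + μ)) < n
          ℓ<n = ℕ.≤-trans (ℕ.n≤1+n _) short
          half : (gap ⟦ 1 + o ⟧ ⟦ 4 + (μ + μ) + o ⟧ ∸ 3) / 2 ≡ μ
          half = trans (cong (λ g → (g ∸ 3) / 2) (gap-at (2 + (μ + μ)) ℓ<n)) (double/2 μ)

  arc-distinct : ∀ {p p′ o ℓ} → Arc p p′ o ℓ → ¬ 1 + o ≋ 2 + ℓ + o
  arc-distinct {o = o} {ℓ} A = distinct o {1} {2 + ℓ} (ℕ.≤-trans (s≤s (s≤s z≤n)) (Arc.short A)) (Arc.short A) (λ ())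

  arc⇒second : ∀ {s t o ℓ} → Arc (s ²) (t ²) o ℓ → χ (s ²) o ≡ ○ ⊎ χ (s ²) (3 + ℓ + o) ≡ ● → SecondKind s t
  arc⇒second {s} {t} {o} {ℓ} A c = ⟦ 1 + o ⟧ , ⟦ 2 + ℓ + o ⟧ ,
    (∈²⇐ s _ first , ∈¹⇐ s _ last , i≢j+1 , flip⇒interchanged {s} {t} (arc-distinct A) flip) ,
    Conds.odd C ,
    (subst (_∈ s ¹) (sym (⊕-⟦⟧ 1 (1 + o))) (∈¹⇐ s _ (Conds.first C first last)) ,
     subst (_∈ s ²) (sym (⊖-⟦⟧ 1 (1 + ℓ + o))) (∈²⇐ s _ (Conds.last C first last))) ,
    ends c , Conds.condD C , Conds.condE C
    where
    open Arc A
    C = balanced⇒conds s o ℓ short balanced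
    i≢j+1 : ⟦ 1 + o ⟧ ≢ ⟦ 2 + ℓ + o ⟧ ⊕ 1
    i≢j+1 e = distinct (1 + o) {0} {2 + ℓ} (ℕ.≤-trans (s≤s z≤n) short) short (λ ())
      (⟦⟧-injective {1 + o} (trans e (trans (⊕-⟦⟧ 1 (2 + ℓ + o)) (cong ⟦_⟧ (sym (ℕ.+-suc (2 + ℓ) o))))))
    ends : χ (s ²) o ≡ ○ ⊎ χ (s ²) (3 + ℓ + o) ≡ ● → ⟦ 1 + o ⟧ ⊖ 1 ∈ s ¹ ⊎ ⟦ 2 + ℓ + o ⟧ ⊕ 1 ∈ s ²
    ends (inj₁ e) = inj₁ (subst (_∈ s ¹) (sym (⊖-⟦⟧ 1 o)) (∈¹⇐ s _ e))
    ends (inj₂ e) = inj₂ (subst (_∈ s ²) (sym (⊕-⟦⟧ 1 (2 + ℓ + o))) (∈²⇐ s _ e))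

  second⇒arc : ∀ {s t} → SecondKind s t → ∃₂ (Arc (s ²) (t ²))
  second⇒arc {s} {t} (i , j , S@((i∈ , j∈ , i≢j+1 , _) , _)) = o , ℓ-arc (steps (1 + o) (toℕ j)) (steps< (1 + o) (toℕ j)) (steps-≋ (1 + o) (toℕ j))
    where
    -- This is i - 1, kept natural by adding a multiple of n. In `ℓ-arc`, d is the distance from i
    -- to j: it is not 0 because i and j lie in different rows, and it is not n - 1 because i ≢ j ⊕
    -- 1.
    o = toℕ i + neg 1
    i≡ : i ≡ ⟦ 1 + o ⟧
    i≡ = trans (sym (⟦toℕ⟧ i)) (⟦⟧-cong (sym (trans (cong (_% n) (ℕ.+-comm 1 o)) (+-neg (toℕ i) 1))))
    ℓ-arc : ∀ d → d < n → d + (1 + o) ≋ toℕ j → ∃ (Arc (s ²) (t ²) o)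
    ℓ-arc zero d<n e = ⊥-elim (Bool.not-¬ {true} refl (trans (sym (∈²⇒ {s} i∈)) (trans (cong (lookup (s ²)) i≡j) (∈¹⇒ s j∈))))
      where
      i≡j : i ≡ j
      i≡j = trans i≡ (trans (⟦⟧-cong e) (⟦toℕ⟧ j))
    ℓ-arc (suc ℓ) d<n e = ℓ , arc (subst₂ (Second s t) i≡ j≡ S)
      where
      j≡ : j ≡ ⟦ 2 + ℓ + o ⟧
      j≡ = trans (sym (⟦toℕ⟧ j)) (⟦⟧-cong (trans (sym e) (cong (λ x → suc x % n) (ℕ.+-suc ℓ o))))
      short : 3 + ℓ ≤ n
      short = ℕ.≤∧≢⇒< d<n λ n≡ → i≢j+1 (trans i≡ (trans (⟦⟧-cong (sym (trans
        (cong (_% n) (trans (sym (ℕ.+-suc (2 + ℓ) o)) (cong (_+ (1 + o)) n≡))) (n+-≋ (1 + o)))))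
        (trans (sym (⊕-⟦⟧ 1 (2 + ℓ + o))) (cong (_⊕ 1) (sym j≡)))))
      arc : Second s t ⟦ 1 + o ⟧ ⟦ 2 + ℓ + o ⟧ → Arc (s ²) (t ²) o ℓ
      arc ((i∈ , j∈ , _ , I) , odd , (i+1∈ , j-1∈) , _ , D , E) = record
        { short    = short
        ; first    = ∈²⇒ {s} i∈
        ; last     = ∈¹⇒ s j∈
        ; flip     = interchanged⇒flip {s} {t} (distinct o {1} {2 + ℓ} (ℕ.≤-trans (s≤s (s≤s z≤n)) short) short (λ ())) I
        ; balanced = conds⇒balanced s o ℓ short odd (∈¹⇒ s (subst (_∈ s ¹) (⊕-⟦⟧ 1 (1 + o)) i+1∈))
                       (∈²⇒ {s} (subst (_∈ s ²) (⊖-⟦⟧ 1 (1 + ℓ + o)) j-1∈)) D E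
        }

  step⇒move : ∀ {s t k} → 3 ≤ n → StepAt k (t ²) (s ²) → Move s t
  step⇒move {s} {t} {k} 3≤n st with stepView 3≤n st
  ... | swaps (cupAt e e′) F = inj₁ (⟦ k ⟧ , ∈¹⇐ s _ e , subst (λ i → i ∈ s ² × Interchanged ⟦ k ⟧ i s t) (sym (⊕-⟦⟧ 1 k))
          (∈²⇐ s _ e′ , flip⇒interchanged {s} {t} (distinct k {0} {1} (ℕ.≤-trans (s≤s z≤n) 3≤n) (ℕ.≤-trans (s≤s (s≤s z≤n)) 3≤n) (λ ())) F))
  ... | arcʳ A e   = inj₂ (arc⇒second {s} {t} A (inj₁ e))
  ... | arcˡ A _ e = inj₂ (arc⇒second {s} {t} A (inj₂ e))

  ○≢● : ∀ {b} → b ≡ ○ → b ≢ ●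
  ○≢● refl ()

  -- Destroying the cup at k takes a change at k or k + 1, and letters change only at a and b.
  flip-location : ∀ {p p′ a b k} → Flip p p′ a b → CupAt k p → ¬ CupAt k p′ →
                  (k ≋ a ⊎ k ≋ b) ⊎ (1 + k ≋ a ⊎ 1 + k ≋ b)
  flip-location {p} {p′} {a} {b} {k} F (cupAt e e′) ¬c
    with k % n ℕ.≟ a % n | k % n ℕ.≟ b % n | (1 + k) % n ℕ.≟ a % n | (1 + k) % n ℕ.≟ b % n
  ... | yes x | _     | _     | _     = inj₁ (inj₁ x)
  ... | no _  | yes x | _     | _     = inj₁ (inj₂ x)
  ... | no _  | no _  | yes x | _     = inj₂ (inj₁ x)
  ... | no _  | no _  | no _  | yes x = inj₂ (inj₂ x)
  ... | no x  | no y  | no z  | no w  = ⊥-elim (¬c (cupAt (trans (Flip.others F k x y) e) (trans (Flip.others F (1 + k) z w) e′)))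

  suc-cancel-≋ : ∀ {k l} → 1 + k ≋ 1 + l → k ≋ l
  suc-cancel-≋ {k} {l} e = +-cancelʳ-≋ 1 (trans (cong (_% n) (ℕ.+-comm k 1)) (trans e (cong (_% n) (ℕ.+-comm 1 l))))

  -- One letter of the cup at k is interchanged. For the second kind, i is a closer and j an opener,
  -- so either k = j or k + 1 = i, and the other letter of the cup is the half of condition (c) that
  -- the step uses.
  move⇒step : ∀ {s t k} → 3 ≤ n → Move s t → CupAt k (s ²) → ¬ CupAt k (t ²) → StepAt k (t ²) (s ²)
  move⇒step {s} {t} {k} 3≤n (inj₁ (i , i∈ , i+1∈ , I)) c@(cupAt e e′) ¬c = at (flip-location F c ¬c)
    where
    a = toℕ i
    F : Flip (s ²) (t ²) a (1 + a)
    F = interchanged⇒flip {s} {t} (distinct a {0} {1} (ℕ.≤-trans (s≤s z≤n) 3≤n) (ℕ.≤-trans (s≤s (s≤s z≤n)) 3≤n) (λ ()))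
      (subst₂ (λ i j → Interchanged i j s t) (sym (⟦toℕ⟧ i)) (⊕1 i) I)
    fa : χ (s ²) a ≡ ○
    fa = trans (sym (lookup-χ (s ²) i)) (∈¹⇒ s i∈)
    f1+a : χ (s ²) (1 + a) ≡ ●
    f1+a = trans (cong (lookup (s ²)) (sym (⊕1 i))) (∈²⇒ {s} i+1∈)
    at : (k ≋ a ⊎ k ≋ 1 + a) ⊎ (1 + k ≋ a ⊎ 1 + k ≋ 1 + a) → StepAt k (t ²) (s ²)
    at (inj₁ (inj₁ x)) = StepAt-cong (sym x) (flip⇒step 3≤n (cupAt fa f1+a) F)
    at (inj₁ (inj₂ x)) = ⊥-elim (○≢● e (trans (χ-cong (s ²) x) f1+a))
    at (inj₂ (inj₁ x)) = ⊥-elim (○≢● fa (trans (χ-cong (s ²) (sym x)) e′))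
    at (inj₂ (inj₂ x)) = StepAt-cong (sym (suc-cancel-≋ x)) (flip⇒step 3≤n (cupAt fa f1+a) F)
  move⇒step {s} {t} {k} 3≤n (inj₂ S) c@(cupAt e e′) ¬c with o , ℓ , A ← second⇒arc {s} {t} S = at o ℓ A (flip-location (Arc.flip A) c ¬c)
    where
    at : ∀ o ℓ → Arc (s ²) (t ²) o ℓ → (k ≋ 1 + o ⊎ k ≋ 2 + ℓ + o) ⊎ (1 + k ≋ 1 + o ⊎ 1 + k ≋ 2 + ℓ + o) → StepAt k (t ²) (s ²)
    at o ℓ A (inj₁ (inj₁ x)) = ⊥-elim (○≢● e (trans (χ-cong (s ²) x) (Arc.first A)))
    at o ℓ A (inj₁ (inj₂ x)) = StepAt-cong (sym x) (arc⇒step-left A (trans (χ-cong (s ²) (+-cong-≋ {1} refl (sym x))) e′))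
    at o ℓ A (inj₂ (inj₁ x)) = StepAt-cong (sym (suc-cancel-≋ x)) (arc⇒step-right A (trans (χ-cong (s ²) (sym (suc-cancel-≋ x))) e))
    at o ℓ A (inj₂ (inj₂ x)) = ⊥-elim (○≢● (Arc.last A) (trans (χ-cong (s ²) (sym x)) e′))

-- The Hecke module

module Action (n λ₁ λ₂ : ℕ) .{{_ : NonZero n}} (3≤n : 3 ≤ n) (λ₁+λ₂≡n : λ₁ + λ₂ ≡ n) where
  open Cyclic n using (_⊕_; Adjacent; adjacent?)
  open CyclicWords n
  open TwoRow n λ₁ λ₂ using (RSYT; _²; des; move?; allRSYT; ∈-allRSYT)
  open Tableaux n λ₁ λ₂
  open Moves n λ₁ λ₂

  Cup : Fin n → RSYT → Set
  Cup i t = CupAt (toℕ i) (t ²)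

  StepT : Fin n → RSYT → RSYT → Set
  StepT i s t = StepAt (toℕ i) (s ²) (t ²)

  2≤n : 2 ≤ n
  2≤n = ℕ.≤-trans (ℕ.n≤1+n 2) 3≤n

  -- A step keeps the number of closers, so its target has λ₂ elements and is a bottom row.
  realise : ∀ {a t p} → StepAt a (t ²) p → (P : Subset n → Set) → P p → ∃ λ u → P (u ²)
  realise {t = t} {p} s P Pp = proj₁ u , subst P (sym (proj₂ u)) Pp
    where u = ²-surjective p λ₁+λ₂≡n (trans (StepAt-card s) (∣²∣ t))

  cup? : ∀ i t → Dec (Cup i t)
  cup? i t = map′ (∈des⇒ t i) (∈des⇐ t i) (i ∈? des t)

  stepT? : ∀ i t → Dec (∃ (StepT i t))
  stepT? i t = map′ (λ (p , s) → realise {t = t} s (StepAt (toℕ i) (t ²)) s) (λ (u , s) → u ² , s) (stepAt? (toℕ i) (t ²))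

  open Operators Laurent.commutativeRing {RSYT} {Fin n} q½ Cup StepT cup? stepT?
    (λ {_} {_} {u} {w} s s′ → ²-injective {u} {w} (StepAt-functional s s′)) (StepAt-target 2≤n) (StepAt-source 2≤n)

  toℕ-⊕1 : ∀ i → toℕ (i ⊕ 1) ≋ suc (toℕ i)
  toℕ-⊕1 i = ⟦⟧-injective {toℕ (i ⊕ 1)} (trans (⟦toℕ⟧ (i ⊕ 1)) (⊕1 i))

  adjacent⇒linking : ∀ {i j} → Adjacent i j → Linking i j
  adjacent⇒linking {i} (inj₁ refl) {v} c = realise {t = v} s
    (λ p → StepAt (toℕ (i ⊕ 1)) (v ²) p × StepAt (toℕ i) p (v ²)) (StepAt-cong (sym (toℕ-⊕1 i)) s , s′)
    where
    next = cupAt-next 3≤n c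
    s  = proj₁ (proj₂ next)
    s′ = proj₂ (proj₂ next)
  adjacent⇒linking {j = j} (inj₂ refl) {v} c = realise {t = v} s
    (λ p → StepAt (toℕ j) (v ²) p × StepAt (toℕ (j ⊕ 1)) p (v ²)) (s , StepAt-cong (sym (toℕ-⊕1 j)) s′)
    where
    prev = cupAt-prev 3≤n (CupAt-cong (toℕ-⊕1 j) c)
    s  = proj₁ (proj₂ prev)
    s′ = proj₂ (proj₂ prev)

  distant : ∀ {i j} → i ≢ j → ¬ Adjacent i j → Distant i j
  distant {i} {j} i≢j ¬adj = record { kept = D.kept ; made = D.made ; commute = λ {v} {u} {w} → commute {v} {u} {w} }
    where
    module D = DistantAt (distantAt (toℕ i) (toℕ j)
      (λ e → i≢j (trans (sym (⟦toℕ⟧ i)) (trans (⟦⟧-cong e) (⟦toℕ⟧ j))))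
      (λ e → ¬adj (inj₁ (trans (sym (⟦toℕ⟧ j)) (trans (⟦⟧-cong (sym e)) (sym (⊕1 i))))))
      (λ e → ¬adj (inj₂ (trans (sym (⟦toℕ⟧ i)) (trans (⟦⟧-cong e) (sym (⊕1 j)))))))
    commute : ∀ {v u w} → StepT i v u → StepT j u w → ∃ λ t → StepT j v t × StepT i t w
    commute {v} {u} {w} s s′ = realise {t = v} (proj₁ (proj₂ commuted))
      (λ p → StepAt (toℕ j) (v ²) p × StepAt (toℕ i) p (w ²)) (proj₂ commuted)
      where commuted = D.commute s s′

  module C = CommutativeRing Laurent.commutativeRing
  module CP = RingProperties C.ring
  module H = Hecke (affineSymmetric n)

  act : H.Expr → (RSYT → Laurent) → RSYT → Laurent
  act (H.const a) x v = a C.* x v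
  act (H.T i)     x   = T i x
  act (e H.+ f)   x v = act e x v C.+ act f x v
  act (e H.* f)   x   = act e (act f x)
  act (H.- e)     x v = C.- act e x v

  act-cong : ∀ e {x y} → x ≗ y → act e x ≗ act e y
  act-cong (H.const a) eq v = C.*-congˡ {a} (eq v)
  act-cong (H.T i)     eq   = T-cong i eq
  act-cong (e H.+ f)   eq v = C.+-cong (act-cong e eq v) (act-cong f eq v)
  act-cong (e H.* f)   eq   = act-cong e (act-cong f eq)
  act-cong (H.- e)     eq v = C.-‿cong (act-cong e eq v)

  -- A single induction over expressions for additivity and scaling together; a = 1 and y = 0 give
  -- the two.
  act-linear : ∀ e a x y → act e (λ v → a C.* x v C.+ y v) ≗ λ v → a C.* act e x v C.+ act e y v
  act-linear (H.const b) a x y v = Identities.linear Laurent.commutativeRing b a (x v) (y v)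
  act-linear (H.T i)     a x y   = T-linear i a x y
  act-linear (e H.+ f)   a x y v = C.trans (C.+-cong (act-linear e a x y v) (act-linear f a x y v))
    (Identities.linear-+ Laurent.commutativeRing a (act e x v) (act e y v) (act f x v) (act f y v))
  act-linear (e H.* f)   a x y v = C.trans (act-cong e (act-linear f a x y) v) (act-linear e a (act f x) (act f y) v)
  act-linear (H.- e)     a x y v = C.trans (C.-‿cong (act-linear e a x y v))
    (C.trans (C.sym (CP.-‿+-comm (a C.* act e x v) (act e y v))) (C.+-congʳ (CP.-‿distribʳ-* a (act e x v))))

  act-+ : ∀ e x y → act e (λ v → x v C.+ y v) ≗ λ v → act e x v C.+ act e y v
  act-+ e x y v = C.trans (act-cong e (λ w → C.+-congʳ (C.sym (C.*-identityˡ (x w)))) v)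
    (C.trans (act-linear e C.1# x y v) (C.+-congʳ (C.*-identityˡ (act e x v))))

  act-0 : ∀ e → act e (λ _ → C.0#) ≗ λ _ → C.0#
  act-0 e v = CP.+-identityˡ-unique (act e (λ _ → C.0#) v) (act e (λ _ → C.0#) v)
    (C.trans (C.sym (act-+ e (λ _ → C.0#) (λ _ → C.0#) v)) (act-cong e (λ _ → C.+-identityˡ C.0#) v))

  act-* : ∀ e a x → act e (λ v → a C.* x v) ≗ λ v → a C.* act e x v
  act-* e a x v = C.trans (act-cong e (λ w → C.sym (C.+-identityʳ (a C.* x w))) v)
    (C.trans (act-linear e a x (λ _ → C.0#) v) (C.trans (C.+-congˡ {a C.* act e x v} (act-0 e v)) (C.+-identityʳ _)))

  open CoxeterMatrix (affineSymmetric n) using (m)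

  m-cases : ∀ i j → i ≡ j ⊎ (Adjacent i j × m i j ≡ 3) ⊎ (i ≢ j × ¬ Adjacent i j × m i j ≡ 2)
  m-cases i j = cases (i Fin.≟ j) (adjacent? i j)
    where
    entry : Bool → Bool → ℕ
    entry equal adjacent = if equal then 1 else if adjacent then 3 else 2
    cases : Dec (i ≡ j) → Dec (Adjacent i j) → i ≡ j ⊎ (Adjacent i j × m i j ≡ 3) ⊎ (i ≢ j × ¬ Adjacent i j × m i j ≡ 2)
    cases (yes i≡j) _         = inj₁ i≡j
    cases (no i≢j) (yes adj)  = inj₂ (inj₁ (adj , cong₂ entry (dec-false (i Fin.≟ j) i≢j) (dec-true (adjacent? i j) adj)))
    cases (no i≢j) (no ¬adj)  = inj₂ (inj₂ (i≢j , ¬adj , cong₂ entry (dec-false (i Fin.≟ j) i≢j) (dec-false (adjacent? i j) ¬adj)))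

  act-alternating : ℕ → Fin n → Fin n → (RSYT → Laurent) → RSYT → Laurent
  act-alternating k i j = act (H.alternating k i j)

  act-braid : ∀ i j x → act-alternating (m i j) i j x ≗ act-alternating (m i j) j i x
  act-braid i j x v = cases (m-cases i j)
    where
    cases : i ≡ j ⊎ (Adjacent i j × m i j ≡ 3) ⊎ (i ≢ j × ¬ Adjacent i j × m i j ≡ 2) →
            act-alternating (m i j) i j x v C.≈ act-alternating (m i j) j i x v
    cases (inj₁ refl) = C.refl
    cases (inj₂ (inj₁ (adj , m≡3))) = subst (λ k → act-alternating k i j x v C.≈ act-alternating k j i x v) (sym m≡3)
      -- `alternating` ends in the factor `1#`, so the relation is applied to 1 · x instead of x.
      (T-braid (λ {u} → adjacent⇒linking adj {u}) (λ {u} → adjacent⇒linking (Sum.swap adj) {u}) (act H.1# x) v)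
    cases (inj₂ (inj₂ (i≢j , ¬adj , m≡2))) = subst (λ k → act-alternating k i j x v C.≈ act-alternating k j i x v) (sym m≡2)
      (T-commute (distant i≢j ¬adj) (distant (λ e → i≢j (sym e)) (λ adj → ¬adj (Sum.swap adj))) (act H.1# x) v)

  act-respects : ∀ {e f} → e H.≈ f → ∀ x → act e x ≗ act f x
  act-respects H.≈-refl x v = C.refl
  act-respects (H.≈-sym p) x v = C.sym (act-respects p x v)
  act-respects (H.≈-trans p r) x v = C.trans (act-respects p x v) (act-respects r x v)
  act-respects (H.+-cong p r) x v = C.+-cong (act-respects p x v) (act-respects r x v)
  act-respects (H.*-cong {e} {e′} {f} {f′} p r) x v =
    C.trans (act-respects p (act f x) v) (act-cong e′ (act-respects r x) v)
  act-respects (H.-‿cong p) x v = C.-‿cong (act-respects p x v)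
  act-respects (H.+-assoc e f g) x v = C.+-assoc (act e x v) (act f x v) (act g x v)
  act-respects (H.+-comm e f) x v = C.+-comm (act e x v) (act f x v)
  act-respects (H.+-identityˡ e) x v = C.+-identityˡ (act e x v)
  act-respects (H.-‿inverseˡ e) x v = C.-‿inverseˡ (act e x v)
  act-respects (H.*-assoc e f g) x v = C.refl
  act-respects (H.*-identityˡ e) x v = C.*-identityˡ (act e x v)
  act-respects (H.*-identityʳ e) x v = act-cong e (λ w → C.*-identityˡ (x w)) v
  act-respects (H.distribˡ e f g) x v = act-+ e (act f x) (act g x) v
  act-respects (H.distribʳ e f g) x v = C.refl
  act-respects (H.const-cong eq) x v = C.*-congʳ {x v} eq
  act-respects (H.const-+ a b) x v = C.distribʳ (x v) a b
  act-respects (H.const-* a b) x v = C.*-assoc a b (x v)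
  act-respects (H.const-central a e) x v = C.sym (act-* e a x v)
  act-respects (H.quadratic i) x v = C.trans (T-quadratic i x v) (C.sym (C.zeroˡ (x v)))
  act-respects (H.braid i j) x = act-braid i j x

  Γ : LabeledGraph n
  Γ = Γ̄ n λ₁ λ₂

  open WGraph (affineSymmetric n) Γ using (Free; coeff; support; basis; neighbours; T-basis; _≈ᴹ_; mk≈ᴹ; coeff-≈; _+ᴹ_; _*ₗ_; 0ᴹ; -ᴹ_)

  infixr 7 _∙_
  _∙_ : H.Expr → Free → Free
  (e ∙ x) .coeff   = act e (coeff x)
  (e ∙ x) .support = allRSYT , λ w w∉ → ⊥-elim (w∉ (∈-allRSYT w))

  isLeftModule : IsLeftModule H.ring _≈ᴹ_ _+ᴹ_ 0ᴹ -ᴹ_ _∙_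
  isLeftModule = record
    { isLeftSemimodule = record
      { +ᴹ-isCommutativeMonoid = record
        { isMonoid = record
          { isSemigroup = record
            { isMagma = record
              { isEquivalence = record
                { refl  = mk≈ᴹ λ v → C.refl
                ; sym   = λ eq → mk≈ᴹ λ v → C.sym (coeff-≈ eq v)
                ; trans = λ eq eq′ → mk≈ᴹ λ v → C.trans (coeff-≈ eq v) (coeff-≈ eq′ v)
                }
              ; ∙-cong = λ eq eq′ → mk≈ᴹ λ v → C.+-cong (coeff-≈ eq v) (coeff-≈ eq′ v)
              }
            ; assoc = λ x y z → mk≈ᴹ λ v → C.+-assoc (coeff x v) (coeff y v) (coeff z v)
            }
          ; identity = (λ x → mk≈ᴹ λ v → C.+-identityˡ (coeff x v)) , (λ x → mk≈ᴹ λ v → C.+-identityʳ (coeff x v))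
          }
        ; comm = λ x y → mk≈ᴹ λ v → C.+-comm (coeff x v) (coeff y v)
        }
      ; isPreleftSemimodule = record
        { *ₗ-cong      = λ {e} {f} {x} {y} eq eq′ → mk≈ᴹ λ v → C.trans (act-respects eq (coeff x) v) (act-cong f (coeff-≈ eq′) v)
        ; *ₗ-zeroˡ     = λ x → mk≈ᴹ λ v → C.zeroˡ (coeff x v)
        ; *ₗ-distribʳ  = λ x e f → mk≈ᴹ λ v → C.refl
        ; *ₗ-identityˡ = λ x → mk≈ᴹ λ v → C.*-identityˡ (coeff x v)
        ; *ₗ-assoc     = λ e f x → mk≈ᴹ λ v → C.refl
        ; *ₗ-zeroʳ     = λ e → mk≈ᴹ (act-0 e)
        ; *ₗ-distribˡ  = λ e x y → mk≈ᴹ (act-+ e (coeff x) (coeff y))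
        }
      }
    ; -ᴹ‿cong    = λ eq → mk≈ᴹ λ v → C.-‿cong (coeff-≈ eq v)
    ; -ᴹ‿inverse = (λ x → mk≈ᴹ λ v → C.-‿inverseˡ (coeff x v)) , (λ x → mk≈ᴹ λ v → C.-‿inverseʳ (coeff x v))
    }

  indicator : ∀ {a} {P : Set a} → Dec P → Laurent
  indicator d = if does d then C.1# else C.0#

  indicator-⇔ : ∀ {a b} {P : Set a} {Q : Set b} (d : Dec P) (e : Dec Q) → (P → Q) → (Q → P) → indicator d ≡ indicator e
  indicator-⇔ (yes _) (yes _) _ _ = refl
  indicator-⇔ (no _)  (no _)  _ _ = refl
  indicator-⇔ (yes p) (no ¬q) f _ = ⊥-elim (¬q (f p))
  indicator-⇔ (no ¬p) (yes q) _ g = ⊥-elim (¬p (g q))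

  indicator-no : ∀ {a} {P : Set a} (d : Dec P) → ¬ P → indicator d ≡ C.0#
  indicator-no (yes p) ¬p = ⊥-elim (¬p p)
  indicator-no (no _)  _  = refl

  T-basis-∈ : ∀ i u v → i ∈ des u → coeff (T-basis i u) v ≡ C.- coeff (basis u) v C.+ q½ C.* coeff (neighbours i u) v
  T-basis-∈ i u v i∈ = cong (λ b → coeff (if b then -ᴹ basis u +ᴹ q½ *ₗ neighbours i u else Laurent.q *ₗ basis u) v)
                            (dec-true (i ∈? des u) i∈)

  T-basis-∉ : ∀ i u v → ¬ i ∈ des u → coeff (T-basis i u) v ≡ Laurent.q C.* coeff (basis u) v
  T-basis-∉ i u v i∉ = cong (λ b → coeff (if b then -ᴹ basis u +ᴹ q½ *ₗ neighbours i u else Laurent.q *ₗ basis u) v)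
                            (dec-false (i ∈? des u) i∉)

  neighbours-∈ : ∀ i u v → i ∈ des v → coeff (neighbours i u) v ≡ C.0#
  neighbours-∈ i u v i∈ = cong (λ b → if b then C.0# else indicator (move? u v)) (dec-true (i ∈? des v) i∈)

  neighbours-∉ : ∀ i u v → ¬ i ∈ des v → coeff (neighbours i u) v ≡ indicator (move? u v)
  neighbours-∉ i u v i∉ = cong (λ b → if b then C.0# else indicator (move? u v)) (dec-false (i ∈? des v) i∉)

  -- Compare the coefficients at v. If i lies in des u but not in des v, both sides are q½ exactly
  -- when the step of i from v leads to u, by `step⇒move` and `move⇒step`. If i is not in des u, no
  -- step ends in u, since steps end in cups, and only the diagonal entry q remains.
  T-action : ∀ i u → H.T i ∙ basis u ≈ᴹ T-basis i u
  T-action i u = mk≈ᴹ λ v → cases v (i ∈? des u) (view i v)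
    where
    open SetoidReasoning C.setoid
    δᵤ : RSYT → Laurent
    δᵤ = coeff (basis u)
    δᵤ-≢ : ∀ v → u ≢ v → δᵤ v ≡ C.0#
    δᵤ-≢ v u≢v = indicator-no (TwoRow._≟_ n λ₁ λ₂ u v) u≢v
    source-∉ : ∀ v w → StepT i v w → ¬ i ∈ des v
    source-∉ v w s i∈ = StepAt-source 2≤n s (∈des⇒ v i i∈)
    differ : ∀ v → i ∈ des u → ¬ i ∈ des v → u ≢ v
    differ _ i∈ i∉ refl = i∉ i∈
    row : ∀ v → i ∈ des u → ¬ i ∈ des v → coeff (T-basis i u) v C.≈ q½ C.* indicator (move? u v)
    row v i∈ i∉ = begin
      coeff (T-basis i u) v                            ≡⟨ T-basis-∈ i u v i∈ ⟩
      C.- δᵤ v C.+ q½ C.* coeff (neighbours i u) v     ≡⟨ cong₂ (λ x y → C.- x C.+ q½ C.* y) (δᵤ-≢ v (differ v i∈ i∉)) (neighbours-∉ i u v i∉) ⟩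
      C.- C.0# C.+ q½ C.* indicator (move? u v)        ≈⟨ C.trans (C.+-congʳ CP.-0#≈0#) (C.+-identityˡ _) ⟩
      q½ C.* indicator (move? u v)                     ∎
    cases : ∀ v → Dec (i ∈ des u) → View i v → T i δᵤ v C.≈ coeff (T-basis i u) v
    cases v (yes i∈) (cup c) = begin
      T i δᵤ v                                         ≈⟨ T-cup {i} {v} c δᵤ ⟩
      C.- δᵤ v                                         ≈⟨ C.+-identityʳ _ ⟨
      C.- δᵤ v C.+ C.0#                                ≈⟨ C.+-congˡ {C.- δᵤ v} (C.zeroʳ q½) ⟨
      C.- δᵤ v C.+ q½ C.* C.0#                         ≡⟨ cong (λ y → C.- δᵤ v C.+ q½ C.* y) (neighbours-∈ i u v (∈des⇐ v i c)) ⟨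
      C.- δᵤ v C.+ q½ C.* coeff (neighbours i u) v     ≡⟨ T-basis-∈ i u v i∈ ⟨
      coeff (T-basis i u) v                            ∎
    cases v (yes i∈) (step {w} s) = begin
      T i δᵤ v                                         ≈⟨ T-step {i} {v} {w} s δᵤ ⟩
      q C.* δᵤ v C.+ q½ C.* δᵤ w                       ≡⟨ cong₂ (λ x y → q C.* x C.+ q½ C.* y) (δᵤ-≢ v (differ v i∈ (source-∉ v w s))) edge ⟩
      q C.* C.0# C.+ q½ C.* indicator (move? u v)      ≈⟨ C.trans (C.+-congʳ (C.zeroʳ q)) (C.+-identityˡ _) ⟩
      q½ C.* indicator (move? u v)                     ≈⟨ row v i∈ (source-∉ v w s) ⟨
      coeff (T-basis i u) v                            ∎
      where
      edge : δᵤ w ≡ indicator (move? u v)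
      edge = indicator-⇔ (TwoRow._≟_ n λ₁ λ₂ u w) (move? u v) (λ { refl → step⇒move {u} {v} 3≤n s })
        λ move → ²-injective {u} {w} (StepAt-functional (move⇒step {u} {v} 3≤n move (∈des⇒ u i i∈) (StepAt-source 2≤n s)) s)
    cases v (yes i∈) (none ¬c ¬s) = begin
      T i δᵤ v                                         ≈⟨ T-none {i} {v} ¬c ¬s δᵤ ⟩
      q C.* δᵤ v                                       ≡⟨ cong (q C.*_) (δᵤ-≢ v (differ v i∈ (λ i∈v → ¬c (∈des⇒ v i i∈v)))) ⟩
      q C.* C.0#                                       ≈⟨ C.trans (C.zeroʳ q) (C.sym (C.zeroʳ q½)) ⟩
      q½ C.* C.0#                                      ≡⟨ cong (q½ C.*_) (indicator-no (move? u v) λ move → ¬s (u , move⇒step {u} {v} 3≤n move (∈des⇒ u i i∈) ¬c)) ⟨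
      q½ C.* indicator (move? u v)                     ≈⟨ row v i∈ (λ i∈v → ¬c (∈des⇒ v i i∈v)) ⟨
      coeff (T-basis i u) v                            ∎
    cases v (no i∉) (cup c) = begin
      T i δᵤ v                                         ≈⟨ T-cup {i} {v} c δᵤ ⟩
      C.- δᵤ v                                         ≡⟨ cong C.-_ δᵤv ⟩
      C.- C.0#                                         ≈⟨ C.trans CP.-0#≈0# (C.sym (C.zeroʳ q)) ⟩
      q C.* C.0#                                       ≡⟨ cong (q C.*_) δᵤv ⟨
      q C.* δᵤ v                                       ≡⟨ T-basis-∉ i u v i∉ ⟨
      coeff (T-basis i u) v                            ∎
      where
      δᵤv : δᵤ v ≡ C.0#
      δᵤv = δᵤ-≢ v λ { refl → i∉ (∈des⇐ v i c) }
    cases v (no i∉) (step {w} s) = begin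
      T i δᵤ v                                         ≈⟨ T-step {i} {v} {w} s δᵤ ⟩
      q C.* δᵤ v C.+ q½ C.* δᵤ w                       ≡⟨ cong (λ y → q C.* δᵤ v C.+ q½ C.* y) (δᵤ-≢ w λ { refl → i∉ (∈des⇐ w i (StepAt-target 2≤n s)) }) ⟩
      q C.* δᵤ v C.+ q½ C.* C.0#                       ≈⟨ C.trans (C.+-congˡ {q C.* δᵤ v} (C.zeroʳ q½)) (C.+-identityʳ _) ⟩
      q C.* δᵤ v                                       ≡⟨ T-basis-∉ i u v i∉ ⟨
      coeff (T-basis i u) v                            ∎
    cases v (no i∉) (none ¬c ¬s) = begin
      T i δᵤ v                                         ≈⟨ T-none {i} {v} ¬c ¬s δᵤ ⟩
      q C.* δᵤ v                                       ≡⟨ T-basis-∉ i u v i∉ ⟨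
      coeff (T-basis i u) v                            ∎

  isWGraph : IsWGraph (affineSymmetric n) Γ
  isWGraph = record
    { _∙_          = _∙_
    ; isLeftModule = isLeftModule
    ; const-action = λ a x → mk≈ᴹ λ v → C.refl
    ; T-action     = T-action
    }

theorem4p9 : (n λ₁ λ₂ : ℕ) .{{_ : NonZero n}} → 3 ≤ n →
    λ₁ + λ₂ ≡ n → λ₂ ≤ λ₁ → 1 ≤ λ₂ →
    IsWGraph (affineSymmetric n) (Γ̄ n λ₁ λ₂)
theorem4p9 n λ₁ λ₂ 3≤n λ₁+λ₂≡n _ _ = Action.isWGraph n λ₁ λ₂ 3≤n λ₁+λ₂≡n
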